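{- For every constant $c$ with $1\leq c<d_3^{ - }$, the complex $\mathrm{Hom}(G(n,c/n),K_3)$ is disconnected with probability tending to $1$ as $n\to\infty$.
   Context: $G(n,p)$ is the Erdős–Rényi random graph on $n$ vertices with each edge present independently with probability $p$; $K_3$ is the triangle. By Achlioptas–Friedgut there is a sequence $d_3(n)$ such that for every $\epsilon>0$: if $c<(1-\epsilon)d_3(n)$ then $\Pr[\chi(G(n,c/n))\le 3]\to 1$, and if $c>(1+\epsilon)d_3(n)$ then $\Pr[\chi(G(n,c/n))\ge 4]\to1$; $d_3^-:=\liminf_{n\to\infty}d_3(n)$. For graphs $G,H$, $\mathrm{Hom}(G,H)$ is the polyhedral complex whose cells are functions $\eta:V(G)\to 2^{V(H)}\setminus\{\varnothing\}$ with $\eta(x)\times\eta(y)\subseteq E(H)$ whenever $\{x,y\}\in E(G)$; the cell $\eta$ is a product of simplices of dimension $\sum_v(|\eta(v)|-1)$, with face relation $\eta\subseteq\tau$ iff $\eta(v)\subseteq\tau(v)$. Disconnected means nonempty with more than one path component. -}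

module Defs where

open import Data.Bool using (Bool; true; false; T)
open import Data.Empty using (⊥)
open import Data.Fin using (Fin; zero; suc)
open import Data.Integer using (+_)
open import Data.List using (List; []; _∷_; map; _++_; foldr; filterᵇ; cartesianProductWith)
open import Data.Nat using (ℕ; zero; suc; NonZero)
import Data.Nat as ℕ
import Data.Nat.Properties as ℕₚ
open import Data.Product using (Σ; ∃; ∃-syntax; _×_; _,_; proj₁; proj₂)
open import Data.Rational using (ℚ; 0ℚ; 1ℚ; ½)
import Data.Rational as ℚ
import Data.Rational.Properties as ℚₚ
open import Data.Rational.Solver using (module +-*-Solver)
open import Data.Vec using (Vec; []; _∷_; lookup)
import Data.Vec as Vec
import Data.Vec.Functional as VF
open import Relation.Binary.PropositionalEquality
  using (_≡_; _≢_; refl; sym; cong; subst; module ≡-Reasoning)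
open import Relation.Nullary using (¬_)

------------------------------------------------------------------------
-- Real numbers: Cauchy sequences of rationals, with pointwise operations.
-- Equality of reals is the setoid equality _≃_.

IsCauchy : (ℕ → ℚ) → Set
IsCauchy s = ∀ ε → 0ℚ ℚ.< ε →
             ∃[ N ] ∀ m n → N ℕ.≤ m → N ℕ.≤ n → ℚ.∣ s m ℚ.- s n ∣ ℚ.< ε

record ℝ : Set where
  constructor mkℝ
  field
    seq    : ℕ → ℚ
    cauchy : IsCauchy seq

open ℝ public

private
  open +-*-Solver using (solve; _:=_; _:+_; _:*_; _:-_; :-_; con)

  half-pos : ∀ {ε} → 0ℚ ℚ.< ε → 0ℚ ℚ.< ε ℚ.* ½
  half-pos = ℚₚ.*-monoˡ-<-pos ½

  halves : ∀ ε → ε ℚ.* ½ ℚ.+ ε ℚ.* ½ ≡ ε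
  halves = solve 1 (λ ε → ε :* con ½ :+ ε :* con ½ := ε) refl

  ∣-∣-swap : ∀ p q → ℚ.∣ p ℚ.- q ∣ ≡ ℚ.∣ q ℚ.- p ∣
  ∣-∣-swap p q = begin
    ℚ.∣ p ℚ.- q ∣          ≡⟨ sym (ℚₚ.∣-p∣≡∣p∣ (p ℚ.- q)) ⟩
    ℚ.∣ ℚ.- (p ℚ.- q) ∣    ≡⟨ cong ℚ.∣_∣ (solve 2 (λ p q → :- (p :- q) := q :- p) refl p q) ⟩
    ℚ.∣ q ℚ.- p ∣          ∎
    where open ≡-Reasoning

  bounded : (x : ℝ) →
            ∃[ b ] 0ℚ ℚ.< b × (∃[ N ] ∀ n → N ℕ.≤ n → ℚ.∣ seq x n ∣ ℚ.≤ b)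
  bounded x with cauchy x 1ℚ (ℚₚ.positive⁻¹ 1ℚ)
  ... | N , close = b , b-pos , N , bound
    where
    b : ℚ
    b = 1ℚ ℚ.+ ℚ.∣ seq x N ∣

    b-pos : 0ℚ ℚ.< b
    b-pos = ℚₚ.+-mono-<-≤ (ℚₚ.positive⁻¹ 1ℚ) (ℚₚ.0≤∣p∣ (seq x N))

    bound : ∀ n → N ℕ.≤ n → ℚ.∣ seq x n ∣ ℚ.≤ b
    bound n N≤n = begin
      ℚ.∣ seq x n ∣
        ≡⟨ cong ℚ.∣_∣ (solve 2 (λ a c → a := (a :- c) :+ c) refl (seq x n) (seq x N)) ⟩
      ℚ.∣ (seq x n ℚ.- seq x N) ℚ.+ seq x N ∣
        ≤⟨ ℚₚ.∣p+q∣≤∣p∣+∣q∣ (seq x n ℚ.- seq x N) (seq x N) ⟩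
      ℚ.∣ seq x n ℚ.- seq x N ∣ ℚ.+ ℚ.∣ seq x N ∣
        ≤⟨ ℚₚ.+-monoˡ-≤ ℚ.∣ seq x N ∣ (ℚₚ.<⇒≤ (close n N N≤n ℕₚ.≤-refl)) ⟩
      b ∎
      where open ℚₚ.≤-Reasoning

  -- Shrinks a tolerance ε to δ so that factors bounded by b keep errors below ε.
  shrink : ∀ b ε → 0ℚ ℚ.< b → 0ℚ ℚ.< ε →
           ∃[ δ ] 0ℚ ℚ.< δ × (∀ p q → ℚ.∣ p ∣ ℚ.≤ b → ℚ.∣ q ∣ ℚ.< δ → ℚ.∣ p ℚ.* q ∣ ℚ.< ε)
  shrink b ε 0<b 0<ε = δ , 0<δ , small
    where
    instance
      b-positive : ℚ.Positive b
      b-positive = ℚ.positive 0<b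

      b-nonZero : ℚ.NonZero b
      b-nonZero = ℚₚ.pos⇒nonZero b

      inv-positive : ℚ.Positive (ℚ.1/ b)
      inv-positive = ℚₚ.1/pos⇒pos b

    δ : ℚ
    δ = ε ℚ.* (ℚ.1/ b)

    0<δ : 0ℚ ℚ.< δ
    0<δ = subst (ℚ._< δ) (ℚₚ.*-zeroˡ (ℚ.1/ b)) (ℚₚ.*-monoˡ-<-pos (ℚ.1/ b) 0<ε)

    bδ≡ε : b ℚ.* δ ≡ ε
    bδ≡ε = begin
      b ℚ.* (ε ℚ.* (ℚ.1/ b))  ≡⟨ solve 3 (λ b ε c → b :* (ε :* c) := ε :* (b :* c)) refl b ε (ℚ.1/ b) ⟩
      ε ℚ.* (b ℚ.* (ℚ.1/ b))  ≡⟨ cong (ε ℚ.*_) (ℚₚ.*-inverseʳ b) ⟩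
      ε ℚ.* 1ℚ                ≡⟨ ℚₚ.*-identityʳ ε ⟩
      ε                       ∎
      where open ≡-Reasoning

    small : ∀ p q → ℚ.∣ p ∣ ℚ.≤ b → ℚ.∣ q ∣ ℚ.< δ → ℚ.∣ p ℚ.* q ∣ ℚ.< ε
    small p q ∣p∣≤b ∣q∣<δ = begin-strict
      ℚ.∣ p ℚ.* q ∣           ≡⟨ ℚₚ.∣p*q∣≡∣p∣*∣q∣ p q ⟩
      ℚ.∣ p ∣ ℚ.* ℚ.∣ q ∣     ≤⟨ ℚₚ.*-monoʳ-≤-nonNeg ℚ.∣ q ∣ {{ℚₚ.∣-∣-nonNeg q}} ∣p∣≤b ⟩
      b ℚ.* ℚ.∣ q ∣           <⟨ ℚₚ.*-monoʳ-<-pos b ∣q∣<δ ⟩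
      b ℚ.* δ                 ≡⟨ bδ≡ε ⟩
      ε                       ∎
      where open ℚₚ.≤-Reasoning

-- Abstract, so that normalising a real does not unfold these proofs.
abstract
  const-cauchy : ∀ q → IsCauchy (λ _ → q)
  const-cauchy q = λ ε 0<ε → 0 , λ _ _ _ _ →
    subst (ℚ._< ε) (sym (cong ℚ.∣_∣ (ℚₚ.+-inverseʳ q))) 0<ε

  +-cauchy : ∀ x y → IsCauchy (λ n → seq x n ℚ.+ seq y n)
  +-cauchy x y = λ ε 0<ε →
    let N₁ , f = cauchy x (ε ℚ.* ½) (half-pos 0<ε)
        N₂ , g = cauchy y (ε ℚ.* ½) (half-pos 0<ε)
    in N₁ ℕ.⊔ N₂ , λ m n N≤m N≤n →
      let open ℚₚ.≤-Reasoning
          a = seq x m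
          a′ = seq x n
          b = seq y m
          b′ = seq y n
      in begin-strict
        ℚ.∣ (a ℚ.+ b) ℚ.- (a′ ℚ.+ b′) ∣
          ≡⟨ cong ℚ.∣_∣ (solve 4 (λ a b c d → (a :+ b) :- (c :+ d) := (a :- c) :+ (b :- d))
                           refl a b a′ b′) ⟩
        ℚ.∣ (a ℚ.- a′) ℚ.+ (b ℚ.- b′) ∣
          ≤⟨ ℚₚ.∣p+q∣≤∣p∣+∣q∣ (a ℚ.- a′) (b ℚ.- b′) ⟩
        ℚ.∣ a ℚ.- a′ ∣ ℚ.+ ℚ.∣ b ℚ.- b′ ∣
          <⟨ ℚₚ.+-mono-< (f m n (ℕₚ.m⊔n≤o⇒m≤o N₁ N₂ N≤m) (ℕₚ.m⊔n≤o⇒m≤o N₁ N₂ N≤n))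
                         (g m n (ℕₚ.m⊔n≤o⇒n≤o N₁ N₂ N≤m) (ℕₚ.m⊔n≤o⇒n≤o N₁ N₂ N≤n)) ⟩
        ε ℚ.* ½ ℚ.+ ε ℚ.* ½
          ≡⟨ halves ε ⟩
        ε ∎

  neg-cauchy : ∀ x → IsCauchy (λ n → ℚ.- seq x n)
  neg-cauchy x = λ ε 0<ε →
    let N , f = cauchy x ε 0<ε
    in N , λ m n N≤m N≤n →
      subst (ℚ._< ε)
        (cong ℚ.∣_∣ (solve 2 (λ a b → b :- a := (:- a) :- (:- b)) refl (seq x m) (seq x n)))
        (f n m N≤n N≤m)

  *-cauchy : ∀ x y → IsCauchy (λ n → seq x n ℚ.* seq y n)
  *-cauchy x y = λ ε 0<ε →
    let A , 0<A , M₁ , bx = bounded x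
        B , 0<B , M₂ , by = bounded y
        δ₁ , 0<δ₁ , s₁ = shrink A (ε ℚ.* ½) 0<A (half-pos 0<ε)
        δ₂ , 0<δ₂ , s₂ = shrink B (ε ℚ.* ½) 0<B (half-pos 0<ε)
        N₁ , f = cauchy y δ₁ 0<δ₁
        N₂ , g = cauchy x δ₂ 0<δ₂
        M = M₁ ℕ.⊔ M₂
        N = N₁ ℕ.⊔ N₂
    in M ℕ.⊔ N , λ m n K≤m K≤n →
      let open ℚₚ.≤-Reasoning
          M≤m = ℕₚ.m⊔n≤o⇒m≤o M N K≤m
          N≤m = ℕₚ.m⊔n≤o⇒n≤o M N K≤m
          M≤n = ℕₚ.m⊔n≤o⇒m≤o M N K≤n
          N≤n = ℕₚ.m⊔n≤o⇒n≤o M N K≤n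
          a = seq x m
          a′ = seq x n
          b = seq y m
          b′ = seq y n
      in begin-strict
        ℚ.∣ a ℚ.* b ℚ.- a′ ℚ.* b′ ∣
          ≡⟨ cong ℚ.∣_∣ (solve 4 (λ a b c d → a :* b :- c :* d := a :* (b :- d) :+ d :* (a :- c))
                           refl a b a′ b′) ⟩
        ℚ.∣ a ℚ.* (b ℚ.- b′) ℚ.+ b′ ℚ.* (a ℚ.- a′) ∣
          ≤⟨ ℚₚ.∣p+q∣≤∣p∣+∣q∣ (a ℚ.* (b ℚ.- b′)) (b′ ℚ.* (a ℚ.- a′)) ⟩
        ℚ.∣ a ℚ.* (b ℚ.- b′) ∣ ℚ.+ ℚ.∣ b′ ℚ.* (a ℚ.- a′) ∣
          <⟨ ℚₚ.+-mono-<
               (s₁ a (b ℚ.- b′) (bx m (ℕₚ.m⊔n≤o⇒m≤o M₁ M₂ M≤m))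
                 (f m n (ℕₚ.m⊔n≤o⇒m≤o N₁ N₂ N≤m) (ℕₚ.m⊔n≤o⇒m≤o N₁ N₂ N≤n)))
               (s₂ b′ (a ℚ.- a′) (by n (ℕₚ.m⊔n≤o⇒n≤o M₁ M₂ M≤n))
                 (g m n (ℕₚ.m⊔n≤o⇒n≤o N₁ N₂ N≤m) (ℕₚ.m⊔n≤o⇒n≤o N₁ N₂ N≤n))) ⟩
        ε ℚ.* ½ ℚ.+ ε ℚ.* ½
          ≡⟨ halves ε ⟩
        ε ∎

fromℚ : ℚ → ℝ
fromℚ q = mkℝ (λ _ → q) (const-cauchy q)

fromℕ : ℕ → ℝ
fromℕ n = fromℚ (+ n ℚ./ 1)

0ℝ 1ℝ : ℝ
0ℝ = fromℚ 0ℚ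
1ℝ = fromℚ 1ℚ

infixl 6 _+_ _-_
infixl 7 _*_ _/ℕ_
infix  8 -_
infix  4 _<_ _≤_ _≃_ ∣_-_∣<_

_+_ : ℝ → ℝ → ℝ
x + y = mkℝ (λ n → seq x n ℚ.+ seq y n) (+-cauchy x y)

-_ : ℝ → ℝ
- x = mkℝ (λ n → ℚ.- seq x n) (neg-cauchy x)

_-_ : ℝ → ℝ → ℝ
x - y = x + (- y)

_*_ : ℝ → ℝ → ℝ
x * y = mkℝ (λ n → seq x n ℚ.* seq y n) (*-cauchy x y)

_/ℕ_ : ℝ → (n : ℕ) → .{{_ : NonZero n}} → ℝ
x /ℕ n = x * fromℚ (+ 1 ℚ./ n)

_<_ : ℝ → ℝ → Set
x < y = ∃[ ε ] 0ℚ ℚ.< ε × (∃[ N ] ∀ n → N ℕ.≤ n → seq x n ℚ.+ ε ℚ.≤ seq y n)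

_≤_ : ℝ → ℝ → Set
x ≤ y = ¬ (y < x)

_≃_ : ℝ → ℝ → Set
x ≃ y = x ≤ y × y ≤ x

∣_-_∣<_ : ℝ → ℝ → ℝ → Set
∣ x - y ∣< ε = (x - y < ε) × (y - x < ε)

------------------------------------------------------------------------
-- Asymptotics

Eventually : (ℕ → Set) → Set
Eventually P = ∃[ N ] ∀ n → N ℕ.≤ n → P n

record IsLiminf (a : ℕ → ℝ) (ℓ : ℝ) : Set where
  field
    eventually-above : ∀ ε → 0ℝ < ε → Eventually (λ n → ℓ - ε < a n)
    frequently-below : ∀ ε → 0ℝ < ε → ∀ N → ∃[ n ] N ℕ.≤ n × (a n < ℓ + ε)

------------------------------------------------------------------------
-- Simple graphs on the vertex set Fin n

record Graph (n : ℕ) : Set₁ where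
  field
    E        : Fin n → Fin n → Set
    E-sym    : ∀ {u v} → E u v → E v u
    E-irrefl : ∀ {v} → ¬ E v v

open Graph public

K : (m : ℕ) → Graph m
K m = record
  { E        = _≢_
  ; E-sym    = λ i≢j j≡i → i≢j (sym j≡i)
  ; E-irrefl = λ i≢i → i≢i refl
  }

Colourable : ∀ {n} → Graph n → ℕ → Set
Colourable {n} G k = Σ (Fin n → Fin k) λ f → ∀ u v → E G u v → f u ≢ f v

χ[_]≡_ : ∀ {n} → Graph n → ℕ → Set
χ[ G ]≡ k = Colourable G k × (∀ j → Colourable G j → k ℕ.≤ j)

χ[_]≤_ : ∀ {n} → Graph n → ℕ → Set
χ[ G ]≤ k = ∃[ j ] χ[ G ]≡ j × j ℕ.≤ k

χ[_]≥_ : ∀ {n} → Graph n → ℕ → Set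
χ[ G ]≥ k = ∃[ j ] χ[ G ]≡ j × k ℕ.≤ j

------------------------------------------------------------------------
-- The random graph G(n,p)

-- One bit for each two-element subset of Fin n: the row of a vertex holds
-- its bits towards the later vertices.
data EdgeBits : ℕ → Set where
  []  : EdgeBits 0
  _∷_ : ∀ {n} → Vec Bool n → EdgeBits n → EdgeBits (suc n)

Adjacent : ∀ {n} → EdgeBits n → Fin n → Fin n → Set
Adjacent (row ∷ ω) zero    zero    = ⊥
Adjacent (row ∷ ω) zero    (suc j) = T (lookup row j)
Adjacent (row ∷ ω) (suc i) zero    = T (lookup row i)
Adjacent (row ∷ ω) (suc i) (suc j) = Adjacent ω i j

graph : ∀ {n} → EdgeBits n → Graph n
graph ω = record { E = Adjacent ω ; E-sym = symm ω _ _ ; E-irrefl = irr ω _ }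
  where
  symm : ∀ {n} (ω : EdgeBits n) u v → Adjacent ω u v → Adjacent ω v u
  symm (row ∷ ω) zero    (suc j) e = e
  symm (row ∷ ω) (suc i) zero    e = e
  symm (row ∷ ω) (suc i) (suc j) e = symm ω i j e

  irr : ∀ {n} (ω : EdgeBits n) v → ¬ Adjacent ω v v
  irr (row ∷ ω) (suc i) e = irr ω i e

allRows : (n : ℕ) → List (Vec Bool n)
allRows zero    = [] ∷ []
allRows (suc n) = map (true ∷_) (allRows n) ++ map (false ∷_) (allRows n)

allEdgeBits : (n : ℕ) → List (EdgeBits n)
allEdgeBits zero    = [] ∷ []
allEdgeBits (suc n) = cartesianProductWith _∷_ (allRows n) (allEdgeBits n)

bitWeight : ℝ → Bool → ℝ
bitWeight p true  = p
bitWeight p false = 1ℝ - p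

weight : ∀ {n} → ℝ → EdgeBits n → ℝ
weight p []        = 1ℝ
weight p (row ∷ ω) = Vec.foldr′ (λ b r → bitWeight p b * r) 1ℝ row * weight p ω

-- The probability under G(n,p) of an event given by its indicator function.
Pr : ∀ {n} → ℝ → (EdgeBits n → Bool) → ℝ
Pr {n} p B = foldr _+_ 0ℝ (map (weight p) (filterᵇ B (allEdgeBits n)))

GraphProperty : Set₁
GraphProperty = ∀ {n} → Graph n → Set

-- Pr[A(G(n,c(n)/n))] → 1 as n → ∞.  As A need not come with a decision
-- procedure, Pr[A] is read as an inner probability: A contains events, given
-- by indicator functions, whose probabilities tend to 1.  When A is decidable
-- (classically, always) one may take the indicator of A itself.
HoldsWHP : (c : ℕ → ℝ) → GraphProperty → Set
HoldsWHP c A =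
  Σ ((n : ℕ) → EdgeBits n → Bool) λ B →
    (∀ n ω → T (B n ω) → A (graph ω)) ×
    (∀ ε → 0ℝ < ε → ∃[ N ] ∀ n .{{_ : NonZero n}} → N ℕ.≤ n →
       ∣ Pr (c n /ℕ n) (B n) - 1ℝ ∣< ε)

-- d is a sharp threshold sequence for k-colourability of G(n,c/n).  The
-- average degree c may vary with n, subject to c(n)/n being a probability.
record IsColouringThreshold (k : ℕ) (d : ℕ → ℝ) : Set where
  field
    below : ∀ ε (c : ℕ → ℝ) → 0ℝ < ε →
            Eventually (λ n → 0ℝ ≤ c n × c n ≤ fromℕ n × c n < (1ℝ - ε) * d n) →
            HoldsWHP c (λ G → χ[ G ]≤ k)
    above : ∀ ε (c : ℕ → ℝ) → 0ℝ < ε →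
            Eventually (λ n → 0ℝ ≤ c n × c n ≤ fromℕ n × (1ℝ + ε) * d n < c n) →
            HoldsWHP c (λ G → χ[ G ]≥ suc k)

------------------------------------------------------------------------
-- The polyhedral complex Hom(G,H)

-- Nonempty subsets of V(H) are given as inhabited predicates.
IsCell : ∀ {n m} → Graph n → Graph m → (Fin n → Fin m → Set) → Set
IsCell G H η =
  (∀ v → ∃[ i ] η v i) ×
  (∀ u v → E G u v → ∀ i j → η u i → η v j → E H i j)

-- A point of the geometric realisation.  The closed cell η is the product over
-- v ∈ V(G) of the simplices spanned by η(v), and faces are glued along
-- inclusion of cells, so the realisation is a subspace of the product of copies
-- of the full simplex on V(H).  In barycentric coordinates, a point of that
-- product lies in some cell exactly when its supports form a cell, namely the
-- unique one containing it in its interior.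
record HomPoint {n m : ℕ} (G : Graph n) (H : Graph m) : Set where
  field
    coord    : Fin n → Fin m → ℝ
    nonneg   : ∀ v i → 0ℝ ≤ coord v i
    sum-one  : ∀ v → VF.foldr _+_ 0ℝ (coord v) ≃ 1ℝ
    support  : IsCell G H (λ v i → 0ℝ < coord v i)

open HomPoint public

UnitInterval : Set
UnitInterval = Σ ℝ λ t → 0ℝ ≤ t × t ≤ 1ℝ

0≤1 : 0ℝ ≤ 1ℝ
0≤1 (ε , 0<ε , N , f) = ℚₚ.<-irrefl refl (begin-strict
  0ℚ            <⟨ ℚₚ.positive⁻¹ 1ℚ ⟩
  1ℚ            ≡⟨ sym (ℚₚ.+-identityʳ 1ℚ) ⟩
  1ℚ ℚ.+ 0ℚ     ≤⟨ ℚₚ.+-monoʳ-≤ 1ℚ (ℚₚ.<⇒≤ 0<ε) ⟩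
  1ℚ ℚ.+ ε      ≤⟨ f N ℕₚ.≤-refl ⟩
  0ℚ            ∎)
  where open ℚₚ.≤-Reasoning

≤-refl : ∀ x → x ≤ x
≤-refl x (ε , 0<ε , N , f) = ℚₚ.<-irrefl refl (begin-strict
  seq x N            ≡⟨ sym (ℚₚ.+-identityʳ (seq x N)) ⟩
  seq x N ℚ.+ 0ℚ     <⟨ ℚₚ.+-monoʳ-< (seq x N) 0<ε ⟩
  seq x N ℚ.+ ε      ≤⟨ f N ℕₚ.≤-refl ⟩
  seq x N            ∎)
  where open ℚₚ.≤-Reasoning

0ᴵ 1ᴵ : UnitInterval
0ᴵ = 0ℝ , ≤-refl 0ℝ , 0≤1
1ᴵ = 1ℝ , 0≤1 , ≤-refl 1ℝ

-- Continuity is with respect to the sup metric on coordinates; it implies that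
-- γ respects the equality of reals.
record Path {n m} {G : Graph n} {H : Graph m} (x y : HomPoint G H) : Set where
  field
    γ          : UnitInterval → HomPoint G H
    continuous : ∀ s ε → 0ℝ < ε → ∃[ δ ] 0ℝ < δ ×
                 (∀ t → ∣ proj₁ s - proj₁ t ∣< δ →
                    ∀ v i → ∣ coord (γ s) v i - coord (γ t) v i ∣< ε)
    start      : ∀ v i → coord (γ 0ᴵ) v i ≃ coord x v i
    end        : ∀ v i → coord (γ 1ᴵ) v i ≃ coord y v i

-- There are two points in different path components (in particular, the
-- complex is nonempty).
HomDisconnected : ∀ {n m} → Graph n → Graph m → Set
HomDisconnected G H = Σ (HomPoint G H) λ x → Σ (HomPoint G H) λ y → ¬ Path x y

{-# OPTIONS --safe #-}

-- A 3-colouring of G gives every closed walk of G a winding number around the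
-- triangle K₃.  It depends only on the cell of Hom(G,K₃), also when a colouring
-- is replaced by another one in the same cell, so it is locally constant and
-- hence constant along paths.  For an odd closed walk it is odd, hence nonzero,
-- and exchanging two colours negates it.  So Hom(G,K₃) is disconnected as soon as
-- G is 3-colourable and has an odd cycle.
--
-- Below the threshold G(n,c/n) is 3-colourable with high probability.  For c ≥ 1 it
-- has an odd cycle with high probability, by the second moment method: let X_k be
-- the number of closed walks of length k without repeated vertices and put
-- Z = Σ_{j<J} X_{2j+3} / (j+1), whose mean is close to t = Σ_{j<J} c^{2j+3} / (j+1);
-- t is unbounded in J because the harmonic series diverges.  Given that a fixed
-- cycle u of length k is present, with adjacency matrix C, the mean of X_l is at
-- most tr (pJ + C)^l = c^l + tr C^l + O(1/n).  For l ≤ k both odd, a closed walk of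
-- length l inside u has to go once around u, so tr C^l is 2k if l = k and 0
-- otherwise.  Thus Var Z ≤ 6t + O(1/n), and Chebyshev gives Pr[Z = 0] ≤ 6/t + O(1/n).

module Submission where

open import Data.Bool using (Bool; true; false; T; _∧_; _∨_; not; if_then_else_)
open import Data.Bool.ListAction using (any)
open import Data.Bool.Properties using (∨-comm; T-∧)
open import Data.Fin using (Fin; zero; suc; toℕ; inject≤)
open import Data.Fin.Patterns using (0F; 1F; 2F)
open import Data.Fin.Properties using (_≟_; all?; toℕ-injective; toℕ-fromℕ<; toℕ<n; inject≤-injective)
open import Data.Integer as ℤ using (ℤ; -[1+_])
import Data.Integer.Properties as ℤₚ
open import Data.List using (List; []; _∷_; _++_; map; foldr; filterᵇ; cartesianProductWith; length; allFin; downFrom)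
open import Data.List.Membership.Propositional using (_∈_)
open import Data.List.Membership.Propositional.Properties using (∈-++⁻)
open import Data.List.Properties using (map-tabulate; ++-identityʳ)
open import Data.List.Relation.Unary.Any using (here; there; satisfied)
open import Data.List.Relation.Unary.Any.Properties using (any⁻)
open import Data.Nat as ℕ using (ℕ; zero; suc; z≤n; s≤s; NonZero)
open import Data.Nat.Coprimality as Coprimality using (1-coprimeTo)
open import Data.Nat.DivMod using (_mod_; _%_; %-distribˡ-+; [m+n]%n≡m%n; m<n⇒m%n≡m; m%n<n)
import Data.Nat.Properties as ℕₚ
open import Data.Nat.Solver using () renaming (module +-*-Solver to ℕ-Solver)
open import Data.Product using (_×_; _,_; proj₁; proj₂; ∃-syntax)
open import Data.Product.Properties using (≡-dec)
open import Data.Rational as ℚ using (ℚ; mkℚ; 0ℚ; 1ℚ; ½)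
import Data.Rational.Properties as ℚₚ
open import Data.Rational.Solver using () renaming (module +-*-Solver to ℚ-Solver)
open import Data.Sum as Sum using (_⊎_; inj₁; inj₂)
open import Data.Vec as Vec using (Vec; []; _∷_; lookup; _[_]≔_; replicate)
import Data.Vec.Functional as VF
open import Data.Vec.Properties using (lookup-replicate)
open import Data.Vec.Relation.Unary.All using (All; []; _∷_)
open import Data.Vec.Relation.Unary.Unique.Propositional using (Unique; []; _∷_)
open import Data.Vec.Relation.Unary.Unique.Propositional.Properties using (lookup-injective)
open import Function using (_∘_; id; Equivalence)
open import Relation.Binary.Definitions using (tri<; tri≈; tri>)
open import Relation.Binary.PropositionalEquality
  using (_≡_; _≢_; refl; sym; trans; cong; cong₂; subst; module ≡-Reasoning)
open import Relation.Nullary using (¬_; Dec; yes; no; does; contradiction; ¬?)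
open import Relation.Nullary.Decidable using (_⊎-dec_; _→-dec_; dec-true; dec-false; decidable-stable; from-yes)

-- The weights 1/(j+1) are dictated by the case c = 1. There the mean of X_k is about 1 and its
-- variance about 2k, because every cycle is counted once for each starting point and direction; an
-- unweighted sum would have mean of order J and variance of order J², which is useless for
-- Chebyshev. The weights cancel the factor 2k, so the variance is at most a constant times the
-- mean, while the mean still diverges.
--
-- Oddness is used twice: it makes the winding number nonzero, and it excludes the backtracking
-- closed walks inside u, which would otherwise dominate tr C^l.
--
-- A real is a Cauchy sequence with termwise operations and a probability is a polynomial in p, so
-- the m-th term of a real probability is a rational probability at the m-th approximation of p. The
-- counting is therefore done over the rationals and uniformly in p. The approximations of np = c
-- may fall slightly below 1; hence the slack 1 - η ≤ np in the estimate, with η chosen after J.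

module OddCycles where

  open import Defs using (EdgeBits; []; _∷_; Adjacent; allRows; allEdgeBits)
  open import Data.Rational using (-_; _+_; _-_; _*_; _/_; _≤_; _<_; 1/_; *≤*; positive; nonNegative)
  open import Data.Rational.Properties hiding (_≟_)
  open ℚ-Solver using (solve; _:=_; _:+_; _:*_; _:-_; :-_; con)
  open ℕ-Solver using () renaming (solve to ℕ-solve; _:=_ to _ℕ:=_; _:+_ to _ℕ:+_; con to ℕcon)

  -- Finite sums of rationals

  0≤1 : 0ℚ ≤ 1ℚ
  0≤1 = <⇒≤ (positive⁻¹ 1ℚ)

  0≤-+ : ∀ {p q} → 0ℚ ≤ p → 0ℚ ≤ q → 0ℚ ≤ p + q
  0≤-+ = +-mono-≤

  *-monoʳ : ∀ {r p q} → 0ℚ ≤ r → p ≤ q → r * p ≤ r * q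
  *-monoʳ {r} 0≤r = *-monoˡ-≤-nonNeg r {{nonNegative 0≤r}}

  *-monoˡ : ∀ {r p q} → 0ℚ ≤ r → p ≤ q → p * r ≤ q * r
  *-monoˡ {r} 0≤r = *-monoʳ-≤-nonNeg r {{nonNegative 0≤r}}

  0≤-* : ∀ {p q} → 0ℚ ≤ p → 0ℚ ≤ q → 0ℚ ≤ p * q
  0≤-* {p} {q} 0≤p 0≤q = subst (_≤ p * q) (*-zeroʳ p) (*-monoʳ 0≤p 0≤q)

  *-mono : ∀ {a b c d} → 0ℚ ≤ a → 0ℚ ≤ d → a ≤ b → c ≤ d → a * c ≤ b * d
  *-mono 0≤a 0≤d a≤b c≤d = ≤-trans (*-monoʳ 0≤a c≤d) (*-monoˡ 0≤d a≤b)

  p≤p+q : ∀ {p q} → 0ℚ ≤ q → p ≤ p + q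
  p≤p+q {p} {q} 0≤q = subst (_≤ p + q) (+-identityʳ p) (+-monoʳ-≤ p 0≤q)

  q≤p+q : ∀ {p q} → 0ℚ ≤ p → q ≤ p + q
  q≤p+q {p} {q} 0≤p = subst (_≤ p + q) (+-identityˡ q) (+-monoˡ-≤ q 0≤p)

  0≤q-p : ∀ {p q} → p ≤ q → 0ℚ ≤ q - p
  0≤q-p {p} {q} p≤q = subst (_≤ q - p) (+-inverseʳ p) (+-monoˡ-≤ (- p) p≤q)

  0≤p*p : ∀ p → 0ℚ ≤ p * p
  0≤p*p p with ≤-total 0ℚ p
  ... | inj₁ 0≤p = 0≤-* 0≤p 0≤p
  ... | inj₂ p≤0 = subst (0ℚ ≤_) (solve 1 (λ p → (:- p) :* (:- p) := p :* p) refl p) (0≤-* 0≤-p 0≤-p)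
    where
    0≤-p : 0ℚ ≤ - p
    0≤-p = neg-antimono-≤ p≤0

  infixr 8 _^_
  _^_ : ℚ → ℕ → ℚ
  q ^ zero  = 1ℚ
  q ^ suc k = q * q ^ k

  0≤-^ : ∀ {q} k → 0ℚ ≤ q → 0ℚ ≤ q ^ k
  0≤-^ zero    0≤q = 0≤1
  0≤-^ (suc k) 0≤q = 0≤-* 0≤q (0≤-^ k 0≤q)

  ^-monoˡ : ∀ {p q} k → 0ℚ ≤ p → p ≤ q → p ^ k ≤ q ^ k
  ^-monoˡ zero    0≤p p≤q = ≤-refl
  ^-monoˡ (suc k) 0≤p p≤q = *-mono 0≤p (0≤-^ k (≤-trans 0≤p p≤q)) p≤q (^-monoˡ k 0≤p p≤q)

  *-^ : ∀ p q k → (p * q) ^ k ≡ p ^ k * q ^ k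
  *-^ p q zero    = refl
  *-^ p q (suc k) = trans (cong (p * q *_) (*-^ p q k))
    (solve 4 (λ p q a b → p :* q :* (a :* b) := p :* a :* (q :* b)) refl p q (p ^ k) (q ^ k))

  -- Recursive instead of `n / 1`, so that `ι (suc n)` unfolds and inductions need no arithmetic of
  -- fractions; `ι≡/1` links the two forms.
  ι : ℕ → ℚ
  ι zero    = 0ℚ
  ι (suc n) = 1ℚ + ι n

  0≤ι : ∀ n → 0ℚ ≤ ι n
  0≤ι zero    = ≤-refl
  0≤ι (suc n) = 0≤-+ 0≤1 (0≤ι n)

  ⟦_⟧ : Bool → ℚ
  ⟦ true  ⟧ = 1ℚ
  ⟦ false ⟧ = 0ℚ

  0≤⟦_⟧ : ∀ b → 0ℚ ≤ ⟦ b ⟧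
  0≤⟦ true  ⟧ = 0≤1
  0≤⟦ false ⟧ = ≤-refl

  ⟦_⟧≤1 : ∀ b → ⟦ b ⟧ ≤ 1ℚ
  ⟦ true  ⟧≤1 = ≤-refl
  ⟦ false ⟧≤1 = 0≤1

  ⟦∧⟧ : ∀ a b → ⟦ a ∧ b ⟧ ≡ ⟦ a ⟧ * ⟦ b ⟧
  ⟦∧⟧ true  b = sym (*-identityˡ ⟦ b ⟧)
  ⟦∧⟧ false b = sym (*-zeroˡ ⟦ b ⟧)

  ⟦∨⟧≤ : ∀ a b → ⟦ a ∨ b ⟧ ≤ ⟦ a ⟧ + ⟦ b ⟧
  ⟦∨⟧≤ true  b = p≤p+q 0≤⟦ b ⟧
  ⟦∨⟧≤ false b = q≤p+q {0ℚ} ≤-refl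

  ⟦not⟧ : ∀ b → ⟦ not b ⟧ ≡ 1ℚ - ⟦ b ⟧
  ⟦not⟧ true  = refl
  ⟦not⟧ false = refl

  module _ {A : Set} where

    ∑ : List A → (A → ℚ) → ℚ
    ∑ []       f = 0ℚ
    ∑ (x ∷ xs) f = f x + ∑ xs f

    ∑-cong : ∀ {f g : A → ℚ} xs → (∀ x → f x ≡ g x) → ∑ xs f ≡ ∑ xs g
    ∑-cong []       f≗g = refl
    ∑-cong (x ∷ xs) f≗g = cong₂ _+_ (f≗g x) (∑-cong xs f≗g)

    ∑-mono : ∀ {f g : A → ℚ} xs → (∀ x → f x ≤ g x) → ∑ xs f ≤ ∑ xs g
    ∑-mono []       f≤g = ≤-refl
    ∑-mono (x ∷ xs) f≤g = +-mono-≤ (f≤g x) (∑-mono xs f≤g)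

    ∑-zero : ∀ xs → ∑ xs (λ (_ : A) → 0ℚ) ≡ 0ℚ
    ∑-zero []       = refl
    ∑-zero (x ∷ xs) = trans (+-identityˡ _) (∑-zero xs)

    0≤-∑ : ∀ {f : A → ℚ} xs → (∀ x → 0ℚ ≤ f x) → 0ℚ ≤ ∑ xs f
    0≤-∑ xs 0≤f = subst (_≤ ∑ xs _) (∑-zero xs) (∑-mono xs 0≤f)

    ∑-+ : ∀ (f g : A → ℚ) xs → ∑ xs (λ x → f x + g x) ≡ ∑ xs f + ∑ xs g
    ∑-+ f g []       = refl
    ∑-+ f g (x ∷ xs) = trans (cong (f x + g x +_) (∑-+ f g xs))
      (solve 4 (λ a b c d → a :+ b :+ (c :+ d) := a :+ c :+ (b :+ d)) refl (f x) (g x) (∑ xs f) (∑ xs g))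

    ∑-*ˡ : ∀ q (f : A → ℚ) xs → ∑ xs (λ x → q * f x) ≡ q * ∑ xs f
    ∑-*ˡ q f []       = sym (*-zeroʳ q)
    ∑-*ˡ q f (x ∷ xs) = trans (cong (q * f x +_) (∑-*ˡ q f xs)) (sym (*-distribˡ-+ q (f x) (∑ xs f)))

    ∑-*ʳ : ∀ q (f : A → ℚ) xs → ∑ xs (λ x → f x * q) ≡ ∑ xs f * q
    ∑-*ʳ q f xs = trans (∑-cong xs (λ x → *-comm (f x) q)) (trans (∑-*ˡ q f xs) (*-comm q (∑ xs f)))

    ∑-++ : ∀ (f : A → ℚ) xs ys → ∑ (xs ++ ys) f ≡ ∑ xs f + ∑ ys f
    ∑-++ f []       ys = sym (+-identityˡ _)
    ∑-++ f (x ∷ xs) ys = trans (cong (f x +_) (∑-++ f xs ys)) (sym (+-assoc (f x) (∑ xs f) (∑ ys f)))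

  ∑-map : ∀ {A B : Set} (f : B → ℚ) (h : A → B) xs → ∑ (map h xs) f ≡ ∑ xs (f ∘ h)
  ∑-map f h []       = refl
  ∑-map f h (x ∷ xs) = cong (f (h x) +_) (∑-map f h xs)

  ∑-swap : ∀ {A B : Set} (f : A → B → ℚ) xs ys →
           ∑ xs (λ x → ∑ ys (f x)) ≡ ∑ ys (λ y → ∑ xs (λ x → f x y))
  ∑-swap f []       ys = sym (∑-zero ys)
  ∑-swap f (x ∷ xs) ys = trans (cong (∑ ys (f x) +_) (∑-swap f xs ys))
    (sym (∑-+ (f x) (λ y → ∑ xs (λ x → f x y)) ys))

  ∑-cartesian : ∀ {A B C : Set} (f : C → ℚ) (_⊕_ : A → B → C) xs ys →
                ∑ (cartesianProductWith _⊕_ xs ys) f ≡ ∑ xs (λ x → ∑ ys (λ y → f (x ⊕ y)))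
  ∑-cartesian f _⊕_ []       ys = refl
  ∑-cartesian f _⊕_ (x ∷ xs) ys = trans (∑-++ f (map (x ⊕_) ys) _)
    (cong₂ _+_ (∑-map f (x ⊕_) ys) (∑-cartesian f _⊕_ xs ys))

  ∑-product : ∀ {A B : Set} (f : A → ℚ) (g : B → ℚ) xs ys →
              ∑ xs f * ∑ ys g ≡ ∑ xs (λ x → ∑ ys (λ y → f x * g y))
  ∑-product f g xs ys = trans (sym (∑-*ʳ (∑ ys g) f xs)) (∑-cong xs (λ x → sym (∑-*ˡ (f x) g ys)))

  ∑-allFin : ∀ {n} (f : Fin (suc n) → ℚ) → ∑ (allFin (suc n)) f ≡ f zero + ∑ (allFin n) (f ∘ suc)
  ∑-allFin {n} f = cong (f zero +_)
    (trans (cong (λ xs → ∑ xs f) (sym (map-tabulate id suc))) (∑-map f suc (allFin n)))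

  ∑-const : ∀ n q → ∑ (allFin n) (λ _ → q) ≡ ι n * q
  ∑-const zero    q = sym (*-zeroˡ q)
  ∑-const (suc n) q = trans (∑-allFin {n} (λ _ → q)) (trans (cong (q +_) (∑-const n q))
    (solve 2 (λ q n → q :+ n :* q := (con 1ℚ :+ n) :* q) refl q (ι n)))

  -- Kronecker deltas and sums over tuples of vertices

  δ : ∀ {n} → Fin n → Fin n → ℚ
  δ x y = ⟦ does (x ≟ y) ⟧

  0≤δ : ∀ {n} (x y : Fin n) → 0ℚ ≤ δ x y
  0≤δ x y = 0≤⟦ does (x ≟ y) ⟧

  δ-refl : ∀ {n} (x : Fin n) → δ x x ≡ 1ℚ
  δ-refl x with x ≟ x
  ... | yes _   = refl
  ... | no  x≢x = contradiction refl x≢x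

  δ-≢ : ∀ {n} {x y : Fin n} → x ≢ y → δ x y ≡ 0ℚ
  δ-≢ {x = x} {y} x≢y with x ≟ y
  ... | yes x≡y = contradiction x≡y x≢y
  ... | no  _   = refl

  ∑-δ : ∀ {n} (x : Fin n) (f : Fin n → ℚ) → ∑ (allFin n) (λ z → δ x z * f z) ≡ f x
  ∑-δ {suc n} zero f = begin
    ∑ (allFin (suc n)) (λ z → δ zero z * f z)      ≡⟨ ∑-allFin (λ z → δ zero z * f z) ⟩
    1ℚ * f zero + ∑ (allFin n) (λ z → 0ℚ * f (suc z))
      ≡⟨ cong₂ _+_ (*-identityˡ (f zero)) (trans (∑-*ˡ 0ℚ (f ∘ suc) (allFin n)) (*-zeroˡ (∑ (allFin n) (f ∘ suc)))) ⟩
    f zero + 0ℚ                                    ≡⟨ +-identityʳ (f zero) ⟩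
    f zero                                         ∎
    where open ≡-Reasoning
  ∑-δ {suc n} (suc x) f = begin
    ∑ (allFin (suc n)) (λ z → δ (suc x) z * f z)   ≡⟨ ∑-allFin (λ z → δ (suc x) z * f z) ⟩
    0ℚ * f zero + ∑ (allFin n) (λ z → δ x z * f (suc z))
      ≡⟨ cong₂ _+_ (*-zeroˡ (f zero)) (∑-δ x (f ∘ suc)) ⟩
    0ℚ + f (suc x)                                 ≡⟨ +-identityˡ (f (suc x)) ⟩
    f (suc x)                                      ∎
    where open ≡-Reasoning

  ∑-δʳ : ∀ {n} (x : Fin n) → ∑ (allFin n) (δ x) ≡ 1ℚ
  ∑-δʳ {n} x = trans (∑-cong (allFin n) (λ z → sym (*-identityʳ (δ x z)))) (∑-δ x (λ _ → 1ℚ))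

  infix 7 _∈ᵇ_
  _∈ᵇ_ : ∀ {n k} → Fin n → Vec (Fin n) k → Bool
  x ∈ᵇ []       = false
  x ∈ᵇ (y ∷ ys) = does (y ≟ x) ∨ x ∈ᵇ ys

  ∑-∈ᵇ : ∀ {n k} (ys : Vec (Fin n) k) → ∑ (allFin n) (λ x → ⟦ x ∈ᵇ ys ⟧) ≤ ι k
  ∑-∈ᵇ {n} []       = ≤-reflexive (∑-zero (allFin n))
  ∑-∈ᵇ {n} {suc k} (y ∷ ys) = begin
    ∑ (allFin n) (λ x → ⟦ does (y ≟ x) ∨ x ∈ᵇ ys ⟧)    ≤⟨ ∑-mono (allFin n) (λ x → ⟦∨⟧≤ (does (y ≟ x)) (x ∈ᵇ ys)) ⟩
    ∑ (allFin n) (λ x → δ y x + ⟦ x ∈ᵇ ys ⟧)           ≡⟨ ∑-+ (δ y) (λ x → ⟦ x ∈ᵇ ys ⟧) (allFin n) ⟩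
    ∑ (allFin n) (δ y) + ∑ (allFin n) (λ x → ⟦ x ∈ᵇ ys ⟧)
      ≤⟨ +-mono-≤ (≤-reflexive (∑-δʳ y)) (∑-∈ᵇ ys) ⟩
    1ℚ + ι k                                           ∎
    where open ≤-Reasoning

  tuples : ∀ n k → List (Vec (Fin n) k)
  tuples n zero    = [] ∷ []
  tuples n (suc k) = cartesianProductWith _∷_ (allFin n) (tuples n k)

  ∑-tuples : ∀ {n k} (f : Vec (Fin n) (suc k) → ℚ) →
             ∑ (tuples n (suc k)) f ≡ ∑ (allFin n) (λ x → ∑ (tuples n k) (λ xs → f (x ∷ xs)))
  ∑-tuples {n} {k} f = ∑-cartesian f _∷_ (allFin n) (tuples n k)

  -- Expectations over random edge sets

  bitMass : ℚ → Bool → ℚ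
  bitMass p true  = p
  bitMass p false = 1ℚ - p

  rowMass : ∀ {n} → ℚ → Vec Bool n → ℚ
  rowMass p = Vec.foldr′ (λ b r → bitMass p b * r) 1ℚ

  mass : ∀ {n} → ℚ → EdgeBits n → ℚ
  mass p []        = 1ℚ
  mass p (row ∷ ω) = rowMass p row * mass p ω

  -- A sum over all edge sets, hence a polynomial in p. It is taken at rational p because the terms
  -- of a real probability are values of it, see `seq-Pr`.
  𝔼 : ∀ {n} → ℚ → (EdgeBits n → ℚ) → ℚ
  𝔼 p f = ∑ (allEdgeBits _) (λ ω → mass p ω * f ω)

  module _ {p : ℚ} (0≤p : 0ℚ ≤ p) (p≤1 : p ≤ 1ℚ) where

    0≤bitMass : ∀ b → 0ℚ ≤ bitMass p b
    0≤bitMass true  = 0≤p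
    0≤bitMass false = 0≤q-p p≤1

    0≤rowMass : ∀ {n} (row : Vec Bool n) → 0ℚ ≤ rowMass p row
    0≤rowMass []        = 0≤1
    0≤rowMass (b ∷ row) = 0≤-* (0≤bitMass b) (0≤rowMass row)

    0≤mass : ∀ {n} (ω : EdgeBits n) → 0ℚ ≤ mass p ω
    0≤mass []        = 0≤1
    0≤mass (row ∷ ω) = 0≤-* (0≤rowMass row) (0≤mass ω)

    𝔼-mono : ∀ {n} {f g : EdgeBits n → ℚ} → (∀ ω → f ω ≤ g ω) → 𝔼 p f ≤ 𝔼 p g
    𝔼-mono f≤g = ∑-mono (allEdgeBits _) (λ ω → *-monoʳ (0≤mass ω) (f≤g ω))

  module _ {n : ℕ} (p : ℚ) where

    𝔼-cong : {f g : EdgeBits n → ℚ} → (∀ ω → f ω ≡ g ω) → 𝔼 p f ≡ 𝔼 p g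
    𝔼-cong f≗g = ∑-cong (allEdgeBits n) (λ ω → cong (mass p ω *_) (f≗g ω))

    𝔼-+ : (f g : EdgeBits n → ℚ) → 𝔼 p (λ ω → f ω + g ω) ≡ 𝔼 p f + 𝔼 p g
    𝔼-+ f g = trans (∑-cong (allEdgeBits n) (λ ω → *-distribˡ-+ (mass p ω) (f ω) (g ω)))
      (∑-+ (λ ω → mass p ω * f ω) (λ ω → mass p ω * g ω) (allEdgeBits n))

    𝔼-* : ∀ q (f : EdgeBits n → ℚ) → 𝔼 p (λ ω → q * f ω) ≡ q * 𝔼 p f
    𝔼-* q f = trans
      (∑-cong (allEdgeBits n) (λ ω → solve 3 (λ m q x → m :* (q :* x) := q :* (m :* x)) refl (mass p ω) q (f ω)))
      (∑-*ˡ q (λ ω → mass p ω * f ω) (allEdgeBits n))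

    𝔼-∑ : ∀ {A : Set} (f : A → EdgeBits n → ℚ) xs → 𝔼 p (λ ω → ∑ xs (λ x → f x ω)) ≡ ∑ xs (λ x → 𝔼 p (f x))
    𝔼-∑ f xs = trans (∑-cong (allEdgeBits n) (λ ω → sym (∑-*ˡ (mass p ω) (λ x → f x ω) xs)))
      (∑-swap (λ ω x → mass p ω * f x ω) (allEdgeBits n) xs)

  -- Sets of edges are encoded as elements of EdgeBits; the indicator of s ⊆ ω is a
  -- product over all pairs of vertices, so its expectation factorises.

  factorᵣ : ∀ {n} → Vec Bool n → Vec Bool n → ℚ
  factorᵣ []       []       = 1ℚ
  factorᵣ (s ∷ ss) (r ∷ rs) = (if s then ⟦ r ⟧ else 1ℚ) * factorᵣ ss rs

  factor : ∀ {n} → EdgeBits n → EdgeBits n → ℚ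
  factor []       []      = 1ℚ
  factor (s ∷ ss) (r ∷ ω) = factorᵣ s r * factor ss ω

  -- `μᵣ` and `μ` equal p to the number of pairs in the set. They are kept as products over all
  -- pairs to match `factor` bit by bit.
  μᵣ : ∀ {n} → ℚ → Vec Bool n → ℚ
  μᵣ p []       = 1ℚ
  μᵣ p (s ∷ ss) = (if s then p else 1ℚ) * μᵣ p ss

  μ : ∀ {n} → ℚ → EdgeBits n → ℚ
  μ p []       = 1ℚ
  μ p (s ∷ ss) = μᵣ p s * μ p ss

  -- Independence of the bits of a row: the sum over rows is split by the first bit.
  ∑-factorᵣ : ∀ {n} p (s : Vec Bool n) → ∑ (allRows n) (λ r → rowMass p r * factorᵣ s r) ≡ μᵣ p s
  ∑-factorᵣ p []             = refl
  ∑-factorᵣ {suc n} p (s ∷ ss) = begin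
    ∑ (map (true ∷_) (allRows n) ++ map (false ∷_) (allRows n)) g
      ≡⟨ ∑-++ g (map (true ∷_) (allRows n)) (map (false ∷_) (allRows n)) ⟩
    ∑ (map (true ∷_) (allRows n)) g + ∑ (map (false ∷_) (allRows n)) g
      ≡⟨ cong₂ _+_ (half true) (half false) ⟩
    p * φ s true * μᵣ p ss + (1ℚ - p) * φ s false * μᵣ p ss
      ≡⟨ combine s ⟩
    (if s then p else 1ℚ) * μᵣ p ss  ∎
    where
    open ≡-Reasoning

    φ : Bool → Bool → ℚ
    φ s b = if s then ⟦ b ⟧ else 1ℚ

    g : Vec Bool (suc n) → ℚ
    g r = rowMass p r * factorᵣ (s ∷ ss) r

    half : ∀ b → ∑ (map (b ∷_) (allRows n)) g ≡ bitMass p b * φ s b * μᵣ p ss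
    half b = begin
      ∑ (map (b ∷_) (allRows n)) g   ≡⟨ ∑-map g (b ∷_) (allRows n) ⟩
      ∑ (allRows n) (λ r → bitMass p b * rowMass p r * (φ s b * factorᵣ ss r))
        ≡⟨ ∑-cong (allRows n) (λ r → solve 4 (λ a b c d → a :* b :* (c :* d) := a :* c :* (b :* d)) refl
                                       (bitMass p b) (rowMass p r) (φ s b) (factorᵣ ss r)) ⟩
      ∑ (allRows n) (λ r → bitMass p b * φ s b * (rowMass p r * factorᵣ ss r))
        ≡⟨ ∑-*ˡ (bitMass p b * φ s b) (λ r → rowMass p r * factorᵣ ss r) (allRows n) ⟩
      bitMass p b * φ s b * ∑ (allRows n) (λ r → rowMass p r * factorᵣ ss r)
        ≡⟨ cong (bitMass p b * φ s b *_) (∑-factorᵣ p ss) ⟩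
      bitMass p b * φ s b * μᵣ p ss  ∎

    -- A required bit contributes p * 1 + (1 - p) * 0 = p and a free one p + (1 - p) = 1.
    combine : ∀ s → p * φ s true * μᵣ p ss + (1ℚ - p) * φ s false * μᵣ p ss ≡ (if s then p else 1ℚ) * μᵣ p ss
    combine true  = solve 2 (λ p m → p :* con 1ℚ :* m :+ (con 1ℚ :- p) :* con 0ℚ :* m := p :* m) refl p (μᵣ p ss)
    combine false = solve 2 (λ p m → p :* con 1ℚ :* m :+ (con 1ℚ :- p) :* con 1ℚ :* m := con 1ℚ :* m) refl p (μᵣ p ss)

  -- Mass and indicator both factor over the rows, so the sum over edge sets is a product of sums
  -- over single rows.
  𝔼-factor : ∀ {n} p (s : EdgeBits n) → 𝔼 p (factor s) ≡ μ p s
  𝔼-factor p []                 = refl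
  𝔼-factor {suc n} p (s ∷ ss) = begin
    𝔼 p (factor (s ∷ ss))
      ≡⟨ ∑-cartesian (λ ω → mass p ω * factor (s ∷ ss) ω) _∷_ (allRows n) (allEdgeBits n) ⟩
    ∑ (allRows n) (λ r → ∑ (allEdgeBits n) (λ ω → rowMass p r * mass p ω * (factorᵣ s r * factor ss ω)))
      ≡⟨ ∑-cong (allRows n) (λ r → ∑-cong (allEdgeBits n) (λ ω →
           solve 4 (λ a b c d → a :* b :* (c :* d) := a :* c :* (b :* d)) refl
             (rowMass p r) (mass p ω) (factorᵣ s r) (factor ss ω))) ⟩
    ∑ (allRows n) (λ r → ∑ (allEdgeBits n) (λ ω → rowMass p r * factorᵣ s r * (mass p ω * factor ss ω)))
      ≡⟨ ∑-product (λ r → rowMass p r * factorᵣ s r) (λ ω → mass p ω * factor ss ω) (allRows n) (allEdgeBits n) ⟨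
    ∑ (allRows n) (λ r → rowMass p r * factorᵣ s r) * 𝔼 p (factor ss)
      ≡⟨ cong₂ _*_ (∑-factorᵣ p s) (𝔼-factor p ss) ⟩
    μᵣ p s * μ p ss  ∎
    where open ≡-Reasoning

  -- Adjacency bits and the insertion of one edge

  adj : ∀ {n} → EdgeBits n → Fin n → Fin n → Bool
  adj (row ∷ ω) zero    zero    = false
  adj (row ∷ ω) zero    (suc j) = lookup row j
  adj (row ∷ ω) (suc i) zero    = lookup row i
  adj (row ∷ ω) (suc i) (suc j) = adj ω i j

  adj⇒Adjacent : ∀ {n} (ω : EdgeBits n) x y → T (adj ω x y) → Adjacent ω x y
  adj⇒Adjacent (row ∷ ω) zero    (suc j) e = e
  adj⇒Adjacent (row ∷ ω) (suc i) zero    e = e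
  adj⇒Adjacent (row ∷ ω) (suc i) (suc j) e = adj⇒Adjacent ω i j e

  ∅ : ∀ {n} → EdgeBits n
  ∅ {zero}  = []
  ∅ {suc n} = replicate n false ∷ ∅

  -- A loop is ignored; this is why the product formulas `factor-insert` and `μ-insert` ask for
  -- `x ≢ y`.
  insert : ∀ {n} → Fin n → Fin n → EdgeBits n → EdgeBits n
  insert zero    zero    (row ∷ ω) = row ∷ ω
  insert zero    (suc j) (row ∷ ω) = (row [ j ]≔ true) ∷ ω
  insert (suc i) zero    (row ∷ ω) = (row [ i ]≔ true) ∷ ω
  insert (suc i) (suc j) (row ∷ ω) = row ∷ insert i j ω

  -- For a pair that is already in the set the additional factor is absorbed, an indicator being
  -- idempotent.
  factorᵣ-insert : ∀ {n} (s : Vec Bool n) r j → factorᵣ (s [ j ]≔ true) r ≡ ⟦ lookup r j ⟧ * factorᵣ s r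
  factorᵣ-insert (true ∷ ss)  (r ∷ rs) zero    = idem r
    where
    idem : ∀ r → ⟦ r ⟧ * factorᵣ ss rs ≡ ⟦ r ⟧ * (⟦ r ⟧ * factorᵣ ss rs)
    idem true  = sym (*-identityˡ _)
    idem false = trans (*-zeroˡ (factorᵣ ss rs)) (sym (*-zeroˡ (0ℚ * factorᵣ ss rs)))
  factorᵣ-insert (false ∷ ss) (r ∷ rs) zero    = cong (⟦ r ⟧ *_) (sym (*-identityˡ (factorᵣ ss rs)))
  factorᵣ-insert (s ∷ ss)     (r ∷ rs) (suc j) = trans (cong ((if s then ⟦ r ⟧ else 1ℚ) *_) (factorᵣ-insert ss rs j))
    (solve 3 (λ a b c → a :* (b :* c) := b :* (a :* c)) refl (if s then ⟦ r ⟧ else 1ℚ) ⟦ lookup rs j ⟧ (factorᵣ ss rs))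

  -- In contrast to the indicator, p is not idempotent: a pair already in the set contributes 1 in
  -- place of p. All dependence between two cycles enters through this case.
  μᵣ-insert : ∀ {n} p (s : Vec Bool n) j → μᵣ p (s [ j ]≔ true) ≡ (if lookup s j then 1ℚ else p) * μᵣ p s
  μᵣ-insert p (true ∷ ss)  zero    = sym (*-identityˡ _)
  μᵣ-insert p (false ∷ ss) zero    = cong (p *_) (sym (*-identityˡ (μᵣ p ss)))
  μᵣ-insert p (s ∷ ss)     (suc j) = trans (cong ((if s then p else 1ℚ) *_) (μᵣ-insert p ss j))
    (solve 3 (λ a b c → a :* (b :* c) := b :* (a :* c)) refl
      (if s then p else 1ℚ) (if lookup ss j then 1ℚ else p) (μᵣ p ss))

  factor-insert : ∀ {n} {x y : Fin n} → x ≢ y → ∀ s ω → factor (insert x y s) ω ≡ ⟦ adj ω x y ⟧ * factor s ω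
  factor-insert {x = zero}  {zero}  x≢y (s ∷ ss) (r ∷ ω) = contradiction refl x≢y
  factor-insert {x = zero}  {suc j} x≢y (s ∷ ss) (r ∷ ω) = trans (cong (_* factor ss ω) (factorᵣ-insert s r j))
    (*-assoc ⟦ lookup r j ⟧ (factorᵣ s r) (factor ss ω))
  factor-insert {x = suc i} {zero}  x≢y (s ∷ ss) (r ∷ ω) = trans (cong (_* factor ss ω) (factorᵣ-insert s r i))
    (*-assoc ⟦ lookup r i ⟧ (factorᵣ s r) (factor ss ω))
  factor-insert {x = suc i} {suc j} x≢y (s ∷ ss) (r ∷ ω) = trans
    (cong (factorᵣ s r *_) (factor-insert (x≢y ∘ cong suc) ss ω))
    (solve 3 (λ a b c → a :* (b :* c) := b :* (a :* c)) refl (factorᵣ s r) ⟦ adj ω i j ⟧ (factor ss ω))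

  μ-insert : ∀ {n} {x y : Fin n} p → x ≢ y → ∀ s → μ p (insert x y s) ≡ (if adj s x y then 1ℚ else p) * μ p s
  μ-insert {x = zero}  {zero}  p x≢y (s ∷ ss) = contradiction refl x≢y
  μ-insert {x = zero}  {suc j} p x≢y (s ∷ ss) = trans (cong (_* μ p ss) (μᵣ-insert p s j)) (*-assoc (if lookup s j then 1ℚ else p) (μᵣ p s) (μ p ss))
  μ-insert {x = suc i} {zero}  p x≢y (s ∷ ss) = trans (cong (_* μ p ss) (μᵣ-insert p s i)) (*-assoc (if lookup s i then 1ℚ else p) (μᵣ p s) (μ p ss))
  μ-insert {x = suc i} {suc j} p x≢y (s ∷ ss) = trans (cong (μᵣ p s *_) (μ-insert p (x≢y ∘ cong suc) ss))
    (solve 3 (λ a b c → a :* (b :* c) := b :* (a :* c)) refl (μᵣ p s) (if adj ss i j then 1ℚ else p) (μ p ss))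

  factor-∅ : ∀ {n} (ω : EdgeBits n) → factor ∅ ω ≡ 1ℚ
  factor-∅ []                    = refl
  factor-∅ {suc n} (row ∷ ω) = cong₂ _*_ (row-∅ row) (factor-∅ ω)
    where
    row-∅ : ∀ {m} (r : Vec Bool m) → factorᵣ (replicate m false) r ≡ 1ℚ
    row-∅ []      = refl
    row-∅ (_ ∷ r) = cong (1ℚ *_) (row-∅ r)

  μ-∅ : ∀ n p → μ p (∅ {n}) ≡ 1ℚ
  μ-∅ zero    p = refl
  μ-∅ (suc n) p = cong₂ _*_ (row-∅ n) (μ-∅ n p)
    where
    row-∅ : ∀ m → μᵣ p (replicate m false) ≡ 1ℚ
    row-∅ zero    = refl
    row-∅ (suc m) = cong (1ℚ *_) (row-∅ m)

  adj-∅ : ∀ {n} (x y : Fin n) → adj ∅ x y ≢ true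
  adj-∅ zero    (suc j) eq with () ← trans (sym (lookup-replicate j false)) eq
  adj-∅ (suc i) zero    eq with () ← trans (sym (lookup-replicate i false)) eq
  adj-∅ (suc i) (suc j) eq = adj-∅ i j eq

  lookup-insert : ∀ {n} (s : Vec Bool n) i j → lookup (s [ i ]≔ true) j ≡ true → j ≡ i ⊎ lookup s j ≡ true
  lookup-insert (s ∷ ss) zero    zero    eq = inj₁ refl
  lookup-insert (s ∷ ss) zero    (suc j) eq = inj₂ eq
  lookup-insert (s ∷ ss) (suc i) zero    eq = inj₂ eq
  lookup-insert (s ∷ ss) (suc i) (suc j) eq = Sum.map₁ (cong suc) (lookup-insert ss i j eq)

  adj-insert : ∀ {n} (x y : Fin n) s x′ y′ → adj (insert x y s) x′ y′ ≡ true →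
               ((x′ , y′) ≡ (x , y) ⊎ (y′ , x′) ≡ (x , y)) ⊎ adj s x′ y′ ≡ true
  adj-insert zero    zero    (s ∷ ss) x′       y′       eq = inj₂ eq
  adj-insert zero    (suc j) (s ∷ ss) zero     (suc j′) eq = Sum.map₁ (λ e → inj₁ (cong (λ z → zero , suc z) e)) (lookup-insert s j j′ eq)
  adj-insert zero    (suc j) (s ∷ ss) (suc i′) zero     eq = Sum.map₁ (λ e → inj₂ (cong (λ z → zero , suc z) e)) (lookup-insert s j i′ eq)
  adj-insert zero    (suc j) (s ∷ ss) (suc i′) (suc j′) eq = inj₂ eq
  adj-insert (suc i) zero    (s ∷ ss) zero     (suc j′) eq = Sum.map₁ (λ e → inj₂ (cong (λ z → suc z , zero) e)) (lookup-insert s i j′ eq)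
  adj-insert (suc i) zero    (s ∷ ss) (suc i′) zero     eq = Sum.map₁ (λ e → inj₁ (cong (λ z → suc z , zero) e)) (lookup-insert s i i′ eq)
  adj-insert (suc i) zero    (s ∷ ss) (suc i′) (suc j′) eq = inj₂ eq
  adj-insert (suc i) (suc j) (s ∷ ss) zero     (suc j′) eq = inj₂ eq
  adj-insert (suc i) (suc j) (s ∷ ss) (suc i′) zero     eq = inj₂ eq
  adj-insert (suc i) (suc j) (s ∷ ss) (suc i′) (suc j′) eq with adj-insert i j ss i′ j′ eq
  ... | inj₁ (inj₁ refl) = inj₁ (inj₁ refl)
  ... | inj₁ (inj₂ refl) = inj₁ (inj₂ refl)
  ... | inj₂ eq′         = inj₂ eq′

  -- Edge lists and the probability that all their edges are present

  module _ {n : ℕ} where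

    Edges : Set
    Edges = List (Fin n × Fin n)

    -- Edges are listed as ordered pairs, in the direction of traversal, but compared without
    -- orientation.
    Linked : Edges → Fin n → Fin n → Set
    Linked es x y = (x , y) ∈ es ⊎ (y , x) ∈ es

    open import Data.List.Membership.DecPropositional (≡-dec (_≟_ {n}) (_≟_ {n})) using (_∈?_)

    linked? : ∀ es x y → Dec (Linked es x y)
    linked? es x y = (x , y) ∈? es ⊎-dec (y , x) ∈? es

    link : Edges → Fin n → Fin n → ℚ
    link es x y = ⟦ does (linked? es x y) ⟧

    0≤link : ∀ es x y → 0ℚ ≤ link es x y
    0≤link es x y = 0≤⟦ does (linked? es x y) ⟧

    link-yes : ∀ {es x y} → Linked es x y → link es x y ≡ 1ℚ
    link-yes {es} {x} {y} l = cong ⟦_⟧ (dec-true (linked? es x y) l)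

    link-no : ∀ {es x y} → ¬ Linked es x y → link es x y ≡ 0ℚ
    link-no {es} {x} {y} ¬l = cong ⟦_⟧ (dec-false (linked? es x y) ¬l)

    link-sym : ∀ es x y → link es x y ≡ link es y x
    link-sym es x y = cong ⟦_⟧ (∨-comm (does ((x , y) ∈? es)) (does ((y , x) ∈? es)))

    mask : Edges → EdgeBits n
    mask []             = ∅
    mask ((x , y) ∷ es) = insert x y (mask es)

    adj-mask : ∀ es x y → adj (mask es) x y ≡ true → Linked es x y
    adj-mask []             x′ y′ eq = contradiction eq (adj-∅ x′ y′)
    adj-mask ((x , y) ∷ es) x′ y′ eq with adj-insert x y (mask es) x′ y′ eq
    ... | inj₁ (inj₁ e) = inj₁ (here e)
    ... | inj₁ (inj₂ e) = inj₂ (here e)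
    ... | inj₂ eq′      = Sum.map there there (adj-mask es x′ y′ eq′)

    present : Edges → EdgeBits n → Bool
    present []             ω = true
    present ((x , y) ∷ es) ω = adj ω x y ∧ present es ω

    present-++ : ∀ es us ω → ⟦ present (es ++ us) ω ⟧ ≡ ⟦ present es ω ⟧ * ⟦ present us ω ⟧
    present-++ []             us ω = sym (*-identityˡ _)
    present-++ ((x , y) ∷ es) us ω with adj ω x y
    ... | true  = present-++ es us ω
    ... | false = sym (*-zeroˡ ⟦ present us ω ⟧)

    data Loopless : Edges → Set where
      []  : Loopless []
      _∷_ : ∀ {x y es} → x ≢ y → Loopless es → Loopless ((x , y) ∷ es)

    -- No undirected edge is listed twice. Together with `Loopless` this makes the length of the
    -- list the exponent of p.
    data Trail : Edges → Set where
      []  : Trail []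
      _∷_ : ∀ {x y es} → ¬ Linked es x y → Trail es → Trail ((x , y) ∷ es)

    Loopless-++ : ∀ {es us} → Loopless es → Loopless us → Loopless (es ++ us)
    Loopless-++ []         lus = lus
    Loopless-++ (x≢y ∷ les) lus = x≢y ∷ Loopless-++ les lus

    factor-mask : ∀ {es} → Loopless es → ∀ ω → factor (mask es) ω ≡ ⟦ present es ω ⟧
    factor-mask []                      ω = factor-∅ ω
    factor-mask (_∷_ {x} {y} {es} x≢y l) ω = begin
      factor (insert x y (mask es)) ω      ≡⟨ factor-insert x≢y (mask es) ω ⟩
      ⟦ adj ω x y ⟧ * factor (mask es) ω   ≡⟨ cong (⟦ adj ω x y ⟧ *_) (factor-mask l ω) ⟩
      ⟦ adj ω x y ⟧ * ⟦ present es ω ⟧     ≡⟨ ⟦∧⟧ (adj ω x y) (present es ω) ⟨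
      ⟦ adj ω x y ∧ present es ω ⟧         ∎
      where open ≡-Reasoning

    𝔼-present : ∀ p {es} → Loopless es → 𝔼 p (λ ω → ⟦ present es ω ⟧) ≡ μ p (mask es)
    𝔼-present p {es} l = trans (sym (𝔼-cong p (factor-mask l))) (𝔼-factor p (mask es))

    ∏ : Edges → (Fin n → Fin n → ℚ) → ℚ
    ∏ []             f = 1ℚ
    ∏ ((x , y) ∷ es) f = f x y * ∏ es f

    module _ {p : ℚ} (0≤p : 0ℚ ≤ p) (p≤1 : p ≤ 1ℚ) where

      0≤if : ∀ b → 0ℚ ≤ (if b then 1ℚ else p)
      0≤if true  = 0≤1
      0≤if false = 0≤p

      p≤if : ∀ b → p ≤ (if b then 1ℚ else p)
      p≤if true  = p≤1
      p≤if false = ≤-refl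

      0≤μ-mask : ∀ {es} → Loopless es → 0ℚ ≤ μ p (mask es)
      0≤μ-mask []                       = ≤-trans 0≤1 (≤-reflexive (sym (μ-∅ n p)))
      0≤μ-mask (_∷_ {x} {y} {es} x≢y l) = subst (0ℚ ≤_) (sym (μ-insert p x≢y (mask es)))
        (0≤-* (0≤if (adj (mask es) x y)) (0≤μ-mask l))

      -- An edge met for the second time contributes 1 ≥ p, so repetitions only raise the
      -- probability.
      ^≤μ-mask : ∀ {es} → Loopless es → p ^ length es ≤ μ p (mask es)
      ^≤μ-mask []                       = ≤-reflexive (sym (μ-∅ n p))
      ^≤μ-mask (_∷_ {x} {y} {es} x≢y l) = subst (p ^ suc (length es) ≤_) (sym (μ-insert p x≢y (mask es)))
        (*-mono 0≤p (0≤μ-mask l) (p≤if (adj (mask es) x y)) (^≤μ-mask l))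

      -- Once us is present, an edge of es contributes 1 if it is shared with us and p otherwise.
      -- Bounding this by the sum `p + link us x y` loses only O(p) and turns the product into a
      -- term of a power of the matrix p J + C.
      μ-mask-++ : ∀ {es us} → Loopless es → Trail es → Loopless us →
                  μ p (mask (es ++ us)) ≤ ∏ es (λ x y → p + link us x y) * μ p (mask us)
      μ-mask-++ [] [] lus = ≤-reflexive (sym (*-identityˡ _))
      μ-mask-++ {us = us} (_∷_ {x} {y} {es} x≢y les) (fresh ∷ tes) lus = begin
        μ p (insert x y (mask (es ++ us)))
          ≡⟨ μ-insert p x≢y (mask (es ++ us)) ⟩
        (if adj (mask (es ++ us)) x y then 1ℚ else p) * μ p (mask (es ++ us))
          ≤⟨ *-mono (0≤if (adj (mask (es ++ us)) x y)) (≤-trans (0≤μ-mask (Loopless-++ les lus)) (μ-mask-++ les tes lus))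
               if≤ (μ-mask-++ les tes lus) ⟩
        f x y * (∏ es f * μ p (mask us))
          ≡⟨ *-assoc (f x y) (∏ es f) (μ p (mask us)) ⟨
        f x y * ∏ es f * μ p (mask us)  ∎
        where
        open ≤-Reasoning

        f : Fin n → Fin n → ℚ
        f x y = p + link us x y

        -- As es is a trail, an edge that is already in the union can only come from us.
        old : Linked (es ++ us) x y → Linked us x y
        old (inj₁ e∈) with ∈-++⁻ es e∈
        ... | inj₁ e∈es = contradiction (inj₁ e∈es) fresh
        ... | inj₂ e∈us = inj₁ e∈us
        old (inj₂ e∈) with ∈-++⁻ es e∈
        ... | inj₁ e∈es = contradiction (inj₂ e∈es) fresh
        ... | inj₂ e∈us = inj₂ e∈us

        if≤ : (if adj (mask (es ++ us)) x y then 1ℚ else p) ≤ f x y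
        if≤ with adj (mask (es ++ us)) x y in eq
        ... | false = p≤p+q (0≤link us x y)
        ... | true  = ≤-trans (≤-reflexive (sym (link-yes (old (adj-mask (es ++ us) x y eq))))) (q≤p+q 0≤p)

  -- Weighted walks

  2ℚ 4ℚ : ℚ
  2ℚ = 1ℚ + 1ℚ
  4ℚ = 2ℚ + 2ℚ

  0≤2 : 0ℚ ≤ 2ℚ
  0≤2 = 0≤-+ 0≤1 0≤1

  0≤4 : 0ℚ ≤ 4ℚ
  0≤4 = 0≤-+ 0≤2 0≤2

  module _ {n : ℕ} where

    -- The (x, y) entry of the i-th power of the matrix M.
    walk : (Fin n → Fin n → ℚ) → ℕ → Fin n → Fin n → ℚ
    walk M zero    x y = δ x y
    walk M (suc i) x y = ∑ (allFin n) (λ z → M x z * walk M i z y)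

    walk-1 : ∀ M x y → walk M 1 x y ≡ M x y
    walk-1 M x y = trans (∑-cong (allFin n) flip-δ) (∑-δ y (M x))
      where
      flip-δ : ∀ z → M x z * δ z y ≡ δ y z * M x z
      flip-δ z = trans (*-comm (M x z) (δ z y)) (cong (_* M x z) (δ-sym z))
        where
        δ-sym : ∀ z → δ z y ≡ δ y z
        δ-sym z with y ≟ z
        ... | yes refl = δ-refl y
        ... | no y≢z   = δ-≢ (λ z≡y → y≢z (sym z≡y))

    0≤walk : ∀ {M} → (∀ x y → 0ℚ ≤ M x y) → ∀ i x y → 0ℚ ≤ walk M i x y
    0≤walk 0≤M zero    x y = 0≤δ x y
    0≤walk 0≤M (suc i) x y = 0≤-∑ (allFin n) (λ z → 0≤-* (0≤M x z) (0≤walk 0≤M i z y))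

  -- `α` collects the first-order terms after one more multiplication by p J + C: p J times C^(i+1)
  -- gives 2^(i+1), C times (p J)^(i+1) gives 2 Q^i, and the old first-order terms are multiplied by
  -- at most Q under p J and by 2 * 2 under C. In `β` the summand `α Q i * κ` is p J applied to the
  -- first-order terms, summed over at most κ vertices.
  α : ℚ → ℕ → ℚ
  α Q zero    = 0ℚ
  α Q (suc i) = 2ℚ ^ suc i + 2ℚ * Q ^ i + (Q + 4ℚ) * α Q i

  β : ℚ → ℚ → ℕ → ℚ
  β Q κ zero    = 0ℚ
  β Q κ (suc i) = α Q i * κ + (Q + 2ℚ) * β Q κ i

  0≤α : ∀ {Q} → 0ℚ ≤ Q → ∀ i → 0ℚ ≤ α Q i
  0≤α 0≤Q zero    = ≤-refl
  0≤α 0≤Q (suc i) = 0≤-+ (0≤-+ (0≤-^ (suc i) 0≤2) (0≤-* 0≤2 (0≤-^ i 0≤Q))) (0≤-* (0≤-+ 0≤Q 0≤4) (0≤α 0≤Q i))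

  0≤β : ∀ {Q κ} → 0ℚ ≤ Q → 0ℚ ≤ κ → ∀ i → 0ℚ ≤ β Q κ i
  0≤β 0≤Q 0≤κ zero    = ≤-refl
  0≤β 0≤Q 0≤κ (suc i) = 0≤-+ (0≤-* (0≤α 0≤Q i) 0≤κ) (0≤-* (0≤-+ 0≤Q 0≤2) (0≤β 0≤Q 0≤κ i))

  -- Up to O(p), the trace of the i-th power of p J + C, where J is the all-ones
  -- matrix, is the sum of the traces of (p J)^i and C^i.  U is the indicator of the
  -- vertices where C does not vanish; α and β bound the terms of first and second
  -- order in p that are left over.
  module Perturbation
    {n : ℕ} (p Q κ : ℚ) (C : Fin n → Fin n → ℚ) (U : Fin n → ℚ)
    (0≤p : 0ℚ ≤ p) (c≤Q : ι n * p ≤ Q)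
    (0≤C : ∀ x y → 0ℚ ≤ C x y) (0≤U : ∀ x → 0ℚ ≤ U x) (U≤1 : ∀ x → U x ≤ 1ℚ) (∑U≤κ : ∑ (allFin n) U ≤ κ)
    (row : ∀ x → ∑ (allFin n) (C x) ≤ 2ℚ * U x) (col : ∀ y → ∑ (allFin n) (λ x → C x y) ≤ 2ℚ * U y)
    where

    private
      V : List (Fin n)
      V = allFin n

      c : ℚ
      c = ι n * p

      0≤c : 0ℚ ≤ c
      0≤c = 0≤-* (0≤ι n) 0≤p

      0≤Q : 0ℚ ≤ Q
      0≤Q = ≤-trans 0≤c c≤Q

      0≤κ : 0ℚ ≤ κ
      0≤κ = ≤-trans (0≤-∑ V 0≤U) ∑U≤κ

      M : Fin n → Fin n → ℚ
      M x y = p + C x y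

      0≤M : ∀ x y → 0ℚ ≤ M x y
      0≤M x y = 0≤-+ 0≤p (0≤C x y)

      a b : ℕ → ℚ
      a = α Q
      b = β Q κ

    -- Multiplication by C at most doubles a column sum. The factor `U y` is retained because the
    -- sum of U over all vertices costs κ and not n.
    ∑-walk : ∀ i y → ∑ V (λ x → walk C (suc i) x y) ≤ 2ℚ ^ suc i * U y
    ∑-walk zero    y = begin
      ∑ V (λ x → walk C 1 x y)     ≡⟨ ∑-cong V (λ x → walk-1 C x y) ⟩
      ∑ V (λ x → C x y)            ≤⟨ col y ⟩
      2ℚ * U y                     ≡⟨ solve 1 (λ u → con 2ℚ :* u := con 2ℚ :* con 1ℚ :* u) refl (U y) ⟩
      2ℚ ^ 1 * U y                 ∎
      where open ≤-Reasoning
    ∑-walk (suc i) y = begin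
      ∑ V (λ x → ∑ V (λ z → C x z * walk C (suc i) z y))
        ≡⟨ ∑-swap (λ x z → C x z * walk C (suc i) z y) V V ⟩
      ∑ V (λ z → ∑ V (λ x → C x z * walk C (suc i) z y))
        ≡⟨ ∑-cong V (λ z → ∑-*ʳ (walk C (suc i) z y) (λ x → C x z) V) ⟩
      ∑ V (λ z → ∑ V (λ x → C x z) * walk C (suc i) z y)
        ≤⟨ ∑-mono V (λ z → *-monoˡ (0≤walk 0≤C (suc i) z y) (≤2 z)) ⟩
      ∑ V (λ z → 2ℚ * walk C (suc i) z y)
        ≡⟨ ∑-*ˡ 2ℚ (λ z → walk C (suc i) z y) V ⟩
      2ℚ * ∑ V (λ z → walk C (suc i) z y)
        ≤⟨ *-monoʳ 0≤2 (∑-walk i y) ⟩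
      2ℚ * (2ℚ ^ suc i * U y)
        ≡⟨ *-assoc 2ℚ (2ℚ ^ suc i) (U y) ⟨
      2ℚ ^ suc (suc i) * U y  ∎
      where
      open ≤-Reasoning
      ≤2 : ∀ z → ∑ V (λ x → C x z) ≤ 2ℚ
      ≤2 z = ≤-trans (col z) (≤-trans (*-monoʳ 0≤2 (U≤1 z)) (≤-reflexive (*-identityʳ 2ℚ)))

    -- `p * c ^ i` is the entry of (p J)^(i+1). Errors of order p are confined to the rows and
    -- columns met by C; elsewhere they have order p * p. Without this separation the n diagonal
    -- entries of the trace would add up to n * O(p) = O(1).
    bound : ℕ → Fin n → Fin n → ℚ
    bound i x y = walk C (suc i) x y + p * c ^ i + p * a i * (U x + U y) + p * p * b i

    walk-M : ∀ i x y → walk M (suc i) x y ≤ bound i x y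
    walk-M zero    x y = begin
      walk M 1 x y  ≡⟨ walk-1 M x y ⟩
      p + C x y     ≡⟨ cong (p +_) (walk-1 C x y) ⟨
      p + walk C 1 x y
        ≡⟨ solve 3 (λ p w u → p :+ w := w :+ p :* con 1ℚ :+ p :* con 0ℚ :* u :+ p :* p :* con 0ℚ) refl
             p (walk C 1 x y) (U x + U y) ⟩
      bound zero x y  ∎
      where open ≤-Reasoning
    walk-M (suc i) x y = begin
      ∑ V (λ z → M x z * walk M (suc i) z y)
        ≤⟨ ∑-mono V (λ z → *-monoʳ (0≤M x z) (walk-M i z y)) ⟩
      ∑ V (λ z → M x z * bound i z y)
        ≤⟨ ∑-mono V pointwise ⟩
      ∑ V (λ z → p * A z + C x z * A z + (k₁ + p * (p * a i) * U z) + k₂ * C x z)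
        ≡⟨ split ⟩
      p * ∑ V A + walk C (suc (suc i)) x y + (ι n * k₁ + p * (p * a i) * ∑ V U) + k₂ * ∑ V (C x)
        ≤⟨ +-mono-≤ (+-mono-≤ (+-monoˡ-≤ (walk C (suc (suc i)) x y) (*-monoʳ 0≤p (∑-walk i y)))
             (+-monoʳ-≤ (ι n * k₁) (*-monoʳ (0≤-* 0≤p (0≤-* 0≤p 0≤a)) ∑U≤κ)))
             (*-monoʳ 0≤k₂ (row x)) ⟩
      p * (t * u) + w + (ι n * k₁ + p * (p * a i) * κ) + k₂ * (2ℚ * v)
        ≡⟨ solve 11 (λ p t u w n ci a b κ v two →
              p :* (t :* u) :+ w :+ (n :* (p :* (p :* ci :+ p :* a :* u :+ p :* p :* b)) :+ p :* (p :* a) :* κ)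
                :+ (p :* ci :+ two :* (p :* a) :+ p :* p :* b) :* (two :* v)
              := w :+ p :* (n :* p :* ci)
                 :+ (p :* (t :* u :+ n :* p :* a :* u) :+ p :* (two :* ci :+ (two :* two) :* a) :* v)
                 :+ p :* p :* (a :* κ :+ n :* p :* b :+ two :* (b :* v)))
             refl p t u w (ι n) (c ^ i) (a i) (b i) κ v 2ℚ ⟩
      w + p * c ^ suc i + (p * (t * u + c * a i * u) + p * (2ℚ * c ^ i + (2ℚ * 2ℚ) * a i) * v)
        + p * p * (a i * κ + c * b i + 2ℚ * (b i * v))
        ≤⟨ +-mono-≤ (+-monoʳ-≤ (w + p * c ^ suc i) (+-mono-≤
              (*-monoʳ 0≤p (+-monoʳ-≤ (t * u) (*-monoˡ (0≤U y) (*-monoˡ 0≤a c≤Q))))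
              (*-monoˡ (0≤U x) (*-monoʳ 0≤p (+-monoˡ-≤ (2ℚ * 2ℚ * a i) (*-monoʳ 0≤2 (^-monoˡ i 0≤c c≤Q)))))))
            (*-monoʳ (0≤-* 0≤p 0≤p) (+-mono-≤ (+-monoʳ-≤ (a i * κ) (*-monoˡ 0≤b c≤Q)) (*-monoʳ 0≤2 bv≤b))) ⟩
      w + p * c ^ suc i + (p * (t * u + Q * a i * u) + p * (2ℚ * Q ^ i + (2ℚ * 2ℚ) * a i) * v)
        + p * p * (a i * κ + Q * b i + 2ℚ * b i)
        ≤⟨ +-monoˡ-≤ _ (+-monoʳ-≤ (w + p * c ^ suc i) uneven) ⟩
      w + p * c ^ suc i + p * a (suc i) * (v + u) + p * p * (a i * κ + Q * b i + 2ℚ * b i)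
        ≡⟨ cong (λ z → w + p * c ^ suc i + p * a (suc i) * (v + u) + p * p * z)
             (solve 4 (λ k q b t → k :+ q :* b :+ t :* b := k :+ (q :+ t) :* b) refl (a i * κ) Q (b i) 2ℚ) ⟩
      bound (suc i) x y  ∎
      where
      open ≤-Reasoning

      A : Fin n → ℚ
      A z = walk C (suc i) z y

      k₁ k₂ t u v w : ℚ
      k₁ = p * (p * c ^ i + p * a i * U y + p * p * b i)
      k₂ = p * c ^ i + 2ℚ * (p * a i) + p * p * b i
      t = 2ℚ ^ suc i
      u = U y
      v = U x
      w = walk C (suc (suc i)) x y

      0≤a : 0ℚ ≤ a i
      0≤a = 0≤α 0≤Q i

      0≤b : 0ℚ ≤ b i
      0≤b = 0≤β 0≤Q 0≤κ i

      0≤k₂ : 0ℚ ≤ k₂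
      0≤k₂ = 0≤-+ (0≤-+ (0≤-* 0≤p (0≤-^ i 0≤c)) (0≤-* 0≤2 (0≤-* 0≤p 0≤a))) (0≤-* (0≤-* 0≤p 0≤p) 0≤b)

      bv≤b : b i * v ≤ b i
      bv≤b = ≤-trans (*-monoʳ 0≤b (U≤1 x)) (≤-reflexive (*-identityʳ (b i)))

      -- Under the factor `C x z` both indicators are replaced by 1, since the row sum of C supplies
      -- an indicator by itself, that of x.
      pointwise : ∀ z → M x z * bound i z y ≤ p * A z + C x z * A z + (k₁ + p * (p * a i) * U z) + k₂ * C x z
      pointwise z = begin
        M x z * bound i z y
          ≡⟨ solve 8 (λ p cz A ci a uz uy b →
               (p :+ cz) :* (A :+ p :* ci :+ p :* a :* (uz :+ uy) :+ p :* p :* b)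
               := p :* A :+ cz :* A :+ (p :* (p :* ci :+ p :* a :* uy :+ p :* p :* b) :+ p :* (p :* a) :* uz)
                  :+ (p :* ci :+ (uz :+ uy) :* (p :* a) :+ p :* p :* b) :* cz)
               refl p (C x z) (A z) (c ^ i) (a i) (U z) (U y) (b i) ⟩
        p * A z + C x z * A z + (k₁ + p * (p * a i) * U z)
          + (p * c ^ i + (U z + U y) * (p * a i) + p * p * b i) * C x z
          ≤⟨ +-monoʳ-≤ (p * A z + C x z * A z + (k₁ + p * (p * a i) * U z)) (*-monoˡ (0≤C x z)
               (+-monoˡ-≤ (p * p * b i) (+-monoʳ-≤ (p * c ^ i)
                 (*-monoˡ (0≤-* 0≤p 0≤a) (+-mono-≤ (U≤1 z) (U≤1 y)))))) ⟩
        p * A z + C x z * A z + (k₁ + p * (p * a i) * U z) + k₂ * C x z  ∎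

      split : ∑ V (λ z → p * A z + C x z * A z + (k₁ + p * (p * a i) * U z) + k₂ * C x z)
              ≡ p * ∑ V A + w + (ι n * k₁ + p * (p * a i) * ∑ V U) + k₂ * ∑ V (C x)
      split = begin-equality
        ∑ V (λ z → p * A z + C x z * A z + (k₁ + p * (p * a i) * U z) + k₂ * C x z)
          ≡⟨ ∑-+ (λ z → p * A z + C x z * A z + (k₁ + p * (p * a i) * U z)) (λ z → k₂ * C x z) V ⟩
        ∑ V (λ z → p * A z + C x z * A z + (k₁ + p * (p * a i) * U z)) + ∑ V (λ z → k₂ * C x z)
          ≡⟨ cong₂ _+_ (∑-+ (λ z → p * A z + C x z * A z) (λ z → k₁ + p * (p * a i) * U z) V) (∑-*ˡ k₂ (C x) V) ⟩
        ∑ V (λ z → p * A z + C x z * A z) + ∑ V (λ z → k₁ + p * (p * a i) * U z) + k₂ * ∑ V (C x)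
          ≡⟨ cong (_+ k₂ * ∑ V (C x)) (cong₂ _+_
               (trans (∑-+ (λ z → p * A z) (λ z → C x z * A z) V) (cong (_+ w) (∑-*ˡ p A V)))
               (trans (∑-+ (λ _ → k₁) (λ z → p * (p * a i) * U z) V)
                 (cong₂ _+_ (∑-const n k₁) (∑-*ˡ (p * (p * a i)) U V)))) ⟩
        p * ∑ V A + w + (ι n * k₁ + p * (p * a i) * ∑ V U) + k₂ * ∑ V (C x)  ∎

      -- p J on the left produces first-order terms in U y only, and C on the left terms in U x
      -- only. The missing summands are added to regain one coefficient for U x + U y.
      uneven : p * (t * u + Q * a i * u) + p * (2ℚ * Q ^ i + (2ℚ * 2ℚ) * a i) * v ≤ p * a (suc i) * (v + u)
      uneven = begin
        p * (t * u + Q * a i * u) + p * (2ℚ * Q ^ i + (2ℚ * 2ℚ) * a i) * v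
          ≤⟨ p≤p+q (0≤-+ (0≤-* (0≤-* 0≤p (0≤-+ (0≤-* 0≤2 (0≤-^ i 0≤Q)) (0≤-* 0≤4 0≤a))) (0≤U y))
                          (0≤-* (0≤-* 0≤p (0≤-+ (0≤-^ (suc i) 0≤2) (0≤-* 0≤Q 0≤a))) (0≤U x))) ⟩
        p * (t * u + Q * a i * u) + p * (2ℚ * Q ^ i + (2ℚ * 2ℚ) * a i) * v
          + (p * (2ℚ * Q ^ i + 4ℚ * a i) * u + p * (t + Q * a i) * v)
          ≡⟨ solve 7 (λ p t Q a q u v →
               p :* (t :* u :+ Q :* a :* u) :+ p :* (con 2ℚ :* q :+ (con 2ℚ :* con 2ℚ) :* a) :* v
                 :+ (p :* (con 2ℚ :* q :+ con 4ℚ :* a) :* u :+ p :* (t :+ Q :* a) :* v)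
               := p :* (t :+ con 2ℚ :* q :+ (Q :+ con 4ℚ) :* a) :* (v :+ u))
               refl p t Q (a i) (Q ^ i) u v ⟩
        p * a (suc i) * (v + u)  ∎

    -- On the diagonal the first-order terms are summed over at most κ vertices, and the
    -- second-order ones give n * p * p * β ≤ p * Q * β, so the whole remainder is O(p).
    trace-M : ∀ i → ∑ V (λ x → walk M (suc i) x x)
              ≤ c ^ suc i + ∑ V (λ x → walk C (suc i) x x) + p * (2ℚ * a i * κ + Q * b i)
    trace-M i = begin
      ∑ V (λ x → walk M (suc i) x x)
        ≤⟨ ∑-mono V (λ x → walk-M i x x) ⟩
      ∑ V (λ x → W x + p * c ^ i + p * a i * (U x + U x) + p * p * b i)
        ≡⟨ ∑-cong V (λ x → solve 6 (λ W p ci a u b →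
              W :+ p :* ci :+ p :* a :* (u :+ u) :+ p :* p :* b
              := W :+ (p :* (con 2ℚ :* a) :* u :+ (p :* ci :+ p :* p :* b)))
              refl (W x) p (c ^ i) (a i) (U x) (b i)) ⟩
      ∑ V (λ x → W x + (p * (2ℚ * a i) * U x + k))
        ≡⟨ trans (∑-+ W (λ x → p * (2ℚ * a i) * U x + k) V) (cong (∑ V W +_)
             (trans (∑-+ (λ x → p * (2ℚ * a i) * U x) (λ _ → k) V)
               (cong₂ _+_ (∑-*ˡ (p * (2ℚ * a i)) U V) (∑-const n k)))) ⟩
      ∑ V W + (p * (2ℚ * a i) * ∑ V U + ι n * k)
        ≤⟨ +-monoʳ-≤ (∑ V W) (+-monoˡ-≤ (ι n * k) (*-monoʳ (0≤-* 0≤p (0≤-* 0≤2 (0≤α 0≤Q i))) ∑U≤κ)) ⟩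
      ∑ V W + (p * (2ℚ * a i) * κ + ι n * k)
        ≡⟨ solve 7 (λ W p a κ n ci b →
             W :+ (p :* (con 2ℚ :* a) :* κ :+ n :* (p :* ci :+ p :* p :* b))
             := n :* p :* ci :+ W :+ p :* (con 2ℚ :* a :* κ :+ n :* p :* b))
             refl (∑ V W) p (a i) κ (ι n) (c ^ i) (b i) ⟩
      c ^ suc i + ∑ V W + p * (2ℚ * a i * κ + c * b i)
        ≤⟨ +-monoʳ-≤ (c ^ suc i + ∑ V W) (*-monoʳ 0≤p (+-monoʳ-≤ (2ℚ * a i * κ) (*-monoˡ (0≤β 0≤Q 0≤κ i) c≤Q))) ⟩
      c ^ suc i + ∑ V W + p * (2ℚ * a i * κ + Q * b i)  ∎
      where
      open ≤-Reasoning
      W : Fin n → ℚ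
      W x = walk C (suc i) x x
      k : ℚ
      k = p * c ^ i + p * p * b i

  -- Cycles

  odd : ℕ → Bool
  odd zero          = false
  odd (suc zero)    = true
  odd (suc (suc n)) = odd n

  odd-suc : ∀ n → odd (suc n) ≡ not (odd n)
  odd-suc zero          = refl
  odd-suc (suc zero)    = refl
  odd-suc (suc (suc n)) = odd-suc n

  odd-+-double : ∀ m n → odd (m ℕ.+ m ℕ.+ n) ≡ odd n
  odd-+-double zero    n = refl
  odd-+-double (suc m) n = trans (cong (λ z → odd (suc z ℕ.+ n)) (ℕₚ.+-suc m m)) (odd-+-double m n)

  ∈ᵇ-lookup : ∀ {n k} (vs : Vec (Fin n) k) i → lookup vs i ∈ᵇ vs ≡ true
  ∈ᵇ-lookup (v ∷ vs) zero with v ≟ v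
  ... | yes _  = refl
  ... | no v≢v = contradiction refl v≢v
  ∈ᵇ-lookup (v ∷ vs) (suc i) with v ≟ lookup vs i
  ... | yes _ = refl
  ... | no _  = ∈ᵇ-lookup vs i

  ∈ᵇ⇒lookup : ∀ {n k} {x : Fin n} (vs : Vec (Fin n) k) → x ∈ᵇ vs ≡ true → ∃[ i ] x ≡ lookup vs i
  ∈ᵇ⇒lookup {x = x} (v ∷ vs) x∈ with v ≟ x
  ... | yes v≡x = zero , sym v≡x
  ... | no _ with i , eq ← ∈ᵇ⇒lookup vs x∈ = suc i , eq

  ∉ᵇ⇒All : ∀ {n k} {x : Fin n} (vs : Vec (Fin n) k) → x ∈ᵇ vs ≡ false → All (x ≢_) vs
  ∉ᵇ⇒All []       x∉ = []
  ∉ᵇ⇒All {x = x} (v ∷ vs) x∉ with v ≟ x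
  ... | no v≢x = (λ x≡v → v≢x (sym x≡v)) ∷ ∉ᵇ⇒All vs x∉

  distinct : ∀ {n k} → Vec (Fin n) k → Bool
  distinct []       = true
  distinct (v ∷ vs) = not (v ∈ᵇ vs) ∧ distinct vs

  distinct⇒Unique : ∀ {n k} (vs : Vec (Fin n) k) → distinct vs ≡ true → Unique vs
  distinct⇒Unique []       d = []
  distinct⇒Unique (v ∷ vs) d with v ∈ᵇ vs in eq
  ... | false = ∉ᵇ⇒All vs eq ∷ distinct⇒Unique vs d

  -- Edge lists of paths and cycles

  module _ {n : ℕ} where

    edgesFrom : ∀ {k} → Fin n → Vec (Fin n) k → Fin n → Edges {n}
    edgesFrom x []       y = (x , y) ∷ []
    edgesFrom x (z ∷ vs) y = (x , z) ∷ edgesFrom z vs y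

    cycleEdges : ∀ {k} → Vec (Fin n) (suc k) → Edges {n}
    cycleEdges (x ∷ vs) = edgesFrom x vs x

    length-edgesFrom : ∀ {k} x (vs : Vec (Fin n) k) y → length (edgesFrom x vs y) ≡ suc k
    length-edgesFrom x []       y = refl
    length-edgesFrom x (z ∷ vs) y = cong suc (length-edgesFrom z vs y)

    length-cycleEdges : ∀ {k} (vs : Vec (Fin n) (suc k)) → length (cycleEdges vs) ≡ suc k
    length-cycleEdges (x ∷ vs) = length-edgesFrom x vs x

    -- The k free vertices are the intermediate indices of the matrix product.
    ∑-edgesFrom : ∀ M k x y → ∑ (tuples n k) (λ vs → ∏ (edgesFrom x vs y) M) ≡ walk M (suc k) x y
    ∑-edgesFrom M zero    x y = trans (+-identityʳ (M x y * 1ℚ)) (trans (*-identityʳ (M x y)) (sym (walk-1 M x y)))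
    ∑-edgesFrom M (suc k) x y = trans (∑-tuples (λ vs → ∏ (edgesFrom x vs y) M))
      (∑-cong (allFin n) (λ z → trans (∑-*ˡ (M x z) (λ vs → ∏ (edgesFrom z vs y) M) (tuples n k))
        (cong (M x z *_) (∑-edgesFrom M k z y))))

    -- The vertices are read off from a function on ℕ so that the periodic continuation of a cycle
    -- can be supplied for f.
    ∈-edgesFrom : ∀ {k} x (vs : Vec (Fin n) k) y {e} → e ∈ edgesFrom x vs y →
                  (f : ℕ → Fin n) → f 0 ≡ x → (∀ i → f (suc (toℕ i)) ≡ lookup vs i) → f (suc k) ≡ y →
                  ∃[ a ] e ≡ (f a , f (suc a))
    ∈-edgesFrom x []       y (here refl) f f0 fi fk = 0 , cong₂ _,_ (sym f0) (sym fk)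
    ∈-edgesFrom x (z ∷ vs) y (here refl) f f0 fi fk = 0 , cong₂ _,_ (sym f0) (sym (fi zero))
    ∈-edgesFrom x (z ∷ vs) y (there e∈)  f f0 fi fk
      with a , eq ← ∈-edgesFrom z vs y e∈ (λ i → f (suc i)) (fi zero) (λ i → fi (suc i)) fk = suc a , eq

    source : ∀ {k} {z} {vs : Vec (Fin n) k} {x y y′} → All (x ≢_) (z ∷ vs) → ¬ ((x , y′) ∈ edgesFrom z vs y)
    source {vs = []}    (x≢z ∷ x∉) (here refl) = x≢z refl
    source {vs = _ ∷ _} (x≢z ∷ x∉) (here refl) = x≢z refl
    source {vs = _ ∷ _} (x≢z ∷ x∉) (there e∈)  = source x∉ e∈

    target : ∀ {k} {z} {vs : Vec (Fin n) k} {x y x′} → All (x ≢_) vs → x ≢ y → ¬ ((x′ , x) ∈ edgesFrom z vs y)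
    target []         x≢y (here refl) = x≢y refl
    target (x≢w ∷ x∉) x≢y (here refl) = x≢w refl
    target (x≢w ∷ x∉) x≢y (there e∈)  = target x∉ x≢y e∈

    path : ∀ {k x} {vs : Vec (Fin n) k} {y} → Unique (x ∷ vs) → All (y ≢_) (x ∷ vs) →
           Loopless (edgesFrom x vs y) × Trail (edgesFrom x vs y)
    path {vs = []}     _              (y≢x ∷ []) = (y≢x ∘ sym) ∷ [] , (λ { (inj₁ ()) ; (inj₂ ()) }) ∷ []
    path {vs = z ∷ vs} (x∉@(x≢z ∷ x∉vs) ∷ unique) (y≢x ∷ y∉) with path unique y∉
    ... | loopless , trail = x≢z ∷ loopless , (λ { (inj₁ e∈) → source x∉ e∈ ; (inj₂ e∈) → target x∉vs (y≢x ∘ sym) e∈ }) ∷ trail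

    cycle : ∀ {k} {vs : Vec (Fin n) (3 ℕ.+ k)} → Unique vs → Loopless (cycleEdges vs) × Trail (cycleEdges vs)
    cycle {vs = x ∷ z ∷ w ∷ vs} (x∉@(x≢z ∷ x≢w ∷ x∉vs) ∷ unique@(z∉ ∷ _)) with path unique x∉
    ... | loopless , trail = x≢z ∷ loopless , no-link ∷ trail
      where
      -- The reverse of the first edge could only be the second edge, if w were x, or a later edge
      -- out of z. With two vertices the closing edge would be this reverse, which is why lengths
      -- start at 3.
      no-link : ¬ Linked (edgesFrom z (w ∷ vs) x) x z
      no-link (inj₁ e∈)          = source x∉ e∈
      no-link (inj₂ (here refl)) = x≢w refl
      no-link (inj₂ (there e∈))  = source z∉ e∈

  -- Walks inside the cycle u, lifted to ℕ by continuing u periodically.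
  module Inside {n m : ℕ} (u : Vec (Fin n) (suc m)) (u-unique : Unique u) where

    k : ℕ
    k = suc m

    ū : ℕ → Fin n
    ū a = lookup u (a mod k)

    C : Fin n → Fin n → ℚ
    C = link (cycleEdges u)

    U : Fin n → ℚ
    U x = ⟦ x ∈ᵇ u ⟧

    toℕ-mod : ∀ a → toℕ (a mod k) ≡ a % k
    toℕ-mod a = toℕ-fromℕ< (m%n<n a k)

    ū-cong : ∀ {a b} → a % k ≡ b % k → ū a ≡ ū b
    ū-cong {a} {b} eq = cong (lookup u) (toℕ-injective (trans (toℕ-mod a) (trans eq (sym (toℕ-mod b)))))

    ū-% : ∀ {a b} → ū a ≡ ū b → a % k ≡ b % k
    ū-% {a} {b} eq = trans (sym (toℕ-mod a)) (trans (cong toℕ (lookup-injective u-unique (a mod k) (b mod k) eq)) (toℕ-mod b))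

    ū-toℕ : ∀ i → ū (toℕ i) ≡ lookup u i
    ū-toℕ i = cong (lookup u) (toℕ-injective (trans (toℕ-mod (toℕ i)) (m<n⇒m%n≡m (toℕ<n i))))

    +-%-cong : ∀ {a b} d → a % k ≡ b % k → (d ℕ.+ a) % k ≡ (d ℕ.+ b) % k
    +-%-cong {a} {b} d eq = begin
      (d ℕ.+ a) % k            ≡⟨ %-distribˡ-+ d a k ⟩
      (d % k ℕ.+ a % k) % k    ≡⟨ cong (λ z → (d % k ℕ.+ z) % k) eq ⟩
      (d % k ℕ.+ b % k) % k    ≡⟨ %-distribˡ-+ d b k ⟨
      (d ℕ.+ b) % k            ∎
      where open ≡-Reasoning

    +k-% : ∀ a → (m ℕ.+ suc a) % k ≡ a % k
    +k-% a = trans (cong (_% k) (trans (ℕₚ.+-suc m a) (ℕₚ.+-comm k a))) ([m+n]%n≡m%n a k)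

    suc-%-cancel : ∀ {a b} → suc a % k ≡ suc b % k → a % k ≡ b % k
    suc-%-cancel {a} {b} eq = trans (sym (+k-% a)) (trans (+-%-cong m eq) (+k-% b))

    +-%-cancel : ∀ a {b} → a % k ≡ (a ℕ.+ b) % k → 0 % k ≡ b % k
    +-%-cancel zero    eq = eq
    +-%-cancel (suc a) eq = +-%-cancel a (suc-%-cancel eq)

    -- Indices less than one period apart have distinct residues, and u has no repetition.
    ū-injective : ∀ {a b} → a ℕ.< b → b ℕ.< a ℕ.+ k → ū a ≢ ū b
    ū-injective {a} {b} a<b b<a+k eq with ℕₚ.m≤n⇒∃[o]m+o≡n (ℕₚ.<⇒≤ a<b)
    ... | d , refl = ℕₚ.<-irrefl (sym (trans (cong (a ℕ.+_) d≡0) (ℕₚ.+-identityʳ a))) a<b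
      where
      d≡0 : d ≡ 0
      d≡0 = trans (sym (m<n⇒m%n≡m (ℕₚ.+-cancelˡ-< a d k b<a+k))) (sym (+-%-cancel a (ū-% {a} {a ℕ.+ d} eq)))

    linked⇒ū : ∀ {x y} → Linked (cycleEdges u) x y →
               ∃[ a ] ((x ≡ ū a × y ≡ ū (suc a)) ⊎ (y ≡ ū a × x ≡ ū (suc a)))
    linked⇒ū = Sum.[ (λ e∈ → let a , eq = consecutive e∈ in a , inj₁ (cong proj₁ eq , cong proj₂ eq)) ,
                     (λ e∈ → let a , eq = consecutive e∈ in a , inj₂ (cong proj₁ eq , cong proj₂ eq)) ]
      where
      first : ∀ {m} (u : Vec (Fin n) (suc m)) {e} (f : ℕ → Fin n) →
              (∀ i → f (toℕ i) ≡ lookup u i) → f (suc m) ≡ f 0 → e ∈ cycleEdges u → ∃[ a ] e ≡ (f a , f (suc a))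
      first (x ∷ vs) f fi fm e∈ = ∈-edgesFrom x vs x e∈ f (fi zero) (λ i → fi (suc i)) (trans fm (fi zero))

      consecutive : ∀ {e} → e ∈ cycleEdges u → ∃[ a ] e ≡ (ū a , ū (suc a))
      consecutive = first u ū ū-toℕ (ū-cong {k} {0} ([m+n]%n≡m%n 0 k))

    -- Centred at `suc b` so that both neighbours on the cycle have natural indices.
    C-ū : ∀ b y → C (ū (suc b)) y ≤ δ (ū b) y + δ (ū (2 ℕ.+ b)) y
    C-ū b y with linked? (cycleEdges u) (ū (suc b)) y
    ... | no ¬l = subst (_≤ δ (ū b) y + δ (ū (2 ℕ.+ b)) y) (sym (link-no {es = cycleEdges u} ¬l))
                    (0≤-+ (0≤δ (ū b) y) (0≤δ (ū (2 ℕ.+ b)) y))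
    ... | yes l with linked⇒ū l
    ...   | a , inj₁ (eq , refl) = begin
      C (ū (suc b)) (ū (suc a))   ≤⟨ ⟦ does (linked? (cycleEdges u) (ū (suc b)) (ū (suc a))) ⟧≤1 ⟩
      1ℚ                          ≡⟨ δ-refl (ū (suc a)) ⟨
      δ (ū (suc a)) (ū (suc a))   ≡⟨ cong (λ z → δ z (ū (suc a))) (ū-cong {suc a} {2 ℕ.+ b} (+-%-cong 1 (sym (ū-% {suc b} {a} eq)))) ⟩
      δ (ū (2 ℕ.+ b)) (ū (suc a)) ≤⟨ q≤p+q (0≤δ (ū b) (ū (suc a))) ⟩
      δ (ū b) (ū (suc a)) + δ (ū (2 ℕ.+ b)) (ū (suc a)) ∎
      where open ≤-Reasoning
    ...   | a , inj₂ (refl , eq) = begin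
      C (ū (suc b)) (ū a)   ≤⟨ ⟦ does (linked? (cycleEdges u) (ū (suc b)) (ū a)) ⟧≤1 ⟩
      1ℚ                    ≡⟨ δ-refl (ū a) ⟨
      δ (ū a) (ū a)         ≡⟨ cong (λ z → δ z (ū a)) (ū-cong {a} {b} (sym (suc-%-cancel (ū-% {suc b} {suc a} eq)))) ⟩
      δ (ū b) (ū a)         ≤⟨ p≤p+q (0≤δ (ū (2 ℕ.+ b)) (ū a)) ⟩
      δ (ū b) (ū a) + δ (ū (2 ℕ.+ b)) (ū a) ∎
      where open ≤-Reasoning

    C-outside : ∀ {x} y → x ∈ᵇ u ≡ false → C x y ≡ 0ℚ
    C-outside {x} y x∉ = link-no {es = cycleEdges u} outside
      where
      ū∈ : ∀ a → x ≢ ū a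
      ū∈ a refl with () ← trans (sym x∉) (∈ᵇ-lookup u (a mod k))
      outside : ¬ Linked (cycleEdges u) x y
      outside l with linked⇒ū l
      ... | a , inj₁ (eq , _) = ū∈ a eq
      ... | a , inj₂ (_ , eq) = ū∈ (suc a) eq

    -- The index is moved up by a full period k = m + 1, which makes room for its predecessor.
    ∈⇒ū-suc : ∀ {x} → x ∈ᵇ u ≡ true → ∃[ b ] x ≡ ū (suc b)
    ∈⇒ū-suc x∈ with i , eq ← ∈ᵇ⇒lookup u x∈ = toℕ i ℕ.+ m , trans eq (trans (sym (ū-toℕ i))
      (ū-cong {toℕ i} {suc (toℕ i ℕ.+ m)} (sym (trans (cong (_% k) (sym (ℕₚ.+-suc (toℕ i) m))) ([m+n]%n≡m%n (toℕ i) k)))))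

    ∑-C-ū : ∀ b (g : Fin n → ℚ) → (∀ z → 0ℚ ≤ g z) →
            ∑ (allFin n) (λ z → C (ū (suc b)) z * g z) ≤ g (ū b) + g (ū (2 ℕ.+ b))
    ∑-C-ū b g 0≤g = begin
      ∑ (allFin n) (λ z → C (ū (suc b)) z * g z)
        ≤⟨ ∑-mono (allFin n) (λ z → *-monoˡ (0≤g z) (C-ū b z)) ⟩
      ∑ (allFin n) (λ z → (δ (ū b) z + δ (ū (2 ℕ.+ b)) z) * g z)
        ≡⟨ ∑-cong (allFin n) (λ z → *-distribʳ-+ (g z) (δ (ū b) z) (δ (ū (2 ℕ.+ b)) z)) ⟩
      ∑ (allFin n) (λ z → δ (ū b) z * g z + δ (ū (2 ℕ.+ b)) z * g z)
        ≡⟨ ∑-+ (λ z → δ (ū b) z * g z) (λ z → δ (ū (2 ℕ.+ b)) z * g z) (allFin n) ⟩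
      ∑ (allFin n) (λ z → δ (ū b) z * g z) + ∑ (allFin n) (λ z → δ (ū (2 ℕ.+ b)) z * g z)
        ≡⟨ cong₂ _+_ (∑-δ (ū b) g) (∑-δ (ū (2 ℕ.+ b)) g) ⟩
      g (ū b) + g (ū (2 ℕ.+ b))  ∎
      where open ≤-Reasoning

    row : ∀ x → ∑ (allFin n) (C x) ≤ 2ℚ * U x
    row x with x ∈ᵇ u in eq
    ... | false = ≤-reflexive (trans (∑-cong (allFin n) (λ y → C-outside y eq)) (∑-zero (allFin n)))
    ... | true with b , refl ← ∈⇒ū-suc eq = begin
      ∑ (allFin n) (C (ū (suc b)))                      ≡⟨ ∑-cong (allFin n) (λ z → *-identityʳ (C (ū (suc b)) z)) ⟨
      ∑ (allFin n) (λ z → C (ū (suc b)) z * 1ℚ)         ≤⟨ ∑-C-ū b (λ _ → 1ℚ) (λ _ → 0≤1) ⟩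
      1ℚ + 1ℚ                                           ≡⟨ *-identityʳ 2ℚ ⟨
      2ℚ * 1ℚ                                           ∎
      where open ≤-Reasoning

    col : ∀ y → ∑ (allFin n) (λ x → C x y) ≤ 2ℚ * U y
    col y = ≤-trans (≤-reflexive (∑-cong (allFin n) (λ x → link-sym (cycleEdges u) x y))) (row y)

    step : ∀ i b y → walk C (suc i) (ū (suc b)) y ≤ walk C i (ū b) y + walk C i (ū (2 ℕ.+ b)) y
    step i b y = ∑-C-ū b (λ z → walk C i z y) (λ z → 0≤walk (0≤link (cycleEdges u)) i z y)

    -- In i steps the lifted walk reaches a - i, a - i + 2, …, a + i only.
    too-short : ∀ i a t → i ℕ.≤ a → a ℕ.+ i ℕ.< t ℕ.+ k → t ℕ.+ i ℕ.< a ℕ.+ k → odd (a ℕ.+ i ℕ.+ t) ≡ true →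
                walk C i (ū a) (ū t) ≤ 0ℚ
    -- The lifts of the target near the start are t - k, t and t + k. The two inequalities put t + k
    -- and t - k out of reach, and parity excludes t.
    too-short zero a t _ a<t+k t<a+k parity = ≤-reflexive (δ-≢ ū≢)
      where
      a+0 : a ℕ.+ 0 ≡ a
      a+0 = ℕₚ.+-identityʳ a
      ū≢ : ū a ≢ ū t
      ū≢ with ℕₚ.<-cmp a t
      ... | tri< a<t _ _ = ū-injective a<t (subst (ℕ._< a ℕ.+ k) (ℕₚ.+-identityʳ t) t<a+k)
      ... | tri> _ _ t<a = λ eq → ū-injective t<a (subst (ℕ._< t ℕ.+ k) a+0 a<t+k) (sym eq)
      ... | tri≈ _ refl _
        with () ← trans (sym parity) (trans (cong odd (trans (cong (ℕ._+ a) a+0) (sym (ℕₚ.+-identityʳ (a ℕ.+ a))))) (odd-+-double a 0))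
    -- `i ≤ a` keeps the walk in ℕ: as long as a step is left, a has a predecessor.
    too-short (suc i) (suc b) t (s≤s i≤b) lt₁ lt₂ parity = ≤-trans (step i b (ū t)) (+-mono-≤
        (too-short i b t i≤b (ℕₚ.<-trans b+i< lt₁′) (ℕₚ.≤-pred (subst (ℕ._< suc (b ℕ.+ k)) (ℕₚ.+-suc t i) lt₂)) parity′)
        (too-short i (2 ℕ.+ b) t (ℕₚ.m≤n⇒m≤o+n 2 i≤b) lt₁′ (ℕₚ.<-trans (ℕₚ.+-monoʳ-< t (ℕₚ.n<1+n i)) (ℕₚ.m<n⇒m<1+n lt₂)) parity′))
      where
      lt₁′ : 2 ℕ.+ b ℕ.+ i ℕ.< t ℕ.+ k
      lt₁′ = subst (ℕ._< t ℕ.+ k) (cong suc (ℕₚ.+-suc b i)) lt₁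
      b+i< : b ℕ.+ i ℕ.< 2 ℕ.+ b ℕ.+ i
      b+i< = ℕₚ.m<n⇒m<1+n (ℕₚ.n<1+n (b ℕ.+ i))
      parity′ : odd (b ℕ.+ i ℕ.+ t) ≡ true
      parity′ = trans (cong (λ z → odd (suc z ℕ.+ t)) (sym (ℕₚ.+-suc b i))) parity

    module _ (k-odd : odd k ≡ true) where

      -- The lift t + k is the extreme point a + i, so every step must go up; after a step down
      -- `too-short` applies. Oddness of k keeps the lift t itself unreachable and `i < k` the lift
      -- t - k.
      upwards : ∀ i a t → i ℕ.≤ a → i ℕ.< k → a ℕ.+ i ≡ t ℕ.+ k → walk C i (ū a) (ū t) ≤ 1ℚ
      upwards zero    a       t _         _     _  = ⟦ does (ū a ≟ ū t) ⟧≤1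
      upwards (suc i) (suc b) t (s≤s i≤b) 1+i<k eq = ≤-trans (step i b (ū t)) (+-mono-≤
        (too-short i b t i≤b b+i< t+i< parity)
        (upwards i (2 ℕ.+ b) t (ℕₚ.m≤n⇒m≤o+n 2 i≤b) (ℕₚ.<-trans (ℕₚ.n<1+n i) 1+i<k) eq′))
        where
        eq′ : 2 ℕ.+ b ℕ.+ i ≡ t ℕ.+ k
        eq′ = trans (sym (cong suc (ℕₚ.+-suc b i))) eq
        b+i< : b ℕ.+ i ℕ.< t ℕ.+ k
        b+i< = subst (b ℕ.+ i ℕ.<_) eq′ (ℕₚ.m<n⇒m<1+n (ℕₚ.n<1+n (b ℕ.+ i)))
        t+i< : t ℕ.+ i ℕ.< b ℕ.+ k
        t+i< = ℕₚ.+-cancelʳ-< k (t ℕ.+ i) (b ℕ.+ k) (begin-strict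
          t ℕ.+ i ℕ.+ k            ≡⟨ ℕ-solve 3 (λ t i k → t ℕ:+ i ℕ:+ k ℕ:= t ℕ:+ k ℕ:+ i) refl t i k ⟩
          t ℕ.+ k ℕ.+ i            ≡⟨ cong (ℕ._+ i) eq′ ⟨
          2 ℕ.+ b ℕ.+ i ℕ.+ i      ≡⟨ ℕ-solve 2 (λ b i → ℕcon 2 ℕ:+ b ℕ:+ i ℕ:+ i ℕ:= b ℕ:+ (ℕcon 1 ℕ:+ i) ℕ:+ (ℕcon 1 ℕ:+ i)) refl b i ⟩
          b ℕ.+ suc i ℕ.+ suc i    <⟨ ℕₚ.+-mono-< (ℕₚ.+-monoʳ-< b 1+i<k) 1+i<k ⟩
          b ℕ.+ k ℕ.+ k            ∎)
          where open ℕₚ.≤-Reasoning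
        parity : odd (b ℕ.+ i ℕ.+ t) ≡ true
        parity = trans (cong (λ z → odd (z ℕ.+ t)) eq′)
          (trans (cong odd (ℕ-solve 2 (λ t k → t ℕ:+ k ℕ:+ t ℕ:= t ℕ:+ t ℕ:+ k) refl t k)) (trans (odd-+-double t k) k-odd))

      -- The mirror case: the lift t - k is the extreme point a - i.
      downwards : ∀ i a t → i ℕ.≤ a → i ℕ.< k → a ℕ.+ k ≡ t ℕ.+ i → walk C i (ū a) (ū t) ≤ 1ℚ
      downwards zero    a       t _         _     _  = ⟦ does (ū a ≟ ū t) ⟧≤1
      downwards (suc i) (suc b) t (s≤s i≤b) 1+i<k eq = ≤-trans (step i b (ū t)) (+-mono-≤
        (downwards i b t i≤b (ℕₚ.<-trans (ℕₚ.n<1+n i) 1+i<k) eq′)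
        (too-short i (2 ℕ.+ b) t (ℕₚ.m≤n⇒m≤o+n 2 i≤b) b+i< t+i< parity))
        where
        eq′ : b ℕ.+ k ≡ t ℕ.+ i
        eq′ = ℕₚ.suc-injective (trans eq (ℕₚ.+-suc t i))
        b+i< : 2 ℕ.+ b ℕ.+ i ℕ.< t ℕ.+ k
        b+i< = ℕₚ.+-cancelʳ-< k (2 ℕ.+ b ℕ.+ i) (t ℕ.+ k) (begin-strict
          2 ℕ.+ b ℕ.+ i ℕ.+ k      ≡⟨ ℕ-solve 3 (λ b i k → ℕcon 2 ℕ:+ b ℕ:+ i ℕ:+ k ℕ:= ℕcon 2 ℕ:+ (b ℕ:+ k) ℕ:+ i) refl b i k ⟩
          2 ℕ.+ (b ℕ.+ k) ℕ.+ i    ≡⟨ cong (λ z → 2 ℕ.+ z ℕ.+ i) eq′ ⟩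
          2 ℕ.+ (t ℕ.+ i) ℕ.+ i    ≡⟨ ℕ-solve 2 (λ t i → ℕcon 2 ℕ:+ (t ℕ:+ i) ℕ:+ i ℕ:= t ℕ:+ (ℕcon 1 ℕ:+ i) ℕ:+ (ℕcon 1 ℕ:+ i)) refl t i ⟩
          t ℕ.+ suc i ℕ.+ suc i    <⟨ ℕₚ.+-mono-< (ℕₚ.+-monoʳ-< t 1+i<k) 1+i<k ⟩
          t ℕ.+ k ℕ.+ k            ∎)
          where open ℕₚ.≤-Reasoning
        t+i< : t ℕ.+ i ℕ.< 2 ℕ.+ b ℕ.+ k
        t+i< = subst (ℕ._< 2 ℕ.+ b ℕ.+ k) eq′ (ℕₚ.m<n⇒m<1+n (ℕₚ.n<1+n (b ℕ.+ k)))
        parity : odd (b ℕ.+ i ℕ.+ t) ≡ true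
        parity = begin
          odd (b ℕ.+ i ℕ.+ t)        ≡⟨ odd-+-double k (b ℕ.+ i ℕ.+ t) ⟨
          odd (k ℕ.+ k ℕ.+ (b ℕ.+ i ℕ.+ t))
            ≡⟨ cong odd (ℕ-solve 4 (λ k b i t → k ℕ:+ k ℕ:+ (b ℕ:+ i ℕ:+ t) ℕ:= (b ℕ:+ k) ℕ:+ (t ℕ:+ i) ℕ:+ k) refl k b i t) ⟩
          odd (b ℕ.+ k ℕ.+ (t ℕ.+ i) ℕ.+ k)   ≡⟨ cong (λ z → odd (z ℕ.+ (t ℕ.+ i) ℕ.+ k)) eq′ ⟩
          odd (t ℕ.+ i ℕ.+ (t ℕ.+ i) ℕ.+ k)   ≡⟨ odd-+-double (t ℕ.+ i) k ⟩
          odd k                      ≡⟨ k-odd ⟩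
          true                       ∎
          where open ≡-Reasoning

      -- Starting at t = s + k leaves room for l ≤ k steps down. If l < k, the lifts t + k and t - k
      -- are too far and t has the wrong parity. If l = k, the first step fixes the direction and
      -- each direction admits one walk; hence the 2.
      closed : ∀ l → l ℕ.≤ k → odd l ≡ true → ∀ s → walk C l (ū (s ℕ.+ k)) (ū (s ℕ.+ k)) ≤ 2ℚ * ⟦ does (l ℕ.≟ k) ⟧
      closed l l≤k l-odd s with l ℕ.≟ k
      ... | no l≢k = subst (λ b → walk C l (ū t) (ū t) ≤ 2ℚ * ⟦ b ⟧) (sym (dec-false (l ℕ.≟ k) l≢k))
          (too-short l t t (ℕₚ.≤-trans l≤k (ℕₚ.m≤n+m k s)) t+l< t+l<
            (trans (cong odd (ℕ-solve 2 (λ t l → t ℕ:+ l ℕ:+ t ℕ:= t ℕ:+ t ℕ:+ l) refl t l)) (trans (odd-+-double t l) l-odd)))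
        where
        t : ℕ
        t = s ℕ.+ k
        t+l< : t ℕ.+ l ℕ.< t ℕ.+ k
        t+l< = ℕₚ.+-monoʳ-< t (ℕₚ.≤∧≢⇒< l≤k l≢k)
      ... | yes refl rewrite ℕₚ.+-suc s m | dec-true (m ℕ.≟ m) refl = ≤-trans (step m (s ℕ.+ m) (ū (suc (s ℕ.+ m)))) (+-mono-≤
        (downwards m (s ℕ.+ m) (suc (s ℕ.+ m)) (ℕₚ.m≤n+m m s) (ℕₚ.n<1+n m) (ℕₚ.+-suc (s ℕ.+ m) m))
        (upwards m (2 ℕ.+ (s ℕ.+ m)) (suc (s ℕ.+ m)) (ℕₚ.m≤n⇒m≤o+n 2 (ℕₚ.m≤n+m m s)) (ℕₚ.n<1+n m)
          (cong suc (sym (ℕₚ.+-suc (s ℕ.+ m) m)))))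

      trace : ∀ i → suc i ℕ.≤ k → odd (suc i) ≡ true →
              ∑ (allFin n) (λ x → walk C (suc i) x x) ≤ ι k * (2ℚ * ⟦ does (suc i ℕ.≟ k) ⟧)
      trace i l≤k l-odd = begin
        ∑ (allFin n) W
          ≤⟨ ∑-mono (allFin n) localise ⟩
        ∑ (allFin n) (λ x → ⟦ x ∈ᵇ u ⟧ * r)
          ≡⟨ ∑-*ʳ r U (allFin n) ⟩
        ∑ (allFin n) U * r
          ≤⟨ *-monoˡ (0≤-* 0≤2 0≤⟦ does (suc i ℕ.≟ k) ⟧) (∑-∈ᵇ u) ⟩
        ι k * r  ∎
        where
        open ≤-Reasoning
        W : Fin n → ℚ
        W x = walk C (suc i) x x
        r : ℚ
        r = 2ℚ * ⟦ does (suc i ℕ.≟ k) ⟧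
        localise : ∀ x → W x ≤ ⟦ x ∈ᵇ u ⟧ * r
        localise x with x ∈ᵇ u in eq
        ... | false = ≤-reflexive (trans (∑-cong (allFin n) (λ z → trans (cong (_* walk C i z x) (C-outside z eq)) (*-zeroˡ (walk C i z x))))
                        (trans (∑-zero (allFin n)) (sym (*-zeroˡ r))))
        ... | true with j , x≡ ← ∈ᵇ⇒lookup u eq = ≤-trans
          (subst (λ z → W z ≤ r) (sym (trans x≡ (trans (sym (ū-toℕ j)) (ū-cong {toℕ j} {toℕ j ℕ.+ k} (sym ([m+n]%n≡m%n (toℕ j) k))))))
            (closed (suc i) l≤k l-odd (toℕ j)))
          (≤-reflexive (sym (*-identityˡ r)))

  -- Moments of the cycle counts

  len : ℕ → ℕ
  len j = 3 ℕ.+ (j ℕ.+ j)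

  odd-len : ∀ j → odd (len j) ≡ true
  odd-len j = trans (cong odd (ℕₚ.+-comm 1 (j ℕ.+ j))) (odd-+-double j 1)

  len-injective : ∀ {i j} → len i ≡ len j → i ≡ j
  len-injective {i} {j} eq = ℕₚ.*-cancelˡ-≡ i j 2
    (trans (cong (i ℕ.+_) (ℕₚ.+-identityʳ i)) (trans (ℕₚ.+-cancelˡ-≡ 3 _ _ eq) (sym (cong (j ℕ.+_) (ℕₚ.+-identityʳ j)))))

  len-mono : ∀ {i j} → i ℕ.≤ j → len i ℕ.≤ len j
  len-mono i≤j = ℕₚ.+-monoʳ-≤ 3 (ℕₚ.+-mono-≤ i≤j i≤j)

  ∏-const : ∀ {n} q (es : Edges {n}) → ∏ es (λ x y → q + link [] x y) ≡ q ^ length es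
  ∏-const q []       = refl
  ∏-const q (e ∷ es) = cong₂ _*_ (+-identityʳ q) (∏-const q es)

  ∑-tuples-const : ∀ n k q → ∑ (tuples n k) (λ _ → q) ≡ ι n ^ k * q
  ∑-tuples-const n zero    q = trans (+-identityʳ q) (sym (*-identityˡ q))
  ∑-tuples-const n (suc k) q = trans (∑-tuples {n} {k} (λ _ → q))
    (trans (∑-cong (allFin n) (λ _ → ∑-tuples-const n k q))
      (trans (∑-const n (ι n ^ k * q)) (sym (*-assoc (ι n) (ι n ^ k) q))))

  -- The falling factorial n (n - 1) ... (n - k + 1). Only the bounds `count≤` and `count-suc` are
  -- used about it.
  count : ℕ → ℕ → ℚ
  count n k = ∑ (tuples n k) (λ vs → ⟦ distinct vs ⟧)

  count≤ : ∀ n k → count n k ≤ ι n ^ k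
  count≤ n k = ≤-trans (∑-mono (tuples n k) (λ vs → ⟦ distinct vs ⟧≤1))
    (≤-reflexive (trans (∑-tuples-const n k 1ℚ) (*-identityʳ (ι n ^ k))))

  -- A tuple of k vertices leaves at least n - k vertices for one more entry.
  count-suc : ∀ n k → (ι n - ι k) * count n k ≤ count n (suc k)
  count-suc n k = begin
    (ι n - ι k) * count n k
      ≡⟨ ∑-*ˡ (ι n - ι k) (λ vs → ⟦ distinct vs ⟧) (tuples n k) ⟨
    ∑ (tuples n k) (λ vs → (ι n - ι k) * ⟦ distinct vs ⟧)
      ≤⟨ ∑-mono (tuples n k) (λ vs → *-monoˡ 0≤⟦ distinct vs ⟧ (fresh vs)) ⟩
    ∑ (tuples n k) (λ vs → ∑ (allFin n) (λ v → ⟦ not (v ∈ᵇ vs) ⟧) * ⟦ distinct vs ⟧)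
      ≡⟨ ∑-cong (tuples n k) (λ vs → ∑-*ʳ ⟦ distinct vs ⟧ (λ v → ⟦ not (v ∈ᵇ vs) ⟧) (allFin n)) ⟨
    ∑ (tuples n k) (λ vs → ∑ (allFin n) (λ v → ⟦ not (v ∈ᵇ vs) ⟧ * ⟦ distinct vs ⟧))
      ≡⟨ ∑-swap (λ vs v → ⟦ not (v ∈ᵇ vs) ⟧ * ⟦ distinct vs ⟧) (tuples n k) (allFin n) ⟩
    ∑ (allFin n) (λ v → ∑ (tuples n k) (λ vs → ⟦ not (v ∈ᵇ vs) ⟧ * ⟦ distinct vs ⟧))
      ≡⟨ ∑-cong (allFin n) (λ v → ∑-cong (tuples n k) (λ vs → ⟦∧⟧ (not (v ∈ᵇ vs)) (distinct vs))) ⟨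
    ∑ (allFin n) (λ v → ∑ (tuples n k) (λ vs → ⟦ distinct (v ∷ vs) ⟧))
      ≡⟨ ∑-tuples {n} {k} (λ vs → ⟦ distinct vs ⟧) ⟨
    count n (suc k)  ∎
    where
    open ≤-Reasoning
    fresh : ∀ vs → ι n - ι k ≤ ∑ (allFin n) (λ v → ⟦ not (v ∈ᵇ vs) ⟧)
    fresh vs = begin
      ι n - ι k
        ≤⟨ +-monoʳ-≤ (ι n) (neg-antimono-≤ (∑-∈ᵇ vs)) ⟩
      ι n - ∑ (allFin n) (λ v → ⟦ v ∈ᵇ vs ⟧)
        ≡⟨ solve 2 (λ n s → n :- s := n :* con 1ℚ :+ con (- 1ℚ) :* s) refl (ι n) (∑ (allFin n) (λ v → ⟦ v ∈ᵇ vs ⟧)) ⟩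
      ι n * 1ℚ + (- 1ℚ) * ∑ (allFin n) (λ v → ⟦ v ∈ᵇ vs ⟧)
        ≡⟨ cong₂ _+_ (∑-const n 1ℚ) (∑-*ˡ (- 1ℚ) (λ v → ⟦ v ∈ᵇ vs ⟧) (allFin n)) ⟨
      ∑ (allFin n) (λ _ → 1ℚ) + ∑ (allFin n) (λ v → (- 1ℚ) * ⟦ v ∈ᵇ vs ⟧)
        ≡⟨ ∑-+ (λ _ → 1ℚ) (λ v → (- 1ℚ) * ⟦ v ∈ᵇ vs ⟧) (allFin n) ⟨
      ∑ (allFin n) (λ v → 1ℚ + (- 1ℚ) * ⟦ v ∈ᵇ vs ⟧)
        ≡⟨ ∑-cong (allFin n) (λ v → trans (⟦not⟧ (v ∈ᵇ vs))
             (solve 1 (λ b → con 1ℚ :- b := con 1ℚ :+ con (- 1ℚ) :* b) refl ⟦ v ∈ᵇ vs ⟧)) ⟨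
      ∑ (allFin n) (λ v → ⟦ not (v ∈ᵇ vs) ⟧)  ∎

  -- The loss of the mean of X against c^k, as a multiple of p. One more vertex multiplies the mean
  -- by at least c - p k, so the old loss is scaled by c ≤ Q and a new loss p k Q^k appears.
  ρ : ℚ → ℕ → ℚ
  ρ Q zero    = 0ℚ
  ρ Q (suc k) = Q * ρ Q k + ι k * Q ^ k

  0≤ρ : ∀ {Q} → 0ℚ ≤ Q → ∀ k → 0ℚ ≤ ρ Q k
  0≤ρ 0≤Q zero    = ≤-refl
  0≤ρ 0≤Q (suc k) = 0≤-+ (0≤-* 0≤Q (0≤ρ 0≤Q k)) (0≤-* (0≤ι k) (0≤-^ k 0≤Q))

  -- The remainder of `trace-M` for walks of length `len j` with `κ = ι (len i)`, times the bound
  -- `Q ^ len i` for c^(len i). It does not involve n.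
  σ : ℚ → ℕ → ℕ → ℚ
  σ Q i j = Q ^ len i * (2ℚ * α Q (2 ℕ.+ (j ℕ.+ j)) * ι (len i) + Q * β Q (ι (len i)) (2 ℕ.+ (j ℕ.+ j)))

  0≤σ : ∀ {Q} → 0ℚ ≤ Q → ∀ i j → 0ℚ ≤ σ Q i j
  0≤σ 0≤Q i j = 0≤-* (0≤-^ (len i) 0≤Q) (0≤-+ (0≤-* (0≤-* 0≤2 (0≤α 0≤Q (2 ℕ.+ (j ℕ.+ j)))) (0≤ι (len i)))
    (0≤-* 0≤Q (0≤β 0≤Q (0≤ι (len i)) (2 ℕ.+ (j ℕ.+ j)))))

  isCycle : ∀ {n k} → Vec (Fin n) (suc k) → EdgeBits n → Bool
  isCycle vs ω = distinct vs ∧ present (cycleEdges vs) ω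

  -- Each cycle is counted once for every starting vertex and direction, so the mean is near
  -- `c ^ len j` without a factor 1 / (2 len j).
  X : ∀ {n} → ℕ → EdgeBits n → ℚ
  X {n} j ω = ∑ (tuples n (len j)) (λ vs → ⟦ isCycle vs ω ⟧)

  module CycleCounts {n : ℕ} {p Q : ℚ} (0≤p : 0ℚ ≤ p) (p≤1 : p ≤ 1ℚ) (c≤Q : ι n * p ≤ Q) where

    c : ℚ
    c = ι n * p

    0≤c : 0ℚ ≤ c
    0≤c = 0≤-* (0≤ι n) 0≤p

    0≤Q : 0ℚ ≤ Q
    0≤Q = ≤-trans 0≤c c≤Q

    private
      e : ℕ → ℚ
      e k = p ^ k * count n k

      e≤ : ∀ k → e k ≤ Q ^ k
      e≤ k = begin
        p ^ k * count n k    ≤⟨ *-monoʳ (0≤-^ k 0≤p) (count≤ n k) ⟩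
        p ^ k * ι n ^ k      ≡⟨ *-comm (p ^ k) (ι n ^ k) ⟩
        ι n ^ k * p ^ k      ≡⟨ *-^ (ι n) p k ⟨
        c ^ k                ≤⟨ ^-monoˡ k 0≤c c≤Q ⟩
        Q ^ k                ∎
        where open ≤-Reasoning

      ≤e : ∀ k → c ^ k - p * ρ Q k ≤ e k
      ≤e zero    = ≤-reflexive (trans (solve 1 (λ p → con 1ℚ :- p :* con 0ℚ := con 1ℚ) refl p) refl)
      ≤e (suc k) = begin
        c ^ suc k - p * (Q * ρ Q k + ι k * Q ^ k)
          ≡⟨ solve 6 (λ c ck p Q r s → c :* ck :- p :* (Q :* r :+ s) := c :* ck :- (Q :* (p :* r) :+ p :* s))
               refl c (c ^ k) p Q (ρ Q k) (ι k * Q ^ k) ⟩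
        c ^ suc k - (Q * (p * ρ Q k) + p * (ι k * Q ^ k))
          ≤⟨ +-monoʳ-≤ (c ^ suc k) (neg-antimono-≤ (+-mono-≤ (*-monoˡ (0≤-* 0≤p (0≤ρ 0≤Q k)) c≤Q)
               (*-monoʳ 0≤p (*-monoʳ (0≤ι k) (e≤ k))))) ⟩
        c ^ suc k - (c * (p * ρ Q k) + p * (ι k * e k))
          ≡⟨ solve 6 (λ c ck p r s e → c :* ck :- (c :* (p :* r) :+ p :* (s :* e)) := c :* (ck :- p :* r) :- p :* s :* e)
               refl c (c ^ k) p (ρ Q k) (ι k) (e k) ⟩
        c * (c ^ k - p * ρ Q k) - p * ι k * e k
          ≤⟨ +-monoˡ-≤ (- (p * ι k * e k)) (*-monoʳ 0≤c (≤e k)) ⟩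
        c * e k - p * ι k * e k
          ≡⟨ solve 5 (λ n p k q m → n :* p :* (q :* m) :- p :* k :* (q :* m) := p :* q :* ((n :- k) :* m))
               refl (ι n) p (ι k) (p ^ k) (count n k) ⟩
        p ^ suc k * ((ι n - ι k) * count n k)
          ≤⟨ *-monoʳ (0≤-^ (suc k) 0≤p) (count-suc n k) ⟩
        e (suc k)  ∎
        where open ≤-Reasoning

    first-moment : ∀ j → c ^ len j - p * ρ Q (len j) ≤ 𝔼 {n} p (X j)
    first-moment j = begin
      c ^ len j - p * ρ Q (len j)   ≤⟨ ≤e (len j) ⟩
      p ^ len j * count n (len j)   ≡⟨ ∑-*ˡ (p ^ len j) (λ vs → ⟦ distinct vs ⟧) (tuples n (len j)) ⟨
      ∑ (tuples n (len j)) (λ vs → p ^ len j * ⟦ distinct vs ⟧)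
        ≤⟨ ∑-mono (tuples n (len j)) likely ⟩
      ∑ (tuples n (len j)) (λ vs → 𝔼 p (λ ω → ⟦ isCycle vs ω ⟧))
        ≡⟨ 𝔼-∑ p (λ vs ω → ⟦ isCycle vs ω ⟧) (tuples n (len j)) ⟨
      𝔼 {n} p (X j)                 ∎
      where
      open ≤-Reasoning
      likely : ∀ (vs : Vec (Fin n) (len j)) → p ^ len j * ⟦ distinct vs ⟧ ≤ 𝔼 p (λ ω → ⟦ isCycle vs ω ⟧)
      likely vs with distinct vs in eq
      ... | false = ≤-reflexive (trans (*-zeroʳ (p ^ len j)) (sym (trans
        (𝔼-cong {n} p {g = λ _ → 0ℚ * 0ℚ} (λ ω → refl)) (trans (𝔼-* {n} p 0ℚ (λ _ → 0ℚ)) (*-zeroˡ (𝔼 {n} p (λ _ → 0ℚ)))))))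
      ... | true with loopless , _ ← cycle (distinct⇒Unique vs eq) = begin
        p ^ len j * 1ℚ                              ≡⟨ *-identityʳ (p ^ len j) ⟩
        p ^ len j                                   ≡⟨ cong (p ^_) (length-cycleEdges vs) ⟨
        p ^ length (cycleEdges vs)                  ≤⟨ ^≤μ-mask 0≤p p≤1 loopless ⟩
        μ p (mask (cycleEdges vs))                  ≡⟨ 𝔼-present p loopless ⟨
        𝔼 p (λ ω → ⟦ present (cycleEdges vs) ω ⟧)  ∎

    -- The shorter tuple vs is counted given the longer cycle u, because `trace` controls closed
    -- walks of length at most that of u.
    module _ (i j : ℕ) (j≤i : j ℕ.≤ i) where

      private
        bound : ℚ
        bound = c ^ len j + ι (len i) * (2ℚ * ⟦ does (len j ℕ.≟ len i) ⟧)
          + p * (2ℚ * α Q (2 ℕ.+ (j ℕ.+ j)) * ι (len i) + Q * β Q (ι (len i)) (2 ℕ.+ (j ℕ.+ j)))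

        joint : (u : Vec (Fin n) (len i)) → Vec (Fin n) (len j) → ℚ
        joint u vs = 𝔼 p (λ ω → ⟦ isCycle vs ω ⟧ * ⟦ isCycle u ω ⟧)

        0≤bound : 0ℚ ≤ bound
        0≤bound = 0≤-+ (0≤-+ (0≤-^ (len j) 0≤c) (0≤-* (0≤ι (len i)) (0≤-* 0≤2 0≤⟦ does (len j ℕ.≟ len i) ⟧)))
          (0≤-* 0≤p (0≤-+ (0≤-* (0≤-* 0≤2 (0≤α 0≤Q (2 ℕ.+ (j ℕ.+ j)))) (0≤ι (len i))) (0≤-* 0≤Q (0≤β 0≤Q (0≤ι (len i)) (2 ℕ.+ (j ℕ.+ j))))))

        module _ (u : Vec (Fin n) (len i)) (u-distinct : distinct u ≡ true) where

          open Inside u (distinct⇒Unique u u-distinct) using (C; U; row; col; trace)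

          M : Fin n → Fin n → ℚ
          M x y = p + C x y

          0≤∏ : ∀ es → 0ℚ ≤ ∏ es M
          0≤∏ []             = 0≤1
          0≤∏ ((x , y) ∷ es) = 0≤-* (0≤-+ 0≤p (0≤link (cycleEdges u) x y)) (0≤∏ es)

          u-loopless : Loopless (cycleEdges u)
          u-loopless = proj₁ (cycle (distinct⇒Unique u u-distinct))

          -- `μ-mask-++` with an empty second list, all of whose links vanish.
          μ-u : μ p (mask (cycleEdges u)) ≤ p ^ len i
          μ-u = begin
            μ p (mask (cycleEdges u))         ≡⟨ cong (μ p ∘ mask) (++-identityʳ (cycleEdges u)) ⟨
            μ p (mask (cycleEdges u ++ []))   ≤⟨ μ-mask-++ 0≤p p≤1 u-loopless (proj₂ (cycle (distinct⇒Unique u u-distinct))) [] ⟩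
            ∏ (cycleEdges u) (λ x y → p + link [] x y) * μ p (mask {n} [])
              ≡⟨ cong₂ _*_ (∏-const p (cycleEdges u)) (μ-∅ n p) ⟩
            p ^ length (cycleEdges u) * 1ℚ    ≡⟨ *-identityʳ (p ^ length (cycleEdges u)) ⟩
            p ^ length (cycleEdges u)         ≡⟨ cong (p ^_) (length-cycleEdges u) ⟩
            p ^ len i                         ∎
            where open ≤-Reasoning

          joint≤ : ∀ vs → joint u vs ≤ ∏ (cycleEdges vs) M * p ^ len i
          joint≤ vs with distinct vs in eq
          ... | false = ≤-trans (≤-reflexive (trans
                  (𝔼-cong {n} p {g = λ ω → 0ℚ * ⟦ isCycle u ω ⟧} (λ ω → refl))
                  (trans (𝔼-* p 0ℚ (λ ω → ⟦ isCycle u ω ⟧)) (*-zeroˡ (𝔼 {n} p (λ ω → ⟦ isCycle u ω ⟧))))))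
                (0≤-* (0≤∏ (cycleEdges vs)) (0≤-^ (len i) 0≤p))
          ... | true with loopless , trail ← cycle (distinct⇒Unique vs eq) = begin
            𝔼 p (λ ω → ⟦ present (cycleEdges vs) ω ⟧ * ⟦ distinct u ∧ present (cycleEdges u) ω ⟧)
              ≡⟨ 𝔼-cong p (λ ω → trans (cong (λ b → ⟦ present (cycleEdges vs) ω ⟧ * ⟦ b ∧ present (cycleEdges u) ω ⟧) u-distinct)
                   (sym (present-++ (cycleEdges vs) (cycleEdges u) ω))) ⟩
            𝔼 p (λ ω → ⟦ present (cycleEdges vs ++ cycleEdges u) ω ⟧)
              ≡⟨ 𝔼-present p (Loopless-++ loopless u-loopless) ⟩
            μ p (mask (cycleEdges vs ++ cycleEdges u))
              ≤⟨ μ-mask-++ 0≤p p≤1 loopless trail u-loopless ⟩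
            ∏ (cycleEdges vs) M * μ p (mask (cycleEdges u))
              ≤⟨ *-monoʳ (0≤∏ (cycleEdges vs)) μ-u ⟩
            ∏ (cycleEdges vs) M * p ^ len i  ∎
            where open ≤-Reasoning

          -- The bound on `joint` makes sense for every tuple vs, so its sum is the full trace of a
          -- power of p J + C.
          ∑-joint : ∑ (tuples n (len j)) (joint u) ≤ p ^ len i * bound
          ∑-joint = begin
            ∑ (tuples n (len j)) (joint u)
              ≤⟨ ∑-mono (tuples n (len j)) joint≤ ⟩
            ∑ (tuples n (len j)) (λ vs → ∏ (cycleEdges vs) M * p ^ len i)
              ≡⟨ ∑-*ʳ (p ^ len i) (λ vs → ∏ (cycleEdges vs) M) (tuples n (len j)) ⟩
            ∑ (tuples n (len j)) (λ vs → ∏ (cycleEdges vs) M) * p ^ len i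
              ≡⟨ cong (_* p ^ len i) (trans (∑-tuples {n} {2 ℕ.+ (j ℕ.+ j)} (λ vs → ∏ (cycleEdges vs) M))
                   (∑-cong (allFin n) (λ x → ∑-edgesFrom M (2 ℕ.+ (j ℕ.+ j)) x x))) ⟩
            ∑ (allFin n) (λ x → walk M (len j) x x) * p ^ len i
              ≤⟨ *-monoˡ (0≤-^ (len i) 0≤p) (≤-trans
                   (Perturbation.trace-M p Q (ι (len i)) C U 0≤p c≤Q (0≤link (cycleEdges u)) (λ x → 0≤⟦ x ∈ᵇ u ⟧)
                      (λ x → ⟦ x ∈ᵇ u ⟧≤1) (∑-∈ᵇ u) row col (2 ℕ.+ (j ℕ.+ j)))
                   (+-monoˡ-≤ _ (+-monoʳ-≤ (c ^ len j) (trace (odd-len i) (2 ℕ.+ (j ℕ.+ j)) (len-mono j≤i) (odd-len j))))) ⟩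
            bound * p ^ len i
              ≡⟨ *-comm bound (p ^ len i) ⟩
            p ^ len i * bound  ∎
            where open ≤-Reasoning

        ∑-joint≤ : ∀ u → ∑ (tuples n (len j)) (joint u) ≤ p ^ len i * bound
        ∑-joint≤ u with distinct u in eq
        ... | true  = subst (λ b →
          ∑ (tuples n (len j)) (λ vs → 𝔼 p (λ ω → ⟦ isCycle vs ω ⟧ * ⟦ b ∧ present (cycleEdges u) ω ⟧)) ≤ p ^ len i * bound)
                        eq (∑-joint u eq)
        ... | false = ≤-trans (≤-reflexive (trans (∑-cong (tuples n (len j)) zero-joint) (∑-zero (tuples n (len j)))))
                        (0≤-* (0≤-^ (len i) 0≤p) 0≤bound)
          where
          zero-joint : ∀ (vs : Vec (Fin n) (len j)) → 𝔼 {n} p (λ ω → ⟦ isCycle vs ω ⟧ * 0ℚ) ≡ 0ℚ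
          zero-joint vs = trans (𝔼-cong {n} p {g = λ ω → 0ℚ * ⟦ isCycle vs ω ⟧} (λ ω → *-comm ⟦ isCycle vs ω ⟧ 0ℚ))
            (trans (𝔼-* p 0ℚ (λ ω → ⟦ isCycle vs ω ⟧)) (*-zeroˡ (𝔼 {n} p (λ ω → ⟦ isCycle vs ω ⟧))))

      -- The n^(len i) tuples u, each of weight at most p^(len i), give the factor `c ^ len i`.
      second-moment : 𝔼 {n} p (λ ω → X i ω * X j ω)
                      ≤ c ^ len i * c ^ len j + c ^ len i * (ι (len i) * (2ℚ * ⟦ does (len j ℕ.≟ len i) ⟧)) + p * σ Q i j
      second-moment = begin
        𝔼 {n} p (λ ω → X i ω * X j ω)
          ≡⟨ 𝔼-cong {n} p (λ ω → trans (∑-product (λ u → ⟦ isCycle u ω ⟧) (λ vs → ⟦ isCycle vs ω ⟧) (tuples n (len i)) (tuples n (len j)))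
               (∑-cong (tuples n (len i)) (λ u → ∑-cong (tuples n (len j)) (λ vs → *-comm ⟦ isCycle u ω ⟧ ⟦ isCycle vs ω ⟧)))) ⟩
        𝔼 {n} p (λ ω → ∑ (tuples n (len i)) (λ u → ∑ (tuples n (len j)) (λ vs → ⟦ isCycle vs ω ⟧ * ⟦ isCycle u ω ⟧)))
          ≡⟨ trans (𝔼-∑ p (λ u ω → ∑ (tuples n (len j)) (λ vs → ⟦ isCycle vs ω ⟧ * ⟦ isCycle u ω ⟧)) (tuples n (len i)))
               (∑-cong (tuples n (len i)) (λ u → 𝔼-∑ p (λ vs ω → ⟦ isCycle vs ω ⟧ * ⟦ isCycle u ω ⟧) (tuples n (len j)))) ⟩
        ∑ (tuples n (len i)) (λ u → ∑ (tuples n (len j)) (joint u))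
          ≤⟨ ∑-mono (tuples n (len i)) ∑-joint≤ ⟩
        ∑ (tuples n (len i)) (λ _ → p ^ len i * bound)
          ≡⟨ ∑-tuples-const n (len i) (p ^ len i * bound) ⟩
        ι n ^ len i * (p ^ len i * bound)
          ≡⟨ trans (sym (*-assoc (ι n ^ len i) (p ^ len i) bound)) (cong (_* bound) (sym (*-^ (ι n) p (len i)))) ⟩
        c ^ len i * bound
          ≡⟨ solve 5 (λ ci cj d p r → ci :* (cj :+ d :+ p :* r) := ci :* cj :+ ci :* d :+ p :* (ci :* r)) refl
               (c ^ len i) (c ^ len j) (ι (len i) * (2ℚ * ⟦ does (len j ℕ.≟ len i) ⟧)) p r ⟩
        c ^ len i * c ^ len j + c ^ len i * (ι (len i) * (2ℚ * ⟦ does (len j ℕ.≟ len i) ⟧)) + p * (c ^ len i * r)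
          ≤⟨ +-monoʳ-≤ (c ^ len i * c ^ len j + c ^ len i * (ι (len i) * (2ℚ * ⟦ does (len j ℕ.≟ len i) ⟧)))
               (*-monoʳ 0≤p (*-monoˡ 0≤r (^-monoˡ (len i) 0≤c c≤Q))) ⟩
        c ^ len i * c ^ len j + c ^ len i * (ι (len i) * (2ℚ * ⟦ does (len j ℕ.≟ len i) ⟧)) + p * σ Q i j  ∎
        where
        open ≤-Reasoning
        r : ℚ
        r = 2ℚ * α Q (2 ℕ.+ (j ℕ.+ j)) * ι (len i) + Q * β Q (ι (len i)) (2 ℕ.+ (j ℕ.+ j))
        0≤r : 0ℚ ≤ r
        0≤r = 0≤-+ (0≤-* (0≤-* 0≤2 (0≤α 0≤Q (2 ℕ.+ (j ℕ.+ j)))) (0≤ι (len i))) (0≤-* 0≤Q (0≤β 0≤Q (0≤ι (len i)) (2 ℕ.+ (j ℕ.+ j))))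

  -- The weighted count of odd cycles

  ι≡/1 : ∀ n → ι n ≡ ℤ.+ n / 1
  ι≡/1 zero    = refl
  ι≡/1 (suc n) = begin
    1ℚ + ι n                                 ≡⟨ cong (1ℚ +_) (ι≡/1 n) ⟩
    1ℚ + ℤ.+ n / 1                             ≡⟨ cong (1ℚ +_) (normalize-coprime c) ⟩
    1ℚ + mkℚ (ℤ.+ n) 0 c                       ≡⟨ cong (_/ 1) (cong (ℤ._+_ (ℤ.+ 1)) (ℤₚ.*-identityʳ (ℤ.+ n))) ⟩
    ℤ.+ suc n / 1                              ∎
    where
    open ≡-Reasoning
    c = Coprimality.sym (1-coprimeTo n)

  -- The numerator bounds the fraction, its denominator being at least 1.
  archimedean : ∀ q → ∃[ n ] q ≤ ι n
  archimedean (mkℚ (ℤ.+ a) d c)    = a , subst (mkℚ (ℤ.+ a) d c ≤_) (trans (sym (normalize-coprime c₁)) (sym (ι≡/1 a)))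
    (*≤* (ℤₚ.*-monoˡ-≤-nonNeg (ℤ.+ a) (ℤ.+≤+ (s≤s z≤n))))
    where c₁ = Coprimality.sym (1-coprimeTo a)
  archimedean (mkℚ -[1+ a ] d c) = 0 , nonPositive⁻¹ (mkℚ -[1+ a ] d c)

  ι-mono : ∀ {m n} → m ℕ.≤ n → ι m ≤ ι n
  ι-mono {n = n} z≤n = 0≤ι n
  ι-mono (s≤s m≤n)   = +-monoʳ-≤ 1ℚ (ι-mono m≤n)

  ι-+ : ∀ m n → ι (m ℕ.+ n) ≡ ι m + ι n
  ι-+ zero    n = sym (+-identityˡ (ι n))
  ι-+ (suc m) n = trans (cong (1ℚ +_) (ι-+ m n)) (sym (+-assoc 1ℚ (ι m) (ι n)))

  0<ι : ∀ n → 0ℚ < ι (suc n)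
  0<ι n = +-mono-<-≤ (positive⁻¹ 1ℚ) (0≤ι n)

  recip : ∀ q → 0ℚ < q → ℚ
  recip q 0<q = (1/ q) {{pos⇒nonZero q {{positive 0<q}}}}

  *-recip : ∀ q (0<q : 0ℚ < q) → q * recip q 0<q ≡ 1ℚ
  *-recip q 0<q = *-inverseʳ q {{pos⇒nonZero q {{positive 0<q}}}}

  0<recip : ∀ q (0<q : 0ℚ < q) → 0ℚ < recip q 0<q
  0<recip q 0<q = positive⁻¹ (recip q 0<q) {{1/pos⇒pos q {{positive 0<q}}}}

  0<-* : ∀ {p q} → 0ℚ < p → 0ℚ < q → 0ℚ < p * q
  0<-* {p} {q} 0<p 0<q = subst (_< p * q) (*-zeroʳ p) (*-monoʳ-<-pos p {{positive 0<p}} 0<q)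

  *-cancel : ∀ {r p q} → 0ℚ < r → r * p ≤ r * q → p ≤ q
  *-cancel {r} 0<r = *-cancelˡ-≤-pos r {{positive 0<r}}

  w : ℕ → ℚ
  w j = recip (ι (suc j)) (0<ι j)

  0≤w : ∀ j → 0ℚ ≤ w j
  0≤w j = <⇒≤ (0<recip (ι (suc j)) (0<ι j))

  ι*w : ∀ j → ι (suc j) * w j ≡ 1ℚ
  ι*w j = *-recip (ι (suc j)) (0<ι j)

  w-anti : ∀ {i j} → i ℕ.≤ j → w j ≤ w i
  w-anti {i} {j} i≤j = *-cancel (0<ι i) (begin
    ι (suc i) * w j   ≤⟨ *-monoˡ (0≤w j) (ι-mono (s≤s i≤j)) ⟩
    ι (suc j) * w j   ≡⟨ trans (ι*w j) (sym (ι*w i)) ⟩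
    ι (suc i) * w i   ∎)
    where open ≤-Reasoning

  -- Divergence of the harmonic series

  H : ℕ → ℚ
  H J = ∑ (downFrom J) w

  H-block : ∀ d J {D} → d ℕ.+ J ℕ.≤ suc D → H J + ι d * w D ≤ H (d ℕ.+ J)
  H-block zero    J {D} _  = ≤-reflexive (solve 2 (λ h w → h :+ con 0ℚ :* w := h) refl (H J) (w D))
  H-block (suc d) J {D} le = begin
    H J + (1ℚ + ι d) * w D         ≡⟨ solve 3 (λ h d w → h :+ (con 1ℚ :+ d) :* w := w :+ (h :+ d :* w)) refl (H J) (ι d) (w D) ⟩
    w D + (H J + ι d * w D)        ≤⟨ +-mono-≤ (w-anti (ℕₚ.≤-pred le)) (H-block d J (ℕₚ.≤-trans (ℕₚ.n≤1+n (d ℕ.+ J)) le)) ⟩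
    H (suc d ℕ.+ J)                ∎
    where open ≤-Reasoning

  -- The J + 1 new terms are all at least the last one, 1 / (2J + 2).
  H-double : ∀ J → H (suc J) + ½ ≤ H (suc J ℕ.+ suc J)
  H-double J = begin
    H (suc J) + ½                                     ≡⟨ cong (H (suc J) +_) half ⟨
    H (suc J) + ι (suc J) * w (J ℕ.+ suc J)           ≤⟨ H-block (suc J) (suc J) {J ℕ.+ suc J} ℕₚ.≤-refl ⟩
    H (suc J ℕ.+ suc J)                               ∎
    where
    open ≤-Reasoning
    half : ι (suc J) * w (J ℕ.+ suc J) ≡ ½
    half = begin-equality
      ι (suc J) * w (J ℕ.+ suc J)
        ≡⟨ solve 2 (λ a b → a :* b := con ½ :* ((a :+ a) :* b)) refl (ι (suc J)) (w (J ℕ.+ suc J)) ⟩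
      ½ * ((ι (suc J) + ι (suc J)) * w (J ℕ.+ suc J))
        ≡⟨ cong (λ z → ½ * (z * w (J ℕ.+ suc J))) (ι-+ (suc J) (suc J)) ⟨
      ½ * (ι (suc J ℕ.+ suc J) * w (J ℕ.+ suc J))
        ≡⟨ cong (½ *_) (ι*w (J ℕ.+ suc J)) ⟩
      ½ * 1ℚ
        ≡⟨ *-identityʳ ½ ⟩
      ½  ∎

  harmonic : ∀ m → ∃[ J ] ι m * ½ ≤ H (suc J)
  harmonic zero    = 0 , ≤-trans (≤-reflexive (*-zeroˡ ½)) (0≤-∑ (downFrom 1) 0≤w)
  harmonic (suc m) with J , le ← harmonic m = J ℕ.+ suc J , (begin
    (1ℚ + ι m) * ½       ≡⟨ solve 1 (λ m → (con 1ℚ :+ m) :* con ½ := m :* con ½ :+ con ½) refl (ι m) ⟩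
    ι m * ½ + ½          ≤⟨ +-monoˡ-≤ ½ le ⟩
    H (suc J) + ½        ≤⟨ H-double J ⟩
    H (suc J ℕ.+ suc J)  ∎)
    where open ≤-Reasoning

  H-unbounded : ∀ b → ∃[ J ] b ≤ H J
  H-unbounded b with m , 2b≤m ← archimedean (b + b) with J , le ← harmonic m = suc J , (begin
    b                ≡⟨ solve 1 (λ b → b := (b :+ b) :* con ½) refl b ⟩
    (b + b) * ½      ≤⟨ *-monoˡ (<⇒≤ (positive⁻¹ ½)) 2b≤m ⟩
    ι m * ½          ≤⟨ le ⟩
    H (suc J)        ∎)
    where open ≤-Reasoning

  ∑-downFrom-diag : ∀ J i → ∑ (downFrom J) (λ j → ⟦ does (j ℕ.≟ i) ⟧ * w j) ≤ w i
  ∑-downFrom-diag J i = ≤-trans (upto J) (*≤ (does (i ℕ.<? J)))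
    where
    open ≤-Reasoning
    *≤ : ∀ b → ⟦ b ⟧ * w i ≤ w i
    *≤ b = ≤-trans (*-monoˡ (0≤w i) ⟦ b ⟧≤1) (≤-reflexive (*-identityˡ (w i)))
    upto : ∀ J → ∑ (downFrom J) (λ j → ⟦ does (j ℕ.≟ i) ⟧ * w j) ≤ ⟦ does (i ℕ.<? J) ⟧ * w i
    upto zero    = ≤-reflexive (sym (*-zeroˡ (w i)))
    upto (suc J) with J ℕ.≟ i
    ... | yes refl = begin
      ⟦ does (J ℕ.≟ J) ⟧ * w J + ∑ (downFrom J) (λ j → ⟦ does (j ℕ.≟ J) ⟧ * w j)
        ≤⟨ +-mono-≤ (*≤ (does (J ℕ.≟ J))) (upto J) ⟩
      w J + ⟦ does (J ℕ.<? J) ⟧ * w J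
        ≡⟨ cong (λ b → w J + ⟦ b ⟧ * w J) (dec-false (J ℕ.<? J) (ℕₚ.<-irrefl refl)) ⟩
      w J + 0ℚ * w J
        ≡⟨ solve 1 (λ w → w :+ con 0ℚ :* w := con 1ℚ :* w) refl (w J) ⟩
      1ℚ * w J
        ≡⟨ cong (λ b → ⟦ b ⟧ * w J) (dec-true (J ℕ.<? suc J) ℕₚ.≤-refl) ⟨
      ⟦ does (J ℕ.<? suc J) ⟧ * w J  ∎
    ... | no J≢i = begin
      ⟦ does (J ℕ.≟ i) ⟧ * w J + ∑ (downFrom J) (λ j → ⟦ does (j ℕ.≟ i) ⟧ * w j)
        ≡⟨ cong (λ b → ⟦ b ⟧ * w J + ∑ (downFrom J) (λ j → ⟦ does (j ℕ.≟ i) ⟧ * w j)) (dec-false (J ℕ.≟ i) J≢i) ⟩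
      0ℚ * w J + ∑ (downFrom J) (λ j → ⟦ does (j ℕ.≟ i) ⟧ * w j)
        ≡⟨ trans (cong (_+ rest) (*-zeroˡ (w J))) (+-identityˡ rest) ⟩
      ∑ (downFrom J) (λ j → ⟦ does (j ℕ.≟ i) ⟧ * w j)
        ≤⟨ upto J ⟩
      ⟦ does (i ℕ.<? J) ⟧ * w i
        ≤⟨ *-monoˡ (0≤w i) grow ⟩
      ⟦ does (i ℕ.<? suc J) ⟧ * w i  ∎
      where
      rest : ℚ
      rest = ∑ (downFrom J) (λ j → ⟦ does (j ℕ.≟ i) ⟧ * w j)
      grow : ⟦ does (i ℕ.<? J) ⟧ ≤ ⟦ does (i ℕ.<? suc J) ⟧
      grow with i ℕ.≤? J
      ... | yes i≤J = ≤-trans ⟦ does (i ℕ.<? J) ⟧≤1 (≤-reflexive (cong ⟦_⟧ (sym (dec-true (i ℕ.<? suc J) (s≤s i≤J)))))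
      ... | no i≰J  = ≤-trans (≤-reflexive (cong ⟦_⟧ (dec-false (i ℕ.<? J) (i≰J ∘ ℕₚ.<⇒≤)))) 0≤⟦ does (i ℕ.<? suc J) ⟧

  -- The event of an odd cycle and the moments of Z

  ∑-any-false : ∀ {A : Set} (b : A → Bool) (f : A → ℚ) xs → (∀ x → b x ≡ false → f x ≡ 0ℚ) → any b xs ≡ false → ∑ xs f ≡ 0ℚ
  ∑-any-false b f []       h _  = refl
  ∑-any-false b f (x ∷ xs) h eq with b x in bx
  ... | false = trans (cong₂ _+_ (h x bx) (∑-any-false b f xs h eq)) (+-identityˡ 0ℚ)

  any-downFrom : ∀ (b : ℕ → Bool) {J n} → J ℕ.≤ n → any b (downFrom n) ≡ false → any b (downFrom J) ≡ false
  any-downFrom b {J} {n} J≤n eq with ℕₚ.≤⇒≤′ J≤n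
  ... | ℕ.≤′-refl = eq
  ... | ℕ.≤′-step {m} J≤m with b m
  ...   | false = any-downFrom b (ℕₚ.≤′⇒≤ J≤m) eq

  -- The search runs over the lengths `len j` with j < n, so it covers all lengths in `Z J` once J ≤
  -- n.
  hasOddCycle : ∀ {n} → EdgeBits n → Bool
  hasOddCycle {n} ω = any (λ j → any (λ vs → isCycle vs ω) (tuples n (len j))) (downFrom n)

  Z : ∀ {n} → ℕ → EdgeBits n → ℚ
  Z J ω = ∑ (downFrom J) (λ j → w j * X j ω)

  Z≡0 : ∀ {n J} → J ℕ.≤ n → ∀ (ω : EdgeBits n) → hasOddCycle ω ≡ false → Z J ω ≡ 0ℚ
  Z≡0 {n} {J} J≤n ω none = ∑-any-false hasCycle (λ j → w j * X j ω) (downFrom J) vanish (any-downFrom hasCycle J≤n none)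
    where
    hasCycle : ℕ → Bool
    hasCycle j = any (λ vs → isCycle vs ω) (tuples n (len j))
    vanish : ∀ j → hasCycle j ≡ false → w j * X j ω ≡ 0ℚ
    vanish j eq = trans
      (cong (w j *_) (∑-any-false (λ vs → isCycle vs ω) (λ vs → ⟦ isCycle vs ω ⟧) (tuples n (len j)) (λ vs → cong ⟦_⟧) eq))
      (*-zeroʳ (w j))

  -- The event that all edges of the empty set are present.
  𝔼-1 : ∀ n p → 𝔼 {n} p (λ _ → 1ℚ) ≡ 1ℚ
  𝔼-1 n p = trans (𝔼-cong {n} p (sym ∘ factor-∅)) (trans (𝔼-factor {n} p ∅) (μ-∅ n p))

  ρ̂ : ℚ → ℕ → ℚ
  ρ̂ Q J = ∑ (downFrom J) (λ j → w j * ρ Q (len j))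

  -- Symmetrised in i and j because `second-moment` needs its indices in order.
  σ̂ : ℚ → ℕ → ℚ
  σ̂ Q J = ∑ (downFrom J) (λ i → ∑ (downFrom J) (λ j → w i * w j * (σ Q i j + σ Q j i)))

  -- A bound for 2 (2j + 3) / (j + 1), attained at j = 0; see `2len*w≤6`.
  6ℚ : ℚ
  6ℚ = 2ℚ + 4ℚ

  module SecondMoment {n : ℕ} {p Q : ℚ} (0≤p : 0ℚ ≤ p) (p≤1 : p ≤ 1ℚ) (c≤Q : ι n * p ≤ Q) (J : ℕ) where

    open CycleCounts {n} 0≤p p≤1 c≤Q

    t : ℚ
    t = ∑ (downFrom J) (λ j → w j * c ^ len j)

    private
      D : ℕ → ℚ
      D i = c ^ len i * (ι (len i) * 2ℚ)

      ⟦len≟⟧ : ∀ i j → ⟦ does (len j ℕ.≟ len i) ⟧ ≡ ⟦ does (j ℕ.≟ i) ⟧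
      ⟦len≟⟧ i j with j ℕ.≟ i
      ... | yes refl = cong ⟦_⟧ (trans (dec-true (len j ℕ.≟ len j) refl) (sym (dec-true (j ℕ.≟ j) refl)))
      ... | no j≢i   = cong ⟦_⟧ (trans (dec-false (len j ℕ.≟ len i) (j≢i ∘ len-injective)) (sym (dec-false (j ℕ.≟ i) j≢i)))

      0≤D : ∀ i → 0ℚ ≤ D i
      0≤D i = 0≤-* (0≤-^ (len i) 0≤c) (0≤-* (0≤ι (len i)) 0≤2)

    second-moment′ : ∀ i j → 𝔼 {n} p (λ ω → X i ω * X j ω)
                     ≤ c ^ len i * c ^ len j + ⟦ does (j ℕ.≟ i) ⟧ * D i + p * (σ Q i j + σ Q j i)
    second-moment′ i j with ℕₚ.≤-total j i
    ... | inj₁ j≤i = begin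
      𝔼 {n} p (λ ω → X i ω * X j ω)
        ≤⟨ second-moment i j j≤i ⟩
      c ^ len i * c ^ len j + c ^ len i * (ι (len i) * (2ℚ * ⟦ does (len j ℕ.≟ len i) ⟧)) + p * σ Q i j
        ≡⟨ cong (λ z → c ^ len i * c ^ len j + z + p * σ Q i j) (trans
             (cong (λ b → c ^ len i * (ι (len i) * (2ℚ * b))) (⟦len≟⟧ i j))
             (solve 4 (λ a b c d → a :* (b :* (c :* d)) := d :* (a :* (b :* c))) refl (c ^ len i) (ι (len i)) 2ℚ ⟦ does (j ℕ.≟ i) ⟧)) ⟩
      c ^ len i * c ^ len j + ⟦ does (j ℕ.≟ i) ⟧ * D i + p * σ Q i j
        ≤⟨ +-monoʳ-≤ (c ^ len i * c ^ len j + ⟦ does (j ℕ.≟ i) ⟧ * D i) (*-monoʳ 0≤p (p≤p+q (0≤σ 0≤Q j i))) ⟩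
      c ^ len i * c ^ len j + ⟦ does (j ℕ.≟ i) ⟧ * D i + p * (σ Q i j + σ Q j i)  ∎
      where open ≤-Reasoning
    ... | inj₂ i≤j = begin
      𝔼 {n} p (λ ω → X i ω * X j ω)
        ≡⟨ 𝔼-cong {n} p (λ ω → *-comm (X i ω) (X j ω)) ⟩
      𝔼 {n} p (λ ω → X j ω * X i ω)
        ≤⟨ second-moment j i i≤j ⟩
      c ^ len j * c ^ len i + c ^ len j * (ι (len j) * (2ℚ * ⟦ does (len i ℕ.≟ len j) ⟧)) + p * σ Q j i
        ≤⟨ +-mono-≤ (+-mono-≤ (≤-reflexive (*-comm (c ^ len j) (c ^ len i))) diag) (*-monoʳ 0≤p (q≤p+q (0≤σ 0≤Q i j))) ⟩
      c ^ len i * c ^ len j + ⟦ does (j ℕ.≟ i) ⟧ * D i + p * (σ Q i j + σ Q j i)  ∎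
      where
      open ≤-Reasoning
      diag : c ^ len j * (ι (len j) * (2ℚ * ⟦ does (len i ℕ.≟ len j) ⟧)) ≤ ⟦ does (j ℕ.≟ i) ⟧ * D i
      diag with i ℕ.≟ j
      ... | yes refl = ≤-reflexive (trans (cong (λ b → c ^ len j * (ι (len j) * (2ℚ * b))) (⟦len≟⟧ j j))
        (solve 4 (λ a b c d → a :* (b :* (c :* d)) := d :* (a :* (b :* c))) refl (c ^ len j) (ι (len j)) 2ℚ ⟦ does (j ℕ.≟ j) ⟧))
      ... | no i≢j   = ≤-trans (≤-reflexive (trans
        (cong (λ b → c ^ len j * (ι (len j) * (2ℚ * ⟦ b ⟧))) (dec-false (len i ℕ.≟ len j) (i≢j ∘ len-injective)))
        (solve 3 (λ a b c → a :* (b :* (c :* con 0ℚ)) := con 0ℚ) refl (c ^ len j) (ι (len j)) 2ℚ)))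
        (0≤-* 0≤⟦ does (j ℕ.≟ i) ⟧ (0≤D i))

    2len*w≤6 : ∀ i → ι (len i) * 2ℚ * w i ≤ 6ℚ
    2len*w≤6 i = begin
      ι (len i) * 2ℚ * w i
        ≤⟨ *-monoˡ (0≤w i) (*-monoˡ 0≤2 len≤) ⟩
      (1ℚ + 2ℚ) * ι (suc i) * 2ℚ * w i
        ≡⟨ solve 2 (λ s w → (con 1ℚ :+ con 2ℚ) :* s :* con 2ℚ :* w := con 6ℚ :* (s :* w)) refl (ι (suc i)) (w i) ⟩
      6ℚ * (ι (suc i) * w i)
        ≡⟨ trans (cong (6ℚ *_) (ι*w i)) (*-identityʳ 6ℚ) ⟩
      6ℚ  ∎
      where
      open ≤-Reasoning
      len≤ : ι (len i) ≤ (1ℚ + 2ℚ) * ι (suc i)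
      len≤ = begin
        ι (len i)                ≡⟨ trans (ι-+ 3 (i ℕ.+ i)) (cong (ι 3 +_) (ι-+ i i)) ⟩
        ι 3 + (ι i + ι i)        ≤⟨ p≤p+q (0≤ι i) ⟩
        ι 3 + (ι i + ι i) + ι i  ≡⟨ solve 1 (λ i → con (ι 3) :+ (i :+ i) :+ i := (con 1ℚ :+ con 2ℚ) :* (con 1ℚ :+ i)) refl (ι i) ⟩
        (1ℚ + 2ℚ) * ι (suc i)    ∎

    𝔼-Z : t - p * ρ̂ Q J ≤ 𝔼 {n} p (Z J)
    𝔼-Z = begin
      t - p * ρ̂ Q J
        ≡⟨ solve 3 (λ t p r → t :- p :* r := t :+ (:- p) :* r) refl t p (ρ̂ Q J) ⟩
      t + (- p) * ρ̂ Q J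
        ≡⟨ cong (_+_ t) (∑-*ˡ (- p) (λ j → w j * ρ Q (len j)) (downFrom J)) ⟨
      t + ∑ (downFrom J) (λ j → (- p) * (w j * ρ Q (len j)))
        ≡⟨ ∑-+ (λ j → w j * c ^ len j) (λ j → (- p) * (w j * ρ Q (len j))) (downFrom J) ⟨
      ∑ (downFrom J) (λ j → w j * c ^ len j + (- p) * (w j * ρ Q (len j)))
        ≡⟨ ∑-cong (downFrom J) (λ j → solve 4 (λ w c p r → w :* c :+ (:- p) :* (w :* r) := w :* (c :- p :* r)) refl
                                         (w j) (c ^ len j) p (ρ Q (len j))) ⟩
      ∑ (downFrom J) (λ j → w j * (c ^ len j - p * ρ Q (len j)))
        ≤⟨ ∑-mono (downFrom J) (λ j → *-monoʳ (0≤w j) (first-moment j)) ⟩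
      ∑ (downFrom J) (λ j → w j * 𝔼 {n} p (X j))
        ≡⟨ ∑-cong (downFrom J) (λ j → 𝔼-* {n} p (w j) (X j)) ⟨
      ∑ (downFrom J) (λ j → 𝔼 {n} p (λ ω → w j * X j ω))
        ≡⟨ 𝔼-∑ {n} p (λ j ω → w j * X j ω) (downFrom J) ⟨
      𝔼 {n} p (Z J)  ∎
      where open ≤-Reasoning

    -- The products of means add up to t * t. The diagonal contributes the sum of w² * 2 len *
    -- c^len, where one factor w cancels the length and leaves at most 6t.
    𝔼-Z² : 𝔼 {n} p (λ ω → Z J ω * Z J ω) ≤ t * t + 6ℚ * t + p * σ̂ Q J
    𝔼-Z² = begin
      𝔼 {n} p (λ ω → Z J ω * Z J ω)
        ≡⟨ 𝔼-cong {n} p (λ ω → trans (∑-product (λ i → w i * X i ω) (λ j → w j * X j ω) js js)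
             (∑-cong js (λ i → ∑-cong js (λ j →
               solve 4 (λ a b c d → a :* b :* (c :* d) := a :* c :* (b :* d)) refl (w i) (X i ω) (w j) (X j ω))))) ⟩
      𝔼 {n} p (λ ω → ∑ js (λ i → ∑ js (λ j → w i * w j * (X i ω * X j ω))))
        ≡⟨ trans (𝔼-∑ {n} p (λ i ω → ∑ js (λ j → w i * w j * (X i ω * X j ω))) js)
             (∑-cong js (λ i → trans (𝔼-∑ {n} p (λ j ω → w i * w j * (X i ω * X j ω)) js)
               (∑-cong js (λ j → 𝔼-* {n} p (w i * w j) (λ ω → X i ω * X j ω))))) ⟩
      ∑ js (λ i → ∑ js (λ j → w i * w j * 𝔼 {n} p (λ ω → X i ω * X j ω)))
        ≤⟨ ∑-mono js (λ i → ∑-mono js (λ j → *-monoʳ (0≤-* (0≤w i) (0≤w j)) (second-moment′ i j))) ⟩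
      ∑ js (λ i → ∑ js (λ j → w i * w j * (c ^ len i * c ^ len j + ⟦ does (j ℕ.≟ i) ⟧ * D i + p * s i j)))
        ≡⟨ ∑-cong js (λ i → ∑-cong js (λ j → solve 8 (λ wi wj ci cj b d p s →
              wi :* wj :* (ci :* cj :+ b :* d :+ p :* s) := wi :* ci :* (wj :* cj) :+ (wi :* d :* (b :* wj) :+ p :* (wi :* wj :* s)))
              refl (w i) (w j) (c ^ len i) (c ^ len j) ⟦ does (j ℕ.≟ i) ⟧ (D i) p (s i j))) ⟩
      ∑ js (λ i → ∑ js (λ j → f i * f j + (w i * D i * (⟦ does (j ℕ.≟ i) ⟧ * w j) + p * (w i * w j * s i j))))
        ≡⟨ ∑-cong js (λ i → trans (∑-+ (λ j → f i * f j) (λ j → w i * D i * (⟦ does (j ℕ.≟ i) ⟧ * w j) + p * (w i * w j * s i j)) js)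
             (cong₂ _+_ (∑-*ˡ (f i) f js) (trans
               (∑-+ (λ j → w i * D i * (⟦ does (j ℕ.≟ i) ⟧ * w j)) (λ j → p * (w i * w j * s i j)) js)
               (cong₂ _+_ (∑-*ˡ (w i * D i) (λ j → ⟦ does (j ℕ.≟ i) ⟧ * w j) js) (∑-*ˡ p (λ j → w i * w j * s i j) js))))) ⟩
      ∑ js (λ i → f i * t + (w i * D i * ∑ js (λ j → ⟦ does (j ℕ.≟ i) ⟧ * w j) + p * ∑ js (λ j → w i * w j * s i j)))
        ≤⟨ ∑-mono js (λ i → +-monoʳ-≤ (f i * t) (+-monoˡ-≤ (p * ∑ js (λ j → w i * w j * s i j)) (diag i))) ⟩
      ∑ js (λ i → f i * t + (6ℚ * f i + p * ∑ js (λ j → w i * w j * s i j)))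
        ≡⟨ trans (∑-+ (λ i → f i * t) (λ i → 6ℚ * f i + p * ∑ js (λ j → w i * w j * s i j)) js)
             (cong₂ _+_ (∑-*ʳ t f js) (trans (∑-+ (λ i → 6ℚ * f i) (λ i → p * ∑ js (λ j → w i * w j * s i j)) js)
               (cong₂ _+_ (∑-*ˡ 6ℚ f js) (∑-*ˡ p (λ i → ∑ js (λ j → w i * w j * s i j)) js)))) ⟩
      t * t + (6ℚ * t + p * σ̂ Q J)
        ≡⟨ +-assoc (t * t) (6ℚ * t) (p * σ̂ Q J) ⟨
      t * t + 6ℚ * t + p * σ̂ Q J  ∎
      where
      open ≤-Reasoning
      js : List ℕ
      js = downFrom J
      f : ℕ → ℚ
      f j = w j * c ^ len j
      s : ℕ → ℕ → ℚ
      s i j = σ Q i j + σ Q j i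
      diag : ∀ i → w i * D i * ∑ js (λ j → ⟦ does (j ℕ.≟ i) ⟧ * w j) ≤ 6ℚ * f i
      diag i = begin
        w i * D i * ∑ js (λ j → ⟦ does (j ℕ.≟ i) ⟧ * w j)
          ≤⟨ *-monoʳ (0≤-* (0≤w i) (0≤D i)) (∑-downFrom-diag J i) ⟩
        w i * D i * w i
          ≡⟨ solve 4 (λ w c k two → w :* (c :* (k :* two)) :* w := k :* two :* w :* (w :* c)) refl (w i) (c ^ len i) (ι (len i)) 2ℚ ⟩
        ι (len i) * 2ℚ * w i * f i
          ≤⟨ *-monoˡ (0≤-* (0≤w i) (0≤-^ (len i) 0≤c)) (2len*w≤6 i) ⟩
        6ℚ * f i  ∎

    0≤t : 0ℚ ≤ t
    0≤t = 0≤-∑ (downFrom J) (λ j → 0≤-* (0≤w j) (0≤-^ (len j) 0≤c))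

    -- Chebyshev's inequality: t² 1[Z = 0] ≤ (Z - t)².
    chebyshev : J ℕ.≤ n → t * t * 𝔼 {n} p (λ ω → ⟦ not (hasOddCycle ω) ⟧) ≤ 6ℚ * t + p * (σ̂ Q J + 2ℚ * t * ρ̂ Q J)
    chebyshev J≤n = begin
      t * t * 𝔼 {n} p (λ ω → ⟦ not (hasOddCycle ω) ⟧)
        ≡⟨ 𝔼-* {n} p (t * t) (λ ω → ⟦ not (hasOddCycle ω) ⟧) ⟨
      𝔼 {n} p (λ ω → t * t * ⟦ not (hasOddCycle ω) ⟧)
        ≤⟨ 𝔼-mono 0≤p p≤1 {n} pointwise ⟩
      𝔼 {n} p (λ ω → Z J ω * Z J ω + ((- (2ℚ * t)) * Z J ω + t * t * 1ℚ))
        ≡⟨ trans (𝔼-+ {n} p (λ ω → Z J ω * Z J ω) (λ ω → (- (2ℚ * t)) * Z J ω + t * t * 1ℚ))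
             (cong (𝔼 {n} p (λ ω → Z J ω * Z J ω) +_) (trans (𝔼-+ {n} p (λ ω → (- (2ℚ * t)) * Z J ω) (λ _ → t * t * 1ℚ))
               (cong₂ _+_ (𝔼-* {n} p (- (2ℚ * t)) (Z J)) (trans (𝔼-* {n} p (t * t) (λ _ → 1ℚ)) (cong (t * t *_) (𝔼-1 n p)))))) ⟩
      𝔼 {n} p (λ ω → Z J ω * Z J ω) + ((- (2ℚ * t)) * 𝔼 {n} p (Z J) + t * t * 1ℚ)
        ≡⟨ solve 3 (λ a t z → a :+ ((:- (con 2ℚ :* t)) :* z :+ t :* t :* con 1ℚ) := a :+ (t :* t :- con 2ℚ :* t :* z)) refl
             (𝔼 {n} p (λ ω → Z J ω * Z J ω)) t (𝔼 {n} p (Z J)) ⟩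
      𝔼 {n} p (λ ω → Z J ω * Z J ω) + (t * t - 2ℚ * t * 𝔼 {n} p (Z J))
        ≤⟨ +-mono-≤ 𝔼-Z² (+-monoʳ-≤ (t * t) (neg-antimono-≤ (*-monoʳ (0≤-* 0≤2 0≤t) 𝔼-Z))) ⟩
      t * t + 6ℚ * t + p * σ̂ Q J + (t * t - 2ℚ * t * (t - p * ρ̂ Q J))
        ≡⟨ solve 4 (λ t p s r → t :* t :+ con 6ℚ :* t :+ p :* s :+ (t :* t :- con 2ℚ :* t :* (t :- p :* r))
                     := con 6ℚ :* t :+ p :* (s :+ con 2ℚ :* t :* r)) refl t p (σ̂ Q J) (ρ̂ Q J) ⟩
      6ℚ * t + p * (σ̂ Q J + 2ℚ * t * ρ̂ Q J)  ∎
      where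
      open ≤-Reasoning
      pointwise : ∀ ω → t * t * ⟦ not (hasOddCycle ω) ⟧ ≤ Z J ω * Z J ω + ((- (2ℚ * t)) * Z J ω + t * t * 1ℚ)
      pointwise ω with hasOddCycle ω in eq
      ... | true  = begin
        t * t * 0ℚ                 ≡⟨ *-zeroʳ (t * t) ⟩
        0ℚ                         ≤⟨ 0≤p*p (Z J ω - t) ⟩
        (Z J ω - t) * (Z J ω - t)
          ≡⟨ solve 2 (λ z t → (z :- t) :* (z :- t) := z :* z :+ ((:- (con 2ℚ :* t)) :* z :+ t :* t :* con 1ℚ)) refl (Z J ω) t ⟩
        Z J ω * Z J ω + ((- (2ℚ * t)) * Z J ω + t * t * 1ℚ)  ∎
      ... | false = ≤-reflexive (trans
        (solve 1 (λ t → t :* t :* con 1ℚ := con 0ℚ :* con 0ℚ :+ ((:- (con 2ℚ :* t)) :* con 0ℚ :+ t :* t :* con 1ℚ)) refl t)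
        (cong (λ z → z * z + ((- (2ℚ * t)) * z + t * t * 1ℚ)) (sym (Z≡0 J≤n ω eq))))

  -- Odd cycles with high probability

  ∑-mono-downFrom : ∀ {f g : ℕ → ℚ} J → (∀ j → j ℕ.< J → f j ≤ g j) → ∑ (downFrom J) f ≤ ∑ (downFrom J) g
  ∑-mono-downFrom zero    h = ≤-refl
  ∑-mono-downFrom (suc J) h = +-mono-≤ (h J ℕₚ.≤-refl) (∑-mono-downFrom J (λ j j<J → h j (ℕₚ.m<n⇒m<1+n j<J)))

  bernoulli : ∀ {η} → 0ℚ ≤ η → η ≤ 1ℚ → ∀ k → 1ℚ - ι k * η ≤ (1ℚ - η) ^ k
  bernoulli {η} 0≤η η≤1 zero    = ≤-reflexive (solve 1 (λ η → con 1ℚ :- con 0ℚ :* η := con 1ℚ) refl η)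
  bernoulli {η} 0≤η η≤1 (suc k) = begin
    1ℚ - (1ℚ + ι k) * η                      ≤⟨ p≤p+q (0≤-* (0≤ι k) (0≤p*p η)) ⟩
    1ℚ - (1ℚ + ι k) * η + ι k * (η * η)
      ≡⟨ solve 2 (λ k η → con 1ℚ :- (con 1ℚ :+ k) :* η :+ k :* (η :* η) := (con 1ℚ :- η) :* (con 1ℚ :- k :* η)) refl (ι k) η ⟩
    (1ℚ - η) * (1ℚ - ι k * η)                ≤⟨ *-monoʳ (0≤q-p η≤1) (bernoulli 0≤η η≤1 k) ⟩
    (1ℚ - η) ^ suc k                         ∎
    where open ≤-Reasoning

  -- Six for the variance and one for the remainder, which is at most 1 ≤ t.
  7ℚ : ℚ
  7ℚ = 6ℚ + 1ℚ

  0≤½ : 0ℚ ≤ ½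
  0≤½ = <⇒≤ (positive⁻¹ ½)

  -- The coefficient of p in `chebyshev`, with t replaced by its bound at c = Q, so that it can be
  -- fixed before n.
  error : ℚ → ℕ → ℚ
  error Q J = σ̂ Q J + 2ℚ * ∑ (downFrom J) (λ j → w j * Q ^ len j) * ρ̂ Q J

  -- In `HJ-large` the factor 2 pays for the powers of c being only at least 1/2, and the summand 1
  -- ensures t ≥ 1. `N₁-large` makes p times the error at most 1. As parameters, J and N₁ stay
  -- variables that never unfold.
  module Choice (Q ε : ℚ) (0<ε : 0ℚ < ε)
           (J : ℕ) (HJ-large : 2ℚ * (7ℚ * recip ε 0<ε + 1ℚ) ≤ H J)
           (N₁ : ℕ) (N₁-large : Q * error Q J ≤ ι N₁)
           where

    R : ℚ
    R = error Q J

    -- J for `chebyshev` and N₁ for `pR≤1`; the successor makes n positive, so that a factor n can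
    -- be cancelled.
    N : ℕ
    N = J ℕ.⊔ suc N₁

    -- This is 1 / (2 len J): by Bernoulli, powers of 1 - η up to the exponent `len J` stay at least
    -- 1/2.
    η : ℚ
    η = ½ * recip (ι (len J)) (0<ι (2 ℕ.+ (J ℕ.+ J)))

    ι*η : ι (len J) * η ≡ ½
    ι*η = trans (solve 2 (λ k r → k :* (con ½ :* r) := con ½ :* (k :* r)) refl (ι (len J)) (recip (ι (len J)) (0<ι (2 ℕ.+ (J ℕ.+ J)))))
      (trans (cong (½ *_) (*-recip (ι (len J)) (0<ι (2 ℕ.+ (J ℕ.+ J))))) (*-identityʳ ½))

    0<η : 0ℚ < η
    0<η = 0<-* (positive⁻¹ ½) (0<recip (ι (len J)) (0<ι (2 ℕ.+ (J ℕ.+ J))))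

    η≤1 : η ≤ 1ℚ
    η≤1 = begin
      η                     ≡⟨ *-identityˡ η ⟨
      1ℚ * η                ≤⟨ *-monoˡ (<⇒≤ 0<η) (p≤p+q {1ℚ} (0≤ι (2 ℕ.+ (J ℕ.+ J)))) ⟩
      ι (len J) * η         ≡⟨ ι*η ⟩
      ½                     ≤⟨ p≤p+q 0≤½ ⟩
      1ℚ                    ∎
      where open ≤-Reasoning

    module _ {n : ℕ} (N≤n : N ℕ.≤ n) {p : ℚ} (0≤p : 0ℚ ≤ p) (p≤1 : p ≤ 1ℚ)
             (1-η≤c : 1ℚ - η ≤ ι n * p) (c≤Q : ι n * p ≤ Q) where

      open CycleCounts {n} 0≤p p≤1 c≤Q using (c; 0≤c; 0≤Q)
      open SecondMoment {n} 0≤p p≤1 c≤Q J using (t; 0≤t; chebyshev)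

      ½≤c^ : ∀ k → k ℕ.≤ len J → ½ ≤ c ^ k
      ½≤c^ k k≤ = begin
        1ℚ - ½                ≡⟨ cong (_-_ 1ℚ) ι*η ⟨
        1ℚ - ι (len J) * η    ≤⟨ +-monoʳ-≤ 1ℚ (neg-antimono-≤ (*-monoˡ (<⇒≤ 0<η) (ι-mono k≤))) ⟩
        1ℚ - ι k * η          ≤⟨ bernoulli (<⇒≤ 0<η) η≤1 k ⟩
        (1ℚ - η) ^ k          ≤⟨ ^-monoˡ k (0≤q-p η≤1) 1-η≤c ⟩
        c ^ k                 ∎
        where open ≤-Reasoning

      t-large : 7ℚ * recip ε 0<ε + 1ℚ ≤ t
      t-large = begin
        7ℚ * recip ε 0<ε + 1ℚ
          ≡⟨ solve 1 (λ a → a := (con 2ℚ :* a) :* con ½) refl (7ℚ * recip ε 0<ε + 1ℚ) ⟩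
        2ℚ * (7ℚ * recip ε 0<ε + 1ℚ) * ½           ≤⟨ *-monoˡ 0≤½ HJ-large ⟩
        H J * ½                                    ≡⟨ ∑-*ʳ ½ w (downFrom J) ⟨
        ∑ (downFrom J) (λ j → w j * ½)
          ≤⟨ ∑-mono-downFrom J (λ j j<J → *-monoʳ (0≤w j) (½≤c^ (len j) (len-mono (ℕₚ.<⇒≤ j<J)))) ⟩
        t                                          ∎
        where open ≤-Reasoning

      0≤7/ε : 0ℚ ≤ 7ℚ * recip ε 0<ε
      0≤7/ε = 0≤-* (0≤-+ (0≤-+ 0≤2 0≤4) 0≤1) (<⇒≤ (0<recip ε 0<ε))

      1≤t : 1ℚ ≤ t
      1≤t = ≤-trans (q≤p+q 0≤7/ε) t-large

      7≤εt : 7ℚ ≤ ε * t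
      7≤εt = begin
        7ℚ                                  ≡⟨ *-identityʳ 7ℚ ⟨
        7ℚ * 1ℚ                             ≡⟨ cong (7ℚ *_) (*-recip ε 0<ε) ⟨
        7ℚ * (ε * recip ε 0<ε)              ≤⟨ p≤p+q (<⇒≤ 0<ε) ⟩
        7ℚ * (ε * recip ε 0<ε) + ε
          ≡⟨ solve 3 (λ a e r → a :* (e :* r) :+ e := e :* (a :* r :+ con 1ℚ)) refl 7ℚ ε (recip ε 0<ε) ⟩
        ε * (7ℚ * recip ε 0<ε + 1ℚ)         ≤⟨ *-monoʳ (<⇒≤ 0<ε) t-large ⟩
        ε * t                               ∎
        where open ≤-Reasoning

      0≤ρ̂ : 0ℚ ≤ ρ̂ Q J
      0≤ρ̂ = 0≤-∑ (downFrom J) (λ j → 0≤-* (0≤w j) (0≤ρ 0≤Q (len j)))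

      0≤R : 0ℚ ≤ R
      0≤R = 0≤-+ (0≤-∑ (downFrom J) (λ i → 0≤-∑ (downFrom J) (λ j →
                   0≤-* (0≤-* (0≤w i) (0≤w j)) (0≤-+ (0≤σ 0≤Q i j) (0≤σ 0≤Q j i)))))
        (0≤-* (0≤-* 0≤2 (0≤-∑ (downFrom J) (λ j → 0≤-* (0≤w j) (0≤-^ (len j) 0≤Q)))) 0≤ρ̂)

      pR≤1 : p * R ≤ 1ℚ
      pR≤1 = *-cancel (<-≤-trans (0<ι 0) (ι-mono (ℕₚ.≤-trans (s≤s z≤n) (ℕₚ.≤-trans (ℕₚ.m≤n⊔m J (suc N₁)) N≤n)))) (begin
        ι n * (p * R)                              ≡⟨ *-assoc (ι n) p R ⟨
        c * R                                      ≤⟨ *-monoˡ 0≤R c≤Q ⟩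
        Q * R                                      ≤⟨ N₁-large ⟩
        ι N₁                                       ≤⟨ ι-mono (ℕₚ.≤-trans (ℕₚ.n≤1+n N₁) (ℕₚ.≤-trans (ℕₚ.m≤n⊔m J (suc N₁)) N≤n)) ⟩
        ι n                                        ≡⟨ *-identityʳ (ι n) ⟨
        ι n * 1ℚ                                   ∎)
        where open ≤-Reasoning

      rare : 𝔼 {n} p (λ ω → ⟦ not (hasOddCycle ω) ⟧) ≤ ε
      rare = *-cancel (0<-* 0<t 0<t) (begin
        t * t * 𝔼 {n} p (λ ω → ⟦ not (hasOddCycle ω) ⟧)
          ≤⟨ chebyshev (ℕₚ.≤-trans (ℕₚ.m≤m⊔n J (suc N₁)) N≤n) ⟩
        6ℚ * t + p * (σ̂ Q J + 2ℚ * t * ρ̂ Q J)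
          ≤⟨ +-monoʳ-≤ (6ℚ * t) (*-monoʳ 0≤p (+-monoʳ-≤ (σ̂ Q J) (*-monoˡ 0≤ρ̂ (*-monoʳ 0≤2 t≤)))) ⟩
        6ℚ * t + p * R       ≤⟨ +-monoʳ-≤ (6ℚ * t) (≤-trans pR≤1 1≤t) ⟩
        6ℚ * t + t           ≡⟨ solve 1 (λ t → con 6ℚ :* t :+ t := con 7ℚ :* t) refl t ⟩
        7ℚ * t               ≤⟨ *-monoˡ 0≤t 7≤εt ⟩
        ε * t * t            ≡⟨ solve 2 (λ e t → e :* t :* t := t :* t :* e) refl ε t ⟩
        t * t * ε            ∎)
        where
        open ≤-Reasoning
        0<t : 0ℚ < t
        0<t = <-≤-trans (positive⁻¹ 1ℚ) 1≤t
        t≤ : t ≤ ∑ (downFrom J) (λ j → w j * Q ^ len j)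
        t≤ = ∑-mono (downFrom J) (λ j → *-monoʳ (0≤w j) (^-monoˡ (len j) 0≤c c≤Q))

  -- N and η depend on Q and ε alone. Uniformity in p lets the bound be applied to every late term
  -- of a sequence converging to c / n.
  no-odd-cycle-rare : ∀ Q ε → 0ℚ < ε →
    ∃[ N ] ∃[ η ] 0ℚ < η × (∀ n → N ℕ.≤ n → ∀ p → 0ℚ ≤ p → p ≤ 1ℚ → 1ℚ - η ≤ ι n * p → ι n * p ≤ Q →
      𝔼 {n} p (λ ω → ⟦ not (hasOddCycle ω) ⟧) ≤ ε)
  no-odd-cycle-rare Q ε 0<ε = pack (H-unbounded (2ℚ * (7ℚ * recip ε 0<ε + 1ℚ)))
    where
    pack : ∃[ J ] 2ℚ * (7ℚ * recip ε 0<ε + 1ℚ) ≤ H J →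
      ∃[ N ] ∃[ η ] 0ℚ < η × (∀ n → N ℕ.≤ n → ∀ p → 0ℚ ≤ p → p ≤ 1ℚ → 1ℚ - η ≤ ι n * p → ι n * p ≤ Q →
        𝔼 {n} p (λ ω → ⟦ not (hasOddCycle ω) ⟧) ≤ ε)
    pack (J , HJ-large) = N , η , 0<η , λ n N≤n p 0≤p p≤1 1-η≤c c≤Q → rare {n} N≤n {p} 0≤p p≤1 1-η≤c c≤Q
      where open Choice Q ε 0<ε J HJ-large (proj₁ (archimedean (Q * error Q J))) (proj₂ (archimedean (Q * error Q J)))

-- Winding numbers of 3-colourings

module Winding where

  open OddCycles using (Edges; odd; odd-+-double; edgesFrom; cycleEdges)
  open import Data.Integer using (+_; 0ℤ; 1ℤ; -1ℤ; _+_; _-_; _*_; -_; ∣_∣)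
  open import Data.Integer.Properties using (neg-distrib-+; abs-*)
  open import Data.Integer.Solver using (module +-*-Solver)
  open +-*-Solver using (solve; _:=_; _:+_; _:*_; _:-_; :-_; con)

  -- The signed step around the triangle, positive along 0, 1, 2, 0. Summed over a properly coloured
  -- closed walk it gives three times the winding number.
  turn : Fin 3 → Fin 3 → ℤ
  turn 0F 0F = 0ℤ
  turn 0F 1F = 1ℤ
  turn 0F 2F = -1ℤ
  turn 1F 0F = -1ℤ
  turn 1F 1F = 0ℤ
  turn 1F 2F = 1ℤ
  turn 2F 0F = 1ℤ
  turn 2F 1F = -1ℤ
  turn 2F 2F = 0ℤ

  -- Lift of a recolouring a ↦ b to the universal cover of the triangle: it moves
  -- over a common neighbour of a and b, hence by -2 turn a b rather than turn a b.
  drift : Fin 3 → Fin 3 → ℤ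
  drift a b = - (turn a b + turn a b)

  -- In three colours the disjoint sets {a, b} and {c, d} cannot both have two elements, so one end
  -- of the edge keeps its colour and the other moves over it. This is checked by enumeration.
  turn-drift : ∀ a b c d → a ≢ c → a ≢ d → b ≢ c → b ≢ d → turn b d ≡ turn a c + (drift c d - drift a b)
  turn-drift = from-yes (all? λ a → all? λ b → all? λ c → all? λ d →
    ¬? (a ≟ c) →-dec ¬? (a ≟ d) →-dec ¬? (b ≟ c) →-dec ¬? (b ≟ d) →-dec
    (turn b d ℤₚ.≟ turn a c + (drift c d - drift a b)))

  -- A reflection of the triangle; it reverses the orientation.
  swap₁₂ : Fin 3 → Fin 3
  swap₁₂ 0F = 0F
  swap₁₂ 1F = 2F
  swap₁₂ 2F = 1F

  swap₁₂-injective : ∀ a b → swap₁₂ a ≡ swap₁₂ b → a ≡ b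
  swap₁₂-injective = from-yes (all? λ a → all? λ b → (swap₁₂ a ≟ swap₁₂ b) →-dec (a ≟ b))

  turn-swap : ∀ a b → turn (swap₁₂ a) (swap₁₂ b) ≡ - turn a b
  turn-swap = from-yes (all? λ a → all? λ b → turn (swap₁₂ a) (swap₁₂ b) ℤₚ.≟ - turn a b)

  turn-odd : ∀ a b → a ≢ b → ∃[ z ] turn a b ≡ 1ℤ + (z + z)
  -- The second component says that the square is 1, which leaves the patterns 1 and -1.
  turn-odd a b a≢b with turn a b in eq | from-yes (all? λ a → all? λ b → ¬? (a ≟ b) →-dec (turn a b * turn a b ℤₚ.≟ 1ℤ)) a b a≢b
  ... | + 1         | _ = 0ℤ , refl
  ... | -[1+ 0 ]    | _ = -1ℤ , refl

  module _ {n : ℕ} where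

    winding : (Fin n → Fin 3) → Edges {n} → ℤ
    winding g []             = 0ℤ
    winding g ((x , y) ∷ es) = turn (g x) (g y) + winding g es

    -- g and h lie in a common cell of Hom(G,K₃), for a graph G with edges es.
    Compatible : (g h : Fin n → Fin 3) → Edges {n} → Set
    Compatible g h es = ∀ {x y} → (x , y) ∈ es → g x ≢ g y × g x ≢ h y × h x ≢ g y × h x ≢ h y

    -- The drifts telescope; only those at the two ends remain, and they cancel for a closed walk.
    winding-edgesFrom : ∀ {k} (g h : Fin n → Fin 3) x (vs : Vec (Fin n) k) y → Compatible g h (edgesFrom x vs y) →
      winding h (edgesFrom x vs y) ≡ winding g (edgesFrom x vs y) + (drift (g y) (h y) - drift (g x) (h x))
    winding-edgesFrom g h x [] y comp with gg , gh , hg , hh ← comp (here refl) = begin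
      turn (h x) (h y) + 0ℤ    ≡⟨ cong (_+ 0ℤ) (turn-drift (g x) (h x) (g y) (h y) gg gh hg hh) ⟩
      turn (g x) (g y) + (drift (g y) (h y) - drift (g x) (h x)) + 0ℤ
        ≡⟨ solve 2 (λ a b → a :+ b :+ con 0ℤ := a :+ con 0ℤ :+ b) refl (turn (g x) (g y)) (drift (g y) (h y) - drift (g x) (h x)) ⟩
      turn (g x) (g y) + 0ℤ + (drift (g y) (h y) - drift (g x) (h x))  ∎
      where open ≡-Reasoning
    winding-edgesFrom g h x (z ∷ vs) y comp with gg , gh , hg , hh ← comp (here refl) = begin
      turn (h x) (h z) + winding h (edgesFrom z vs y)
        ≡⟨ cong₂ _+_ (turn-drift (g x) (h x) (g z) (h z) gg gh hg hh) (winding-edgesFrom g h z vs y (comp ∘ there)) ⟩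
      turn (g x) (g z) + (dz - dx) + (winding g (edgesFrom z vs y) + (dy - dz))
        ≡⟨ solve 5 (λ s dx dy dz r → s :+ (dz :- dx) :+ (r :+ (dy :- dz)) := s :+ r :+ (dy :- dx)) refl
             (turn (g x) (g z)) dx dy dz (winding g (edgesFrom z vs y)) ⟩
      turn (g x) (g z) + winding g (edgesFrom z vs y) + (dy - dx)  ∎
      where
      open ≡-Reasoning
      dx = drift (g x) (h x)
      dy = drift (g y) (h y)
      dz = drift (g z) (h z)

    winding-cell : ∀ {k} (g h : Fin n → Fin 3) (vs : Vec (Fin n) (suc k)) → Compatible g h (cycleEdges vs) →
                   winding h (cycleEdges vs) ≡ winding g (cycleEdges vs)
    winding-cell g h (x ∷ vs) comp = trans (winding-edgesFrom g h x vs x comp)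
      (solve 2 (λ w d → w :+ (d :- d) := w) refl (winding g (edgesFrom x vs x)) (drift (g x) (h x)))

    winding-swap : ∀ g es → winding (swap₁₂ ∘ g) es ≡ - winding g es
    winding-swap g []             = refl
    winding-swap g ((x , y) ∷ es) = trans (cong₂ _+_ (turn-swap (g x) (g y)) (winding-swap g es))
      (sym (neg-distrib-+ (turn (g x) (g y)) (winding g es)))

    winding-parity : ∀ (g : Fin n → Fin 3) es → (∀ {x y} → (x , y) ∈ es → g x ≢ g y) →
                     ∃[ z ] winding g es ≡ + length es + (z + z)
    winding-parity g []             proper = 0ℤ , refl
    winding-parity g ((x , y) ∷ es) proper
      with z , eq ← turn-odd (g x) (g y) (proper (here refl))
      with z′ , eq′ ← winding-parity g es (proper ∘ there) = z + z′ , trans (cong₂ _+_ eq eq′)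
        (solve 3 (λ z l z′ → con 1ℤ :+ (z :+ z) :+ (l :+ (z′ :+ z′)) := con 1ℤ :+ l :+ ((z :+ z′) :+ (z :+ z′))) refl z (+ length es) z′)

    winding-swap-≢ : ∀ (g : Fin n → Fin 3) es → odd (length es) ≡ true → (∀ {x y} → (x , y) ∈ es → g x ≢ g y) →
                     winding g es ≢ winding (swap₁₂ ∘ g) es
    winding-swap-≢ g es len-odd proper eq = contradict (winding-parity g es proper)
      where
      open ≡-Reasoning
      w l : ℤ
      w = winding g es
      l = + length es

      w≡0 : w ≡ 0ℤ
      w≡0 = ℤₚ.*-cancelˡ-≡ (+ 2) w 0ℤ (begin
        + 2 * w       ≡⟨ solve 1 (λ w → con (+ 2) :* w := w :- (:- w)) refl w ⟩
        w - (- w)     ≡⟨ cong (λ v → w - v) (trans (sym (winding-swap g es)) (sym eq)) ⟩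
        w - w         ≡⟨ solve 1 (λ w → w :- w := con (+ 2) :* con 0ℤ) refl w ⟩
        + 2 * 0ℤ      ∎)

      contradict : ¬ (∃[ z ] w ≡ l + (z + z))
      contradict (z , parity) = true≢false (trans (sym len-odd) (trans (cong odd len≡) (odd-+-double ∣ - z ∣ 0)))
        where
        true≢false : true ≢ false
        true≢false ()

        len≡ : length es ≡ ∣ - z ∣ ℕ.+ ∣ - z ∣ ℕ.+ 0
        len≡ = begin
          ∣ l ∣                            ≡⟨ cong ∣_∣ (solve 2 (λ l z → l := (l :+ (z :+ z)) :+ con (+ 2) :* (:- z)) refl l z) ⟩
          ∣ (l + (z + z)) + + 2 * (- z) ∣  ≡⟨ cong (λ v → ∣ v + + 2 * (- z) ∣) (trans (sym parity) w≡0) ⟩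
          ∣ 0ℤ + + 2 * (- z) ∣             ≡⟨ cong ∣_∣ (ℤₚ.+-identityˡ (+ 2 * (- z))) ⟩
          ∣ + 2 * (- z) ∣                  ≡⟨ abs-* (+ 2) (- z) ⟩
          2 ℕ.* ∣ - z ∣                    ≡⟨ ℕₚ.+-assoc ∣ - z ∣ ∣ - z ∣ 0 ⟨
          ∣ - z ∣ ℕ.+ ∣ - z ∣ ℕ.+ 0        ∎

open import Defs
open OddCycles using
  (_^_; 0≤-^; 0≤-*; 0<-*; *-monoˡ; *-monoʳ; *-cancel; 0≤q-p; p≤p+q; q≤p+q; ι; 0≤ι; 0<ι; ι-mono; ι≡/1; archimedean;
  recip; *-recip; 0<recip; ⟦_⟧; 0≤⟦_⟧; ⟦_⟧≤1; ⟦not⟧; ∑; δ; 0≤δ; δ-refl; δ-≢; tuples; 𝔼; 𝔼-mono; 𝔼-cong; 𝔼-+; 𝔼-*; 𝔼-1;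
  bitMass; rowMass; mass; adj; adj⇒Adjacent; Edges; present; odd; cycleEdges; length-cycleEdges; len; odd-len; isCycle;
  hasOddCycle; no-odd-cycle-rare)
open Winding
open ℚ-Solver using (solve; _:=_; _:+_; _:*_; _:-_; :-_; con)

-- Connectedness of the unit interval

eventually-≤⇒≤ : ∀ x y N → (∀ m → N ℕ.≤ m → seq x m ℚ.≤ seq y m) → x ≤ y
eventually-≤⇒≤ x y N x≤y (ε , 0<ε , M , y<x) = ℚₚ.<-irrefl refl (begin-strict
  seq y m              ≡⟨ ℚₚ.+-identityʳ (seq y m) ⟨
  seq y m ℚ.+ 0ℚ       <⟨ ℚₚ.+-monoʳ-< (seq y m) 0<ε ⟩
  seq y m ℚ.+ ε        ≤⟨ y<x m (ℕₚ.m≤n⊔m N M) ⟩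
  seq x m              ≤⟨ x≤y m (ℕₚ.m≤m⊔n N M) ⟩
  seq y m              ∎)
  where
  open ℚₚ.≤-Reasoning
  m = N ℕ.⊔ M

-- This is k + 1 ≤ 2^k without division.
½^*ι≤1 : ∀ k → ½ ^ k ℚ.* ι (suc k) ℚ.≤ 1ℚ
½^*ι≤1 zero    = ℚₚ.≤-refl
½^*ι≤1 (suc k) = begin
  ½ ℚ.* ½ ^ k ℚ.* (1ℚ ℚ.+ (1ℚ ℚ.+ ι k))
    ≤⟨ p≤p+q (0≤-* (0≤-* (ℚₚ.<⇒≤ (ℚₚ.positive⁻¹ ½)) (0≤-^ k (ℚₚ.<⇒≤ (ℚₚ.positive⁻¹ ½)))) (0≤ι k)) ⟩
  ½ ℚ.* ½ ^ k ℚ.* (1ℚ ℚ.+ (1ℚ ℚ.+ ι k)) ℚ.+ ½ ℚ.* ½ ^ k ℚ.* ι k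
    ≡⟨ solve 2 (λ h k → con ½ :* h :* (con 1ℚ :+ (con 1ℚ :+ k)) :+ con ½ :* h :* k := h :* (con 1ℚ :+ k)) refl (½ ^ k) (ι k) ⟩
  ½ ^ k ℚ.* ι (suc k)  ≤⟨ ½^*ι≤1 k ⟩
  1ℚ                   ∎
  where open ℚₚ.≤-Reasoning

½^-small : ∀ q → 0ℚ ℚ.< q → ∃[ k ] ½ ^ k ℚ.≤ q
½^-small q 0<q = k , *-cancel (0<ι k) (begin
  ι (suc k) ℚ.* ½ ^ k       ≡⟨ ℚₚ.*-comm (ι (suc k)) (½ ^ k) ⟩
  ½ ^ k ℚ.* ι (suc k)       ≤⟨ ½^*ι≤1 k ⟩
  1ℚ                        ≡⟨ *-recip q 0<q ⟨
  q ℚ.* recip q 0<q         ≤⟨ *-monoʳ (ℚₚ.<⇒≤ 0<q) (ℚₚ.≤-trans (proj₂ (archimedean (recip q 0<q))) (q≤p+q (ℚₚ.<⇒≤ (ℚₚ.positive⁻¹ 1ℚ)))) ⟩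
  q ℚ.* ι (suc k)           ≡⟨ ℚₚ.*-comm q (ι (suc k)) ⟩
  ι (suc k) ℚ.* q           ∎)
  where
  open ℚₚ.≤-Reasoning
  k = proj₁ (archimedean (recip q 0<q))

∣-∣≤ : ∀ {p q} → p ℚ.≤ q → ℚ.- p ℚ.≤ q → ℚ.∣ p ∣ ℚ.≤ q
∣-∣≤ {p} p≤q -p≤q with ℚₚ.∣p∣≡p∨∣p∣≡-p p
... | inj₁ eq = subst (ℚ._≤ _) (sym eq) p≤q
... | inj₂ eq = subst (ℚ._≤ _) (sym eq) -p≤q

-- Bisection needs W to be locally constant at the limit only; uniform continuity
-- is not constructively available.
module Bisection (W : UnitInterval → ℤ) (W0≢W1 : W 0ᴵ ≢ W 1ᴵ) where

  -- The membership proofs are stored because W may depend on the proof that a real lies in the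
  -- interval: a midpoint must keep the same proof when it becomes an endpoint.
  record Bracket : Set where
    field
      lo hi : ℚ
      0≤lo  : 0ℚ ℚ.≤ lo
      lo≤hi : lo ℚ.≤ hi
      hi≤1  : hi ℚ.≤ 1ℚ
      lo∈   : 0ℝ ≤ fromℚ lo × fromℚ lo ≤ 1ℝ
      hi∈   : 0ℝ ≤ fromℚ hi × fromℚ hi ≤ 1ℝ
      W≢    : W (fromℚ lo , lo∈) ≢ W (fromℚ hi , hi∈)

  open Bracket

  _⊆_ : Bracket → Bracket → Set
  b ⊆ b′ = lo b′ ℚ.≤ lo b × hi b ℚ.≤ hi b′

  module Halve (b : Bracket) where

    mid : ℚ
    mid = ½ ℚ.* (lo b ℚ.+ hi b)

    lo≤mid : lo b ℚ.≤ mid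
    lo≤mid = begin
      lo b                       ≡⟨ solve 1 (λ l → l := con ½ :* (l :+ l)) refl (lo b) ⟩
      ½ ℚ.* (lo b ℚ.+ lo b)      ≤⟨ *-monoʳ (ℚₚ.<⇒≤ (ℚₚ.positive⁻¹ ½)) (ℚₚ.+-monoʳ-≤ (lo b) (lo≤hi b)) ⟩
      mid                        ∎
      where open ℚₚ.≤-Reasoning

    mid≤hi : mid ℚ.≤ hi b
    mid≤hi = begin
      mid                        ≤⟨ *-monoʳ (ℚₚ.<⇒≤ (ℚₚ.positive⁻¹ ½)) (ℚₚ.+-monoˡ-≤ (hi b) (lo≤hi b)) ⟩
      ½ ℚ.* (hi b ℚ.+ hi b)      ≡⟨ solve 1 (λ l → l := con ½ :* (l :+ l)) refl (hi b) ⟨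
      hi b                       ∎
      where open ℚₚ.≤-Reasoning

    0≤mid : 0ℚ ℚ.≤ mid
    0≤mid = ℚₚ.≤-trans (0≤lo b) lo≤mid

    mid≤1 : mid ℚ.≤ 1ℚ
    mid≤1 = ℚₚ.≤-trans mid≤hi (hi≤1 b)

    mid∈ : 0ℝ ≤ fromℚ mid × fromℚ mid ≤ 1ℝ
    mid∈ = eventually-≤⇒≤ 0ℝ (fromℚ mid) 0 (λ _ _ → 0≤mid) , eventually-≤⇒≤ (fromℚ mid) 1ℝ 0 (λ _ _ → mid≤1)

    halve : ∃[ b′ ] b′ ⊆ b × hi b′ ℚ.- lo b′ ≡ ½ ℚ.* (hi b ℚ.- lo b)
    -- Equality in ℤ is decidable. If W agrees at lo and mid, the change lies between mid and hi;
    -- otherwise it lies between lo and mid.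
    halve = pick (W (fromℚ (lo b) , lo∈ b) ℤₚ.≟ W (fromℚ mid , mid∈))
      where
      pick : Dec (W (fromℚ (lo b) , lo∈ b) ≡ W (fromℚ mid , mid∈)) → ∃[ b′ ] b′ ⊆ b × hi b′ ℚ.- lo b′ ≡ ½ ℚ.* (hi b ℚ.- lo b)
      pick (yes eq) = record { lo = mid ; hi = hi b ; 0≤lo = 0≤mid ; lo≤hi = mid≤hi ; hi≤1 = hi≤1 b
                          ; lo∈ = mid∈ ; hi∈ = hi∈ b ; W≢ = λ eq′ → W≢ b (trans eq eq′) } ,
                   (lo≤mid , ℚₚ.≤-refl) ,
                   solve 2 (λ l h → h :- con ½ :* (l :+ h) := con ½ :* (h :- l)) refl (lo b) (hi b)
      pick (no neq) = record { lo = lo b ; hi = mid ; 0≤lo = 0≤lo b ; lo≤hi = lo≤mid ; hi≤1 = mid≤1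
                          ; lo∈ = lo∈ b ; hi∈ = mid∈ ; W≢ = neq } ,
                   (ℚₚ.≤-refl , mid≤hi) ,
                   solve 2 (λ l h → con ½ :* (l :+ h) :- l := con ½ :* (h :- l)) refl (lo b) (hi b)

  bracket : ℕ → Bracket
  bracket zero    = record { lo = 0ℚ ; hi = 1ℚ ; 0≤lo = ℚₚ.≤-refl ; lo≤hi = ℚₚ.<⇒≤ (ℚₚ.positive⁻¹ 1ℚ) ; hi≤1 = ℚₚ.≤-refl
                           ; lo∈ = proj₂ 0ᴵ ; hi∈ = proj₂ 1ᴵ ; W≢ = W0≢W1 }
  bracket (suc k) = proj₁ (Halve.halve (bracket k))

  width : ∀ k → hi (bracket k) ℚ.- lo (bracket k) ≡ ½ ^ k
  width zero    = refl
  width (suc k) = trans (proj₂ (proj₂ (Halve.halve (bracket k)))) (cong (½ ℚ.*_) (width k))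

  nested : ∀ {k m} → k ℕ.≤ m → bracket m ⊆ bracket k
  nested k≤m = go (ℕₚ.≤⇒≤′ k≤m)
    where
    go : ∀ {k m} → k ℕ.≤′ m → bracket m ⊆ bracket k
    go ℕ.≤′-refl               = ℚₚ.≤-refl , ℚₚ.≤-refl
    go (ℕ.≤′-step {m} k≤m) =
      let lo≤ , ≤hi = go k≤m
          lo≤′ , ≤hi′ = proj₁ (proj₂ (Halve.halve (bracket m)))
      in ℚₚ.≤-trans lo≤ lo≤′ , ℚₚ.≤-trans ≤hi′ ≤hi

  lo-lo≤ : ∀ {k m} → k ℕ.≤ m → lo (bracket m) ℚ.- lo (bracket k) ℚ.≤ ½ ^ k
  lo-lo≤ {k} {m} k≤m = begin
    lo (bracket m) ℚ.- lo (bracket k)   ≤⟨ ℚₚ.+-monoˡ-≤ (ℚ.- lo (bracket k)) (ℚₚ.≤-trans (lo≤hi (bracket m)) (proj₂ (nested k≤m))) ⟩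
    hi (bracket k) ℚ.- lo (bracket k)   ≡⟨ width k ⟩
    ½ ^ k                               ∎
    where open ℚₚ.≤-Reasoning

  hi-lo≤ : ∀ {k m} → k ℕ.≤ m → hi (bracket k) ℚ.- lo (bracket m) ℚ.≤ ½ ^ k
  hi-lo≤ {k} {m} k≤m = begin
    hi (bracket k) ℚ.- lo (bracket m)   ≤⟨ ℚₚ.+-monoʳ-≤ (hi (bracket k)) (ℚₚ.neg-antimono-≤ (proj₁ (nested k≤m))) ⟩
    hi (bracket k) ℚ.- lo (bracket k)   ≡⟨ width k ⟩
    ½ ^ k                               ∎
    where open ℚₚ.≤-Reasoning

  ½*-< : ∀ {q} → 0ℚ ℚ.< q → ½ ℚ.* q ℚ.< q
  ½*-< {q} 0<q = begin-strict
    ½ ℚ.* q                  ≡⟨ ℚₚ.+-identityʳ (½ ℚ.* q) ⟨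
    ½ ℚ.* q ℚ.+ 0ℚ           <⟨ ℚₚ.+-monoʳ-< (½ ℚ.* q) (ℚₚ.*-monoʳ-<-pos ½ 0<q) ⟩
    ½ ℚ.* q ℚ.+ ½ ℚ.* q      ≡⟨ solve 1 (λ q → con ½ :* q :+ con ½ :* q := q) refl q ⟩
    q                        ∎
    where open ℚₚ.≤-Reasoning

  lo-cauchy : IsCauchy (λ m → lo (bracket m))
  lo-cauchy ε 0<ε = k , λ m n k≤m k≤n → ℚₚ.≤-<-trans (∣-∣≤ (close m n k≤m k≤n)
      (subst (ℚ._≤ ½ ℚ.* ε) (solve 2 (λ a b → b :- a := :- (a :- b)) refl (lo (bracket m)) (lo (bracket n))) (close n m k≤n k≤m)))
      (½*-< 0<ε)
    where
    k : ℕ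
    k = proj₁ (½^-small (½ ℚ.* ε) (ℚₚ.*-monoʳ-<-pos ½ 0<ε))
    close : ∀ m n → k ℕ.≤ m → k ℕ.≤ n → lo (bracket m) ℚ.- lo (bracket n) ℚ.≤ ½ ℚ.* ε
    close m n k≤m k≤n = begin
      lo (bracket m) ℚ.- lo (bracket n)   ≤⟨ ℚₚ.+-monoʳ-≤ (lo (bracket m)) (ℚₚ.neg-antimono-≤ (proj₁ (nested k≤n))) ⟩
      lo (bracket m) ℚ.- lo (bracket k)   ≤⟨ lo-lo≤ k≤m ⟩
      ½ ^ k                               ≤⟨ proj₂ (½^-small (½ ℚ.* ε) (ℚₚ.*-monoʳ-<-pos ½ 0<ε)) ⟩
      ½ ℚ.* ε                             ∎
      where open ℚₚ.≤-Reasoning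

  limit : UnitInterval
  limit = mkℝ (λ m → lo (bracket m)) lo-cauchy ,
    eventually-≤⇒≤ 0ℝ (mkℝ (λ m → lo (bracket m)) lo-cauchy) 0 (λ m _ → 0≤lo (bracket m)) ,
    eventually-≤⇒≤ (mkℝ (λ m → lo (bracket m)) lo-cauchy) 1ℝ 0 (λ m _ → ℚₚ.≤-trans (lo≤hi (bracket m)) (hi≤1 (bracket m)))

  -- Both ends of a sufficiently small bracket lie within δ of the limit, where W would be constant.
  not-locally-constant : ¬ (∃[ δ ] 0ℝ < δ × (∀ t → ∣ proj₁ limit - proj₁ t ∣< δ → W t ≡ W limit))
  not-locally-constant (δ , (η , 0<η , N , η≤δ) , const) = W≢ (bracket k)
      (trans (const (fromℚ (lo (bracket k)) , lo∈ (bracket k)) lo-close)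
      (sym (const (fromℚ (hi (bracket k)) , hi∈ (bracket k)) hi-close)))
    where
    open ℚₚ.≤-Reasoning
    0<½η : 0ℚ ℚ.< ½ ℚ.* η
    0<½η = ℚₚ.*-monoʳ-<-pos ½ 0<η
    k : ℕ
    k = proj₁ (½^-small (½ ℚ.* η) 0<½η)

    -- Half of η bounds the distance; the other half remains as the margin of the strict inequality.
    within : ∀ {q} m → q ℚ.≤ ½ ^ k → N ℕ.≤ m → q ℚ.+ ½ ℚ.* η ℚ.≤ seq δ m
    within {q} m q≤ N≤m = begin
      q ℚ.+ ½ ℚ.* η              ≤⟨ ℚₚ.+-monoˡ-≤ (½ ℚ.* η) (ℚₚ.≤-trans q≤ (proj₂ (½^-small (½ ℚ.* η) 0<½η))) ⟩
      ½ ℚ.* η ℚ.+ ½ ℚ.* η        ≡⟨ solve 1 (λ q → con ½ :* q :+ con ½ :* q := con 0ℚ :+ q) refl η ⟩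
      0ℚ ℚ.+ η                   ≤⟨ η≤δ m N≤m ⟩
      seq δ m                    ∎

    0≤½^ : 0ℚ ℚ.≤ ½ ^ k
    0≤½^ = 0≤-^ k (ℚₚ.<⇒≤ (ℚₚ.positive⁻¹ ½))

    nonpos : ∀ {p q} → p ℚ.≤ q → p ℚ.- q ℚ.≤ ½ ^ k
    nonpos {p} {q} p≤q = ℚₚ.≤-trans (ℚₚ.≤-trans (ℚₚ.+-monoˡ-≤ (ℚ.- q) p≤q) (ℚₚ.≤-reflexive (ℚₚ.+-inverseʳ q))) 0≤½^

    lo-close : ∣ proj₁ limit - fromℚ (lo (bracket k)) ∣< δ
    lo-close =
      (½ ℚ.* η , 0<½η , N ℕ.⊔ k , λ m N≤m → within m (lo-lo≤ (ℕₚ.m⊔n≤o⇒n≤o N k N≤m)) (ℕₚ.m⊔n≤o⇒m≤o N k N≤m)) ,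
      (½ ℚ.* η , 0<½η , N ℕ.⊔ k , λ m N≤m → within m (nonpos (proj₁ (nested (ℕₚ.m⊔n≤o⇒n≤o N k N≤m)))) (ℕₚ.m⊔n≤o⇒m≤o N k N≤m))

    hi-close : ∣ proj₁ limit - fromℚ (hi (bracket k)) ∣< δ
    hi-close =
      (½ ℚ.* η , 0<½η , N ℕ.⊔ k , λ m N≤m → within m (nonpos (ℚₚ.≤-trans (lo≤hi (bracket m)) (proj₂ (nested (ℕₚ.m⊔n≤o⇒n≤o N k N≤m))))) (ℕₚ.m⊔n≤o⇒m≤o N k N≤m)) ,
      (½ ℚ.* η , 0<½η , N ℕ.⊔ k , λ m N≤m → within m (hi-lo≤ (ℕₚ.m⊔n≤o⇒n≤o N k N≤m)) (ℕₚ.m⊔n≤o⇒m≤o N k N≤m))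

locally-constant⇒equal-ends : (W : UnitInterval → ℤ) →
  (∀ s → ∃[ δ ] 0ℝ < δ × (∀ t → ∣ proj₁ s - proj₁ t ∣< δ → W t ≡ W s)) → W 0ᴵ ≡ W 1ᴵ
locally-constant⇒equal-ends W const with W 0ᴵ ℤₚ.≟ W 1ᴵ
... | yes eq = eq
... | no neq = contradiction (const (Bisection.limit W neq)) (Bisection.not-locally-constant W neq)

-- Components of Hom(G,K₃)

≡-seq⇒≃ : ∀ x y → (∀ m → seq x m ≡ seq y m) → x ≃ y
≡-seq⇒≃ x y eq = eventually-≤⇒≤ x y 0 (λ m _ → ℚₚ.≤-reflexive (eq m)) , eventually-≤⇒≤ y x 0 (λ m _ → ℚₚ.≤-reflexive (sym (eq m)))

0<1ℝ : 0ℝ < 1ℝ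
0<1ℝ = 1ℚ , ℚₚ.positive⁻¹ 1ℚ , 0 , λ _ _ → ℚₚ.≤-refl

δ-sum : ∀ (a : Fin 3) → VF.foldr ℚ._+_ 0ℚ (δ a) ≡ 1ℚ
δ-sum 0F = refl
δ-sum 1F = refl
δ-sum 2F = refl

min-pos : ∀ {m} (q : Fin m → ℚ) → (∀ i → 0ℚ ℚ.< q i) → ∃[ ε ] 0ℚ ℚ.< ε × (∀ i → ε ℚ.≤ q i)
min-pos {zero}  q 0<q = 1ℚ , ℚₚ.positive⁻¹ 1ℚ , λ ()
min-pos {suc m} q 0<q =
  let ε , 0<ε , ε≤ = min-pos (q ∘ suc) (0<q ∘ suc)
  in q zero ℚ.⊓ ε , 0<⊓ (ℚₚ.⊓-sel (q zero) ε) (0<q zero) 0<ε ,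
     λ { zero → ℚₚ.p⊓q≤p (q zero) ε ; (suc i) → ℚₚ.≤-trans (ℚₚ.p⊓q≤q (q zero) ε) (ε≤ i) }
  where
  0<⊓ : ∀ {a b} → (a ℚ.⊓ b ≡ a) ⊎ (a ℚ.⊓ b ≡ b) → 0ℚ ℚ.< a → 0ℚ ℚ.< b → 0ℚ ℚ.< a ℚ.⊓ b
  0<⊓ (inj₁ eq) 0<a 0<b = subst (0ℚ ℚ.<_) (sym eq) 0<a
  0<⊓ (inj₂ eq) 0<a 0<b = subst (0ℚ ℚ.<_) (sym eq) 0<b

<-≃-fromℚ-trans : ∀ {a b} → 0ℝ < a → a ≃ fromℚ b → 0ℚ ℚ.< b
<-≃-fromℚ-trans {a} {b} (ε , 0<ε , N , ε≤a) (a≤b , _) = ℚₚ.≰⇒> λ b≤0 → a≤b (ε , 0<ε , N , λ m le → begin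
  b ℚ.+ ε     ≤⟨ ℚₚ.+-monoˡ-≤ ε b≤0 ⟩
  0ℚ ℚ.+ ε    ≤⟨ ε≤a m le ⟩
  seq a m     ∎)
  where open ℚₚ.≤-Reasoning

winding-cong : ∀ {n} {f g : Fin n → Fin 3} → (∀ v → f v ≡ g v) → ∀ es → winding f es ≡ winding g es
winding-cong f≗g []             = refl
winding-cong f≗g ((x , y) ∷ es) = cong₂ ℤ._+_ (cong₂ turn (f≗g x) (f≗g y)) (winding-cong f≗g es)

module _ {n : ℕ} {G : Graph n} where

  vertexCoord : (Fin n → Fin 3) → Fin n → Fin 3 → ℝ
  vertexCoord f v i = fromℚ (δ (f v) i)

  0<vertexCoord : ∀ f v i → 0ℝ < vertexCoord f v i → f v ≡ i
  0<vertexCoord f v i pos = decidable-stable (f v ≟ i) λ f≢i →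
    eventually-≤⇒≤ (vertexCoord f v i) 0ℝ 0 (λ _ _ → ℚₚ.≤-reflexive (δ-≢ f≢i)) pos

  vertexPoint : Colourable G 3 → HomPoint G (K 3)
  vertexPoint (f , proper) = record
    { coord   = vertexCoord f
    ; nonneg  = λ v i → eventually-≤⇒≤ 0ℝ (vertexCoord f v i) 0 (λ _ _ → 0≤δ (f v) i)
    ; sum-one = λ v → ≡-seq⇒≃ (VF.foldr _+_ 0ℝ (vertexCoord f v)) 1ℝ (λ _ → δ-sum (f v))
    ; support = (λ v → f v , subst (λ q → 0ℝ < fromℚ q) (sym (δ-refl (f v))) 0<1ℝ) ,
                (λ u v uv i j ui vj i≡j → proper u v uv
                  (trans (0<vertexCoord f u i ui) (trans i≡j (sym (0<vertexCoord f v j vj)))))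
    }

  -- Any selection from the supports of a point is a 3-colouring in the cell
  -- containing that point in its interior.
  colour : HomPoint G (K 3) → Fin n → Fin 3
  colour x v = proj₁ (proj₁ (support x) v)

  0<colour : ∀ x v → 0ℝ < coord x v (colour x v)
  0<colour x v = proj₂ (proj₁ (support x) v)

  -- The ends of a path match the given points only up to `≃`, and the colours selected there come
  -- from the path's own support proofs. At a vertex of the complex the support leaves a single
  -- choice.
  colour-vertex : ∀ x (f : Fin n → Fin 3) → (∀ v i → coord x v i ≃ vertexCoord f v i) → ∀ v → colour x v ≡ f v
  colour-vertex x f at v = sym (0<vertexCoord f v (colour x v)
    (δ (f v) (colour x v) , <-≃-fromℚ-trans {coord x v (colour x v)} (0<colour x v) (at v (colour x v)) ,
     0 , λ _ _ → ℚₚ.≤-reflexive (ℚₚ.+-identityˡ _)))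

  module _ {k : ℕ} (vs : Vec (Fin n) (suc k)) (in-G : ∀ {x y} → (x , y) ∈ cycleEdges vs → E G x y) where

    wind : HomPoint G (K 3) → ℤ
    wind x = winding (colour x) (cycleEdges vs)

    -- If the colours selected at x stay positive at y, then `colour x` and `colour y` both select
    -- from the support of y and so lie in one cell.
    wind-near : ∀ x y → (∀ v → 0ℝ < coord y v (colour x v)) → wind y ≡ wind x
    wind-near x y pos = winding-cell (colour x) (colour y) vs λ {u} {v} uv →
      let edge = proj₂ (support y) u v (in-G uv)
      in edge _ _ (pos u) (pos v) , edge _ _ (pos u) (0<colour y v) ,
         edge _ _ (0<colour y u) (pos v) , edge _ _ (0<colour y u) (0<colour y v)

    module _ {x y : HomPoint G (K 3)} (P : Path x y) where

      open Path P

      locally-constant : ∀ s → ∃[ δ ] 0ℝ < δ × (∀ t → ∣ proj₁ s - proj₁ t ∣< δ → wind (γ t) ≡ wind (γ s))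
      locally-constant s = proj₁ cont , proj₁ (proj₂ cont) , λ t close → wind-near (γ s) (γ t) (λ v → stays t v (proj₂ (proj₂ cont) t close))
        where
        -- Each proof of positivity carries a rational lower bound for its coordinate. A change of
        -- less than the least of them keeps every selected coordinate positive.
        lower : ∃[ ε ] 0ℚ ℚ.< ε × (∀ v → ε ℚ.≤ proj₁ (0<colour (γ s) v))
        lower = min-pos (λ v → proj₁ (0<colour (γ s) v)) (λ v → proj₁ (proj₂ (0<colour (γ s) v)))

        ε : ℚ
        ε = proj₁ lower

        0<ε : 0ℝ < fromℚ ε
        0<ε = ε , proj₁ (proj₂ lower) , 0 , λ _ _ → ℚₚ.≤-reflexive (ℚₚ.+-identityˡ ε)

        cont : ∃[ δ ] 0ℝ < δ × (∀ t → ∣ proj₁ s - proj₁ t ∣< δ → ∀ v i → ∣ coord (γ s) v i - coord (γ t) v i ∣< fromℚ ε)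
        cont = continuous s (fromℚ ε) 0<ε

        stays : ∀ t v → (∀ v i → ∣ coord (γ s) v i - coord (γ t) v i ∣< fromℚ ε) → 0ℝ < coord (γ t) v (colour (γ s) v)
        stays t v near = above (proj₁ (near v (colour (γ s) v))) (proj₂ (0<colour (γ s) v)) (proj₂ (proj₂ lower) v)
          where
          a b : ℝ
          a = coord (γ s) v (colour (γ s) v)
          b = coord (γ t) v (colour (γ s) v)

          above : ∀ {q} → a - b < fromℚ ε → 0ℚ ℚ.< q × (∃[ N ] ∀ m → N ℕ.≤ m → 0ℚ ℚ.+ q ℚ.≤ seq a m) → ε ℚ.≤ q → 0ℝ < b
          above {q} (η , 0<η , M , a-b) (_ , N , q≤a) ε≤q = η , 0<η , M ℕ.⊔ N , λ m le → begin
            0ℚ ℚ.+ η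
              ≡⟨ solve 3 (λ η a b → con 0ℚ :+ η := (a :+ (:- b) :+ η) :+ (b :- a)) refl η (seq a m) (seq b m) ⟩
            (seq a m ℚ.+ ℚ.- seq b m ℚ.+ η) ℚ.+ (seq b m ℚ.- seq a m)
              ≤⟨ ℚₚ.+-monoˡ-≤ (seq b m ℚ.- seq a m) (ℚₚ.≤-trans (a-b m (ℕₚ.m⊔n≤o⇒m≤o M N le)) (ℚₚ.≤-trans ε≤q
                   (subst (ℚ._≤ seq a m) (ℚₚ.+-identityˡ q) (q≤a m (ℕₚ.m⊔n≤o⇒n≤o M N le))))) ⟩
            seq a m ℚ.+ (seq b m ℚ.- seq a m)
              ≡⟨ solve 2 (λ a b → a :+ (b :- a) := b) refl (seq a m) (seq b m) ⟩
            seq b m  ∎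
            where open ℚₚ.≤-Reasoning

    odd-cycle⇒disconnected : odd (suc k) ≡ true → Colourable G 3 → HomDisconnected G (K 3)
    odd-cycle⇒disconnected k-odd (f , proper) = vertexPoint (f , proper) , vertexPoint (swap₁₂ ∘ f , proper′) , no-path
      where
      proper′ : ∀ u v → E G u v → swap₁₂ (f u) ≢ swap₁₂ (f v)
      proper′ u v uv eq = proper u v uv (swap₁₂-injective (f u) (f v) eq)

      no-path : ¬ Path (vertexPoint (f , proper)) (vertexPoint (swap₁₂ ∘ f , proper′))
      no-path P = winding-swap-≢ f (cycleEdges vs) (trans (cong odd (length-cycleEdges vs)) k-odd) (λ {x} {y} xy → proper x y (in-G xy))
        (trans (sym (winding-cong (colour-vertex (γ 0ᴵ) f start) (cycleEdges vs)))
          (trans (locally-constant⇒equal-ends (wind ∘ γ) (locally-constant P))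
            (winding-cong (colour-vertex (γ 1ᴵ) (swap₁₂ ∘ f) end) (cycleEdges vs))))
        where open Path P

-- Transfer to real edge probabilities

seq-weight : ∀ {n} P m (ω : EdgeBits n) → seq (weight P ω) m ≡ mass (seq P m) ω
seq-weight P m []        = refl
seq-weight P m (row ∷ ω) = cong₂ ℚ._*_ (seq-row row) (seq-weight P m ω)
  where
  seq-bit : ∀ b → seq (bitWeight P b) m ≡ bitMass (seq P m) b
  seq-bit true  = refl
  seq-bit false = refl
  seq-row : ∀ {n} (row : Vec Bool n) → seq (Vec.foldr′ (λ b r → bitWeight P b * r) 1ℝ row) m ≡ rowMass (seq P m) row
  seq-row []        = refl
  seq-row (b ∷ row) = cong₂ ℚ._*_ (seq-bit b) (seq-row row)

-- Operations on reals act termwise, so the m-th term of the real probability is the rational one at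
-- the m-th term of P.
seq-Pr : ∀ {n} P (B : EdgeBits n → Bool) m → seq (Pr P B) m ≡ 𝔼 (seq P m) (λ ω → ⟦ B ω ⟧)
seq-Pr {n} P B m = go (allEdgeBits n)
  where
  go : ∀ L → seq (foldr _+_ 0ℝ (map (weight P) (filterᵇ B L))) m ≡ ∑ L (λ ω → mass (seq P m) ω ℚ.* ⟦ B ω ⟧)
  go []      = refl
  go (ω ∷ L) with B ω
  ... | true  = cong₂ ℚ._+_ (trans (seq-weight P m ω) (sym (ℚₚ.*-identityʳ (mass (seq P m) ω)))) (go L)
  ... | false = trans (go L) (sym (trans (cong (ℚ._+ ∑ L (λ ω → mass (seq P m) ω ℚ.* ⟦ B ω ⟧)) (ℚₚ.*-zeroʳ (mass (seq P m) ω)))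
                  (ℚₚ.+-identityˡ (∑ L (λ ω → mass (seq P m) ω ℚ.* ⟦ B ω ⟧)))))

𝔼-not : ∀ {n} p (B : EdgeBits n → Bool) → 𝔼 p (λ ω → ⟦ not (B ω) ⟧) ≡ 1ℚ ℚ.- 𝔼 p (λ ω → ⟦ B ω ⟧)
𝔼-not {n} p B = begin
  𝔼 p (λ ω → ⟦ not (B ω) ⟧)
    ≡⟨ 𝔼-cong {n} p (λ ω → trans (⟦not⟧ (B ω)) (solve 1 (λ b → con 1ℚ :- b := con 1ℚ :+ con (ℚ.- 1ℚ) :* b) refl ⟦ B ω ⟧)) ⟩
  𝔼 {n} p (λ ω → 1ℚ ℚ.+ (ℚ.- 1ℚ) ℚ.* ⟦ B ω ⟧)
    ≡⟨ trans (𝔼-+ {n} p (λ _ → 1ℚ) (λ ω → (ℚ.- 1ℚ) ℚ.* ⟦ B ω ⟧)) (cong₂ ℚ._+_ (𝔼-1 n p) (𝔼-* {n} p (ℚ.- 1ℚ) (λ ω → ⟦ B ω ⟧))) ⟩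
  1ℚ ℚ.+ (ℚ.- 1ℚ) ℚ.* 𝔼 p (λ ω → ⟦ B ω ⟧)
    ≡⟨ solve 1 (λ b → con 1ℚ :- b := con 1ℚ :+ con (ℚ.- 1ℚ) :* b) refl (𝔼 p (λ ω → ⟦ B ω ⟧)) ⟨
  1ℚ ℚ.- 𝔼 p (λ ω → ⟦ B ω ⟧)  ∎
  where open ≡-Reasoning

union-bound : ∀ {n p} → 0ℚ ℚ.≤ p → p ℚ.≤ 1ℚ → (A B : EdgeBits n → Bool) →
              1ℚ ℚ.- 𝔼 p (λ ω → ⟦ A ω ∧ B ω ⟧) ℚ.≤ (1ℚ ℚ.- 𝔼 p (λ ω → ⟦ A ω ⟧)) ℚ.+ 𝔼 p (λ ω → ⟦ not (B ω) ⟧)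
union-bound {n} {p} 0≤p p≤1 A B = begin
  1ℚ ℚ.- 𝔼 p (λ ω → ⟦ A ω ∧ B ω ⟧)                          ≡⟨ 𝔼-not p (λ ω → A ω ∧ B ω) ⟨
  𝔼 p (λ ω → ⟦ not (A ω ∧ B ω) ⟧)                           ≤⟨ 𝔼-mono 0≤p p≤1 (λ ω → de-morgan (A ω) (B ω)) ⟩
  𝔼 p (λ ω → ⟦ not (A ω) ⟧ ℚ.+ ⟦ not (B ω) ⟧)               ≡⟨ 𝔼-+ p (λ ω → ⟦ not (A ω) ⟧) (λ ω → ⟦ not (B ω) ⟧) ⟩
  𝔼 p (λ ω → ⟦ not (A ω) ⟧) ℚ.+ 𝔼 p (λ ω → ⟦ not (B ω) ⟧)   ≡⟨ cong (ℚ._+ 𝔼 p (λ ω → ⟦ not (B ω) ⟧)) (𝔼-not p A) ⟩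
  (1ℚ ℚ.- 𝔼 p (λ ω → ⟦ A ω ⟧)) ℚ.+ 𝔼 p (λ ω → ⟦ not (B ω) ⟧) ∎
  where
  open ℚₚ.≤-Reasoning
  de-morgan : ∀ a b → ⟦ not (a ∧ b) ⟧ ℚ.≤ ⟦ not a ⟧ ℚ.+ ⟦ not b ⟧
  de-morgan true  b = q≤p+q {0ℚ} ℚₚ.≤-refl
  de-morgan false b = p≤p+q 0≤⟦ not b ⟧

𝔼≤1 : ∀ {n p} → 0ℚ ℚ.≤ p → p ℚ.≤ 1ℚ → (B : EdgeBits n → Bool) → 𝔼 p (λ ω → ⟦ B ω ⟧) ℚ.≤ 1ℚ
𝔼≤1 {n} {p} 0≤p p≤1 B = ℚₚ.≤-trans (𝔼-mono 0≤p p≤1 (λ ω → ⟦ B ω ⟧≤1)) (ℚₚ.≤-reflexive (𝔼-1 n p))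

ι*[x/n]≡x : ∀ n x → ι (suc n) ℚ.* (x ℚ.* (ℤ.+ 1 ℚ./ suc n)) ≡ x
ι*[x/n]≡x n x = trans (solve 3 (λ a x b → a :* (x :* b) := (a :* b) :* x) refl (ι (suc n)) x (ℤ.+ 1 ℚ./ suc n))
  (trans (cong (ℚ._* x) cancel) (ℚₚ.*-identityˡ x))
  where
  coprime = Coprimality.sym (1-coprimeTo (suc n))
  cancel : ι (suc n) ℚ.* (ℤ.+ 1 ℚ./ suc n) ≡ 1ℚ
  cancel = trans (cong₂ ℚ._*_ (trans (ι≡/1 (suc n)) (ℚₚ.normalize-coprime coprime)) (ℚₚ.normalize-coprime (1-coprimeTo (suc n))))
    (ℚₚ.*-inverseʳ (mkℚ (ℤ.+ suc n) 0 coprime))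

-- Rational bounds on the terms of a real

p≤∣p∣ : ∀ p → p ℚ.≤ ℚ.∣ p ∣
p≤∣p∣ p with ℚₚ.≤-total 0ℚ p
... | inj₁ 0≤p = ℚₚ.≤-reflexive (sym (ℚₚ.0≤p⇒∣p∣≡p 0≤p))
... | inj₂ p≤0 = ℚₚ.≤-trans p≤0 (ℚₚ.0≤∣p∣ p)

eventually-bounded : ∀ x → ∃[ q ] 0ℚ ℚ.< q × ∃[ N ] ∀ m → N ℕ.≤ m → seq x m ℚ.≤ q
eventually-bounded x =
  let N , close = cauchy x 1ℚ (ℚₚ.positive⁻¹ 1ℚ)
      open ℚₚ.≤-Reasoning
  in 1ℚ ℚ.+ ℚ.∣ seq x N ∣ , ℚₚ.+-mono-<-≤ (ℚₚ.positive⁻¹ 1ℚ) (ℚₚ.0≤∣p∣ (seq x N)) , N , λ m N≤m → begin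
    seq x m                                    ≡⟨ solve 2 (λ a b → a := (a :- b) :+ b) refl (seq x m) (seq x N) ⟩
    (seq x m ℚ.- seq x N) ℚ.+ seq x N
      ≤⟨ ℚₚ.+-mono-≤ (ℚₚ.≤-trans (p≤∣p∣ (seq x m ℚ.- seq x N)) (ℚₚ.<⇒≤ (close m N N≤m ℕₚ.≤-refl))) (p≤∣p∣ (seq x N)) ⟩
    1ℚ ℚ.+ ℚ.∣ seq x N ∣                       ∎

-- `x ≤ y` is a negated strict inequality, and it bounds terms only up to a slack. From `1 ≤ c` this
-- yields `1 - η ≤ seq c m`.
≤⇒eventually : ∀ {x y} → x ≤ y → ∀ η → 0ℚ ℚ.< η → ∃[ N ] ∀ m → N ℕ.≤ m → seq x m ℚ.- η ℚ.≤ seq y m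
≤⇒eventually {x} {y} x≤y η 0<η = N , λ m N≤m → ℚₚ.≮⇒≥ λ y<x-η → x≤y (η′ , 0<η′ , N , λ k N≤k → far m k N≤m N≤k (ℚₚ.<⇒≤ y<x-η))
  where
  η′ : ℚ
  -- Quarters of η: two for the oscillations of x and y, one for the strict margin, and one to
  -- spare.
  η′ = ½ ℚ.* (½ ℚ.* η)
  0<η′ : 0ℚ ℚ.< η′
  0<η′ = 0<-* (ℚₚ.positive⁻¹ ½) (0<-* (ℚₚ.positive⁻¹ ½) 0<η)
  N₁ N₂ N : ℕ
  N₁ = proj₁ (cauchy x η′ 0<η′)
  N₂ = proj₁ (cauchy y η′ 0<η′)
  N = N₁ ℕ.⊔ N₂
  far : ∀ m k → N ℕ.≤ m → N ℕ.≤ k → seq y m ℚ.≤ seq x m ℚ.- η → seq y k ℚ.+ η′ ℚ.≤ seq x k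
  far m k N≤m N≤k le = begin
    seq y k ℚ.+ η′
      ≡⟨ solve 3 (λ yk ym e → yk :+ e := (yk :- ym) :+ ym :+ e) refl (seq y k) (seq y m) η′ ⟩
    (seq y k ℚ.- seq y m) ℚ.+ seq y m ℚ.+ η′
      ≤⟨ ℚₚ.+-monoˡ-≤ η′ (ℚₚ.+-mono-≤ (ℚₚ.≤-trans (p≤∣p∣ (seq y k ℚ.- seq y m)) (ℚₚ.<⇒≤
           (proj₂ (cauchy y η′ 0<η′) k m (ℕₚ.m⊔n≤o⇒n≤o N₁ N₂ N≤k) (ℕₚ.m⊔n≤o⇒n≤o N₁ N₂ N≤m)))) le) ⟩
    η′ ℚ.+ (seq x m ℚ.- η) ℚ.+ η′
      ≡⟨ solve 3 (λ xm xk e → con ½ :* (con ½ :* e) :+ (xm :- e) :+ con ½ :* (con ½ :* e) := xk :+ (xm :- xk) :- con ½ :* e) refl (seq x m) (seq x k) η ⟩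
    seq x k ℚ.+ (seq x m ℚ.- seq x k) ℚ.- ½ ℚ.* η
      ≤⟨ ℚₚ.+-monoˡ-≤ (ℚ.- (½ ℚ.* η)) (ℚₚ.+-monoʳ-≤ (seq x k) (ℚₚ.≤-trans (p≤∣p∣ (seq x m ℚ.- seq x k)) (ℚₚ.<⇒≤
           (proj₂ (cauchy x η′ 0<η′) m k (ℕₚ.m⊔n≤o⇒m≤o N₁ N₂ N≤m) (ℕₚ.m⊔n≤o⇒m≤o N₁ N₂ N≤k))))) ⟩
    seq x k ℚ.+ η′ ℚ.- ½ ℚ.* η
      ≡⟨ solve 2 (λ xk e → xk :+ con ½ :* (con ½ :* e) :- con ½ :* e := xk :- con ½ :* (con ½ :* e)) refl (seq x k) η ⟩
    seq x k ℚ.- η′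
      ≤⟨ ℚₚ.+-monoʳ-≤ (seq x k) (ℚₚ.neg-antimono-≤ (ℚₚ.<⇒≤ 0<η′)) ⟩
    seq x k ℚ.+ 0ℚ
      ≡⟨ ℚₚ.+-identityʳ (seq x k) ⟩
    seq x k  ∎
    where open ℚₚ.≤-Reasoning

-- From the events on edge bits to disconnectedness

χ≤3⇒Colourable : ∀ {n} {G : Graph n} → χ[ G ]≤ 3 → Colourable G 3
χ≤3⇒Colourable (j , ((f , proper) , _) , j≤3) =
  (λ v → inject≤ (f v) j≤3) , λ u v uv eq → proper u v uv (inject≤-injective j≤3 j≤3 (f u) (f v) eq)

present⇒adj : ∀ {n} (es : Edges {n}) ω → T (present es ω) → ∀ {x y} → (x , y) ∈ es → T (adj ω x y)
present⇒adj ((x , y) ∷ es) ω p (here refl) = proj₁ (Equivalence.to (T-∧ {adj ω x y}) p)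
present⇒adj ((x , y) ∷ es) ω p (there e∈)  = present⇒adj es ω (proj₂ (Equivalence.to (T-∧ {adj ω x y}) p)) e∈

hasOddCycle⇒disconnected : ∀ {n} (ω : EdgeBits n) → T (hasOddCycle ω) → Colourable (graph ω) 3 → HomDisconnected (graph ω) (K 3)
hasOddCycle⇒disconnected {n} ω has col =
  let j , has-j = satisfied (any⁻ _ (downFrom n) has)
      vs , is-cycle = satisfied (any⁻ (λ vs → isCycle vs ω) (tuples n (len j)) has-j)
  in odd-cycle⇒disconnected {G = graph ω} vs
       (λ {x} {y} xy → adj⇒Adjacent ω x y (present⇒adj (cycleEdges vs) ω (proj₂ (Equivalence.to T-∧ is-cycle)) xy))
       (odd-len j) col

-- The two high-probability events at a constant c ≥ 1

module _ (c : ℝ) (1≤c : 1ℝ ≤ c) where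

  private
    Q : ℚ
    Q = proj₁ (eventually-bounded c)

    0<Q : 0ℚ ℚ.< Q
    0<Q = proj₁ (proj₂ (eventually-bounded c))

    MQ : ℕ
    MQ = proj₁ (proj₂ (proj₂ (eventually-bounded c)))

    c≤Q : ∀ m → MQ ℕ.≤ m → seq c m ℚ.≤ Q
    c≤Q = proj₂ (proj₂ (proj₂ (eventually-bounded c)))

    M₀ : ℕ
    -- With slack 1 the bound reads 1 - 1 ≤ seq c m.
    M₀ = proj₁ (≤⇒eventually {1ℝ} {c} 1≤c 1ℚ (ℚₚ.positive⁻¹ 1ℚ))

    0≤c : ∀ m → M₀ ℕ.≤ m → 0ℚ ℚ.≤ seq c m
    0≤c = proj₂ (≤⇒eventually {1ℝ} {c} 1≤c 1ℚ (ℚₚ.positive⁻¹ 1ℚ))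

    NQ : ℕ
    NQ = proj₁ (archimedean Q)

    Q≤n : ∀ {n} → NQ ℕ.≤ n → Q ℚ.≤ ι n
    Q≤n NQ≤n = ℚₚ.≤-trans (proj₂ (archimedean Q)) (ι-mono NQ≤n)

  colourable-whp : (d : ℕ → ℝ) → IsColouringThreshold 3 d → (d⁻ : ℝ) → IsLiminf d d⁻ → c < d⁻ →
                   HoldsWHP (λ n → c) (λ G → χ[ G ]≤ 3)
  colourable-whp d threshold d⁻ liminf (e , 0<e , N , c+e≤d⁻) =
    IsColouringThreshold.below threshold (fromℚ r) (λ _ → c) (r , 0<r , 0 , λ _ _ → ℚₚ.≤-reflexive (ℚₚ.+-identityˡ r))
      (N₁ ℕ.⊔ NQ , λ n le → eventually-≤⇒≤ 0ℝ c M₀ 0≤c ,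
        eventually-≤⇒≤ c (fromℕ n) MQ (λ m MQ≤m → ℚₚ.≤-trans (c≤Q m MQ≤m)
          (subst (Q ℚ.≤_) (ι≡/1 n) (Q≤n (ℕₚ.m⊔n≤o⇒n≤o N₁ NQ le)))) ,
        below n (d⁻-½e<d n (ℕₚ.m⊔n≤o⇒m≤o N₁ NQ le)))
    where
    open ℚₚ.≤-Reasoning

    0<½ : 0ℚ ℚ.< ½
    0<½ = ℚₚ.positive⁻¹ ½

    s : ℚ
    s = Q ℚ.+ ½ ℚ.* e

    0<½e : 0ℚ ℚ.< ½ ℚ.* e
    0<½e = 0<-* 0<½ 0<e

    0<¼e : 0ℚ ℚ.< ½ ℚ.* (½ ℚ.* e)
    0<¼e = 0<-* 0<½ 0<½e

    0<s : 0ℚ ℚ.< s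
    0<s = ℚₚ.+-mono-<-≤ 0<Q (ℚₚ.<⇒≤ 0<½e)

    -- The threshold needs a relative gap, while `c < d⁻` and the liminf give an absolute one, c +
    -- e/2 ≤ d n. As c + e/2 ≤ s, the loss r (c + e/2) is at most e/4, and e/4 remains as the strict
    -- margin.
    r : ℚ
    r = ½ ℚ.* (½ ℚ.* e) ℚ.* recip s 0<s

    0<r : 0ℚ ℚ.< r
    0<r = 0<-* 0<¼e (0<recip s 0<s)

    s*r : s ℚ.* r ≡ ½ ℚ.* (½ ℚ.* e)
    s*r = trans (solve 3 (λ s a b → s :* (a :* b) := a :* (s :* b)) refl s (½ ℚ.* (½ ℚ.* e)) (recip s 0<s))
      (trans (cong (½ ℚ.* (½ ℚ.* e) ℚ.*_) (*-recip s 0<s)) (ℚₚ.*-identityʳ (½ ℚ.* (½ ℚ.* e))))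

    r≤1 : r ℚ.≤ 1ℚ
    r≤1 = *-cancel 0<s (begin
      s ℚ.* r                  ≡⟨ s*r ⟩
      ½ ℚ.* (½ ℚ.* e)          ≤⟨ q≤p+q (ℚₚ.<⇒≤ 0<¼e) ⟩
      ½ ℚ.* (½ ℚ.* e) ℚ.+ ½ ℚ.* (½ ℚ.* e)
        ≡⟨ solve 1 (λ e → con ½ :* (con ½ :* e) :+ con ½ :* (con ½ :* e) := con ½ :* e) refl e ⟩
      ½ ℚ.* e                  ≤⟨ q≤p+q (ℚₚ.<⇒≤ 0<Q) ⟩
      s                        ≡⟨ ℚₚ.*-identityʳ s ⟨
      s ℚ.* 1ℚ                 ∎)

    above : Eventually (λ n → d⁻ - fromℚ (½ ℚ.* e) < d n)
    above = IsLiminf.eventually-above liminf (fromℚ (½ ℚ.* e)) (½ ℚ.* e , 0<½e , 0 , λ _ _ → ℚₚ.≤-reflexive (ℚₚ.+-identityˡ (½ ℚ.* e)))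

    N₁ : ℕ
    N₁ = proj₁ above

    d⁻-½e<d : ∀ n → N₁ ℕ.≤ n → d⁻ - fromℚ (½ ℚ.* e) < d n
    d⁻-½e<d = proj₂ above

    below : ∀ n → d⁻ - fromℚ (½ ℚ.* e) < d n → c < (1ℝ - fromℚ r) * d n
    below n (e′ , 0<e′ , N′ , d⁻≤d) = ½ ℚ.* (½ ℚ.* e) , 0<¼e , N ℕ.⊔ (N′ ℕ.⊔ MQ) , λ m le → begin
      seq c m ℚ.+ ½ ℚ.* (½ ℚ.* e)
        ≡⟨ solve 2 (λ c e → c :+ con ½ :* (con ½ :* e) := c :+ con ½ :* e :- con ½ :* (con ½ :* e)) refl (seq c m) e ⟩
      seq c m ℚ.+ ½ ℚ.* e ℚ.- ½ ℚ.* (½ ℚ.* e)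
        ≡⟨ cong (λ z → seq c m ℚ.+ ½ ℚ.* e ℚ.- z) s*r ⟨
      seq c m ℚ.+ ½ ℚ.* e ℚ.- s ℚ.* r
        ≤⟨ ℚₚ.+-monoʳ-≤ (seq c m ℚ.+ ½ ℚ.* e) (ℚₚ.neg-antimono-≤ (*-monoˡ (ℚₚ.<⇒≤ 0<r)
             (ℚₚ.+-monoˡ-≤ (½ ℚ.* e) (c≤Q m (ℕₚ.m⊔n≤o⇒n≤o N′ MQ (ℕₚ.m⊔n≤o⇒n≤o N (N′ ℕ.⊔ MQ) le)))))) ⟩
      seq c m ℚ.+ ½ ℚ.* e ℚ.- (seq c m ℚ.+ ½ ℚ.* e) ℚ.* r
        ≡⟨ solve 2 (λ x r → x :- x :* r := (con 1ℚ :- r) :* x) refl (seq c m ℚ.+ ½ ℚ.* e) r ⟩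
      (1ℚ ℚ.- r) ℚ.* (seq c m ℚ.+ ½ ℚ.* e)
        ≤⟨ *-monoʳ (0≤q-p r≤1) (c+½e≤d m (ℕₚ.m⊔n≤o⇒m≤o N (N′ ℕ.⊔ MQ) le) (ℕₚ.m⊔n≤o⇒m≤o N′ MQ (ℕₚ.m⊔n≤o⇒n≤o N (N′ ℕ.⊔ MQ) le))) ⟩
      (1ℚ ℚ.- r) ℚ.* seq (d n) m  ∎
      where
      c+½e≤d : ∀ m → N ℕ.≤ m → N′ ℕ.≤ m → seq c m ℚ.+ ½ ℚ.* e ℚ.≤ seq (d n) m
      c+½e≤d m N≤m N′≤m = begin
        seq c m ℚ.+ ½ ℚ.* e
          ≡⟨ solve 2 (λ c e → c :+ con ½ :* e := c :+ e :- con ½ :* e) refl (seq c m) e ⟩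
        seq c m ℚ.+ e ℚ.- ½ ℚ.* e
          ≤⟨ ℚₚ.+-monoˡ-≤ (ℚ.- (½ ℚ.* e)) (c+e≤d⁻ m N≤m) ⟩
        seq d⁻ m ℚ.- ½ ℚ.* e
          ≤⟨ p≤p+q (ℚₚ.<⇒≤ 0<e′) ⟩
        seq d⁻ m ℚ.- ½ ℚ.* e ℚ.+ e′
          ≤⟨ d⁻≤d m N′≤m ⟩
        seq (d n) m  ∎

  disconnected-whp : HoldsWHP (λ n → c) (λ G → χ[ G ]≤ 3) → HoldsWHP (λ n → c) (λ G → HomDisconnected G (K 3))
  disconnected-whp (A , A-sound , A-whp) = B , B-sound , B-whp
    where
    B : ∀ n → EdgeBits n → Bool
    B n ω = A n ω ∧ hasOddCycle ω

    B-sound : ∀ n ω → T (B n ω) → HomDisconnected (graph ω) (K 3)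
    B-sound n ω t = let a , has = Equivalence.to (T-∧ {A n ω}) t
                    in hasOddCycle⇒disconnected ω has (χ≤3⇒Colourable {G = graph ω} (A-sound n ω a))

    B-whp : ∀ ε → 0ℝ < ε → ∃[ N ] ∀ n .{{_ : NonZero n}} → N ℕ.≤ n → ∣ Pr (c /ℕ n) (B n) - 1ℝ ∣< ε
    -- The successor rules out n = 0, so that the division is by `suc n`.
    B-whp ε (ε₀ , 0<ε₀ , N₀ , ε₀≤ε) = suc (NA ℕ.⊔ (NC ℕ.⊔ NQ)) , λ { (suc n) le → close n (ℕₚ.≤-trans (ℕₚ.n≤1+n _) le) }
      where
      open ℚₚ.≤-Reasoning

      -- One quarter for the failure of `A` and one for the absence of odd cycles; the remaining
      -- half is the strict margin.
      ¼ε₀ : ℚ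
      ¼ε₀ = ½ ℚ.* (½ ℚ.* ε₀)

      0<¼ε₀ : 0ℚ ℚ.< ¼ε₀
      0<¼ε₀ = 0<-* (ℚₚ.positive⁻¹ ½) (0<-* (ℚₚ.positive⁻¹ ½) 0<ε₀)

      A-close : ∃[ N ] ∀ n .{{_ : NonZero n}} → N ℕ.≤ n → ∣ Pr (c /ℕ n) (A n) - 1ℝ ∣< fromℚ ¼ε₀
      A-close = A-whp (fromℚ ¼ε₀) (¼ε₀ , 0<¼ε₀ , 0 , λ _ _ → ℚₚ.≤-reflexive (ℚₚ.+-identityˡ ¼ε₀))

      cycles = no-odd-cycle-rare Q ¼ε₀ 0<¼ε₀

      NA NC : ℕ
      NA = proj₁ A-close
      NC = proj₁ cycles

      η : ℚ
      η = proj₁ (proj₂ cycles)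

      c≥1-η : ∃[ M ] ∀ m → M ℕ.≤ m → 1ℚ ℚ.- η ℚ.≤ seq c m
      c≥1-η = ≤⇒eventually {1ℝ} {c} 1≤c η (proj₁ (proj₂ (proj₂ cycles)))

      module _ (n : ℕ) (le : NA ℕ.⊔ (NC ℕ.⊔ NQ) ℕ.≤ suc n) where

        P : ℝ
        P = c /ℕ suc n

        -- A single late term p of the sequence c / n, where the probabilities are compared over the
        -- rationals.
        module _ (m : ℕ) (M₀≤m : M₀ ℕ.≤ m) (MQ≤m : MQ ℕ.≤ m) (Mη≤m : proj₁ c≥1-η ℕ.≤ m) where

          p : ℚ
          p = seq P m

          np≡c : ι (suc n) ℚ.* p ≡ seq c m
          np≡c = ι*[x/n]≡x n (seq c m)

          0≤p : 0ℚ ℚ.≤ p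
          0≤p = *-cancel (0<ι n) (begin
            ι (suc n) ℚ.* 0ℚ   ≡⟨ ℚₚ.*-zeroʳ (ι (suc n)) ⟩
            0ℚ                 ≤⟨ 0≤c m M₀≤m ⟩
            seq c m            ≡⟨ np≡c ⟨
            ι (suc n) ℚ.* p    ∎)

          p≤1 : p ℚ.≤ 1ℚ
          p≤1 = *-cancel (0<ι n) (begin
            ι (suc n) ℚ.* p    ≡⟨ np≡c ⟩
            seq c m            ≤⟨ c≤Q m MQ≤m ⟩
            Q                  ≤⟨ Q≤n (ℕₚ.m⊔n≤o⇒n≤o NC NQ (ℕₚ.m⊔n≤o⇒n≤o NA (NC ℕ.⊔ NQ) le)) ⟩
            ι (suc n)          ≡⟨ ℚₚ.*-identityʳ (ι (suc n)) ⟨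
            ι (suc n) ℚ.* 1ℚ   ∎)

          B≤1 : seq (Pr P (B (suc n))) m ℚ.≤ 1ℚ
          B≤1 = subst (ℚ._≤ 1ℚ) (sym (seq-Pr P (B (suc n)) m)) (𝔼≤1 0≤p p≤1 (B (suc n)))

          1-B≤ : 1ℚ ℚ.- seq (Pr P (B (suc n))) m ℚ.≤ (1ℚ ℚ.- seq (Pr P (A (suc n))) m) ℚ.+ ¼ε₀
          1-B≤ = begin
            1ℚ ℚ.- seq (Pr P (B (suc n))) m
              ≡⟨ cong (ℚ._-_ 1ℚ) (seq-Pr P (B (suc n)) m) ⟩
            1ℚ ℚ.- 𝔼 p (λ ω → ⟦ A (suc n) ω ∧ hasOddCycle ω ⟧)
              ≤⟨ union-bound 0≤p p≤1 (A (suc n)) hasOddCycle ⟩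
            (1ℚ ℚ.- 𝔼 p (λ ω → ⟦ A (suc n) ω ⟧)) ℚ.+ 𝔼 {suc n} p (λ ω → ⟦ not (hasOddCycle ω) ⟧)
              ≤⟨ ℚₚ.+-mono-≤ (ℚₚ.≤-reflexive (cong (ℚ._-_ 1ℚ) (sym (seq-Pr P (A (suc n)) m))))
                   (proj₂ (proj₂ (proj₂ cycles)) (suc n) (ℕₚ.m⊔n≤o⇒m≤o NC NQ (ℕₚ.m⊔n≤o⇒n≤o NA (NC ℕ.⊔ NQ) le)) p 0≤p p≤1
                     (subst (1ℚ ℚ.- η ℚ.≤_) (sym np≡c) (proj₂ c≥1-η m Mη≤m))
                     (subst (ℚ._≤ Q) (sym np≡c) (c≤Q m MQ≤m))) ⟩
            (1ℚ ℚ.- seq (Pr P (A (suc n))) m) ℚ.+ ¼ε₀  ∎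

        M : ℕ → ℕ
        M k = (N₀ ℕ.⊔ k) ℕ.⊔ (M₀ ℕ.⊔ (MQ ℕ.⊔ proj₁ c≥1-η))

        module _ {k m : ℕ} (M≤m : M k ℕ.≤ m) where
          N₀⊔k≤m = ℕₚ.m⊔n≤o⇒m≤o (N₀ ℕ.⊔ k) (M₀ ℕ.⊔ (MQ ℕ.⊔ proj₁ c≥1-η)) M≤m
          rest≤m = ℕₚ.m⊔n≤o⇒n≤o (N₀ ℕ.⊔ k) (M₀ ℕ.⊔ (MQ ℕ.⊔ proj₁ c≥1-η)) M≤m
          N₀≤m = ℕₚ.m⊔n≤o⇒m≤o N₀ k N₀⊔k≤m
          k≤m = ℕₚ.m⊔n≤o⇒n≤o N₀ k N₀⊔k≤m
          M₀≤m = ℕₚ.m⊔n≤o⇒m≤o M₀ (MQ ℕ.⊔ proj₁ c≥1-η) rest≤m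
          rest′≤m = ℕₚ.m⊔n≤o⇒n≤o M₀ (MQ ℕ.⊔ proj₁ c≥1-η) rest≤m
          MQ≤m = ℕₚ.m⊔n≤o⇒m≤o MQ (proj₁ c≥1-η) rest′≤m
          Mη≤m = ℕₚ.m⊔n≤o⇒n≤o MQ (proj₁ c≥1-η) rest′≤m

        close : ∣ Pr P (B (suc n)) - 1ℝ ∣< ε
        close = upper , lower (proj₂ (proj₂ A-close (suc n) (ℕₚ.m⊔n≤o⇒m≤o NA (NC ℕ.⊔ NQ) le)))
          where
          upper : Pr P (B (suc n)) - 1ℝ < ε
          upper = ε₀ , 0<ε₀ , M 0 , λ m M≤m → begin
            seq (Pr P (B (suc n))) m ℚ.- 1ℚ ℚ.+ ε₀
              ≤⟨ ℚₚ.+-monoˡ-≤ ε₀ (ℚₚ.+-monoˡ-≤ (ℚ.- 1ℚ) (B≤1 m (M₀≤m M≤m) (MQ≤m {0} M≤m) (Mη≤m {0} M≤m))) ⟩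
            1ℚ ℚ.- 1ℚ ℚ.+ ε₀      ≤⟨ ε₀≤ε m (N₀≤m {0} M≤m) ⟩
            seq ε m               ∎

          lower : 1ℝ - Pr P (A (suc n)) < fromℚ ¼ε₀ → 1ℝ - Pr P (B (suc n)) < ε
          lower (e , 0<e , k , A≤) = ½ ℚ.* ε₀ , 0<-* (ℚₚ.positive⁻¹ ½) 0<ε₀ , M k , λ m M≤m → begin
            1ℚ ℚ.- seq (Pr P (B (suc n))) m ℚ.+ ½ ℚ.* ε₀
              ≤⟨ ℚₚ.+-monoˡ-≤ (½ ℚ.* ε₀) (1-B≤ m (M₀≤m {k} M≤m) (MQ≤m {k} M≤m) (Mη≤m {k} M≤m)) ⟩
            (1ℚ ℚ.- seq (Pr P (A (suc n))) m) ℚ.+ ¼ε₀ ℚ.+ ½ ℚ.* ε₀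
              ≤⟨ ℚₚ.+-monoˡ-≤ (½ ℚ.* ε₀) (ℚₚ.+-monoˡ-≤ ¼ε₀ (ℚₚ.≤-trans (p≤p+q {1ℚ ℚ.- seq (Pr P (A (suc n))) m} (ℚₚ.<⇒≤ 0<e)) (A≤ m (k≤m {k} M≤m)))) ⟩
            ¼ε₀ ℚ.+ ¼ε₀ ℚ.+ ½ ℚ.* ε₀
              ≡⟨ solve 1 (λ e → con ½ :* (con ½ :* e) :+ con ½ :* (con ½ :* e) :+ con ½ :* e := con 0ℚ :+ e) refl ε₀ ⟩
            0ℚ ℚ.+ ε₀             ≤⟨ ε₀≤ε m (N₀≤m {k} M≤m) ⟩
            seq ε m               ∎

theorem5p3 : (d₃ : ℕ → ℝ) → IsColouringThreshold 3 d₃ →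
    (d₃⁻ : ℝ) → IsLiminf d₃ d₃⁻ →
    (c : ℝ) → 1ℝ ≤ c → c < d₃⁻ →
    HoldsWHP (λ n → c) (λ G → HomDisconnected G (K 3))
theorem5p3 d₃ threshold d₃⁻ liminf c 1≤c c<d₃⁻ =
  disconnected-whp c 1≤c (colourable-whp c 1≤c d₃ threshold d₃⁻ liminf c<d₃⁻)
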